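{- Let $S$ be the species of split graphs, $U$ the species of unbalanced split graphs, $E$ the species of sets, and $X$ the species of singletons. Then, in the ring of virtual species, $$U = \frac{(2-X)\cdot E - 2}{(1-X)\cdot E}\cdot S.$$
   Context: Graphs are finite and simple (the graph with no vertices is allowed). A split graph is a graph whose vertices can be partitioned into two (possibly empty) sets $K$ and $S$ such that $K$ is a clique and $S$ is a stable (independent) set; such an ordered partition $(K,S)$ is called a $KS$-partition. A split graph is balanced if it has a unique $KS$-partition, and unbalanced otherwise. A (combinatorial) species $F$ is a functor from the category of finite sets with bijections to itself: it assigns to each finite set $I$ a finite set $F[I]$ of structures with label set $I$, and to each bijection $\varphi\colon I\to J$ a bijection $F[\varphi]\colon F[I]\to F[J]$, functorially. Isomorphic species (naturally equivalent functors) are regarded as equal. For a species of graphs with a certain isomorphism-invariant property, $F[I]$ is the set of such graphs with vertex set $I$, and $F[\varphi]$ replaces each label $i$ by $\varphi(i)$. The species of split graphs and of unbalanced split graphs are defined this way. Sum: $(F+G)[I]=F[I]\sqcup G[I]$. Product: $(F\cdot G)[I]$ is the set of pairs $(f,g)$ with $f\in F[V]$, $g\in G[W]$, over all ordered partitions $I=V\sqcup W$ (parts may be empty). The species $0$ has no structures; the species $1$ has exactly one structure on the empty set and none on nonempty sets; an integer $m\ge 0$ denotes $1+\cdots+1$ ($m$ times). $E$ is the species of sets: $E[I]=\{I\}$ for all finite $I$. $X$ is the species of singletons: $X[I]=\{I\}$ if $|I|=1$ and $X[I]=\varnothing$ otherwise. The ring of virtual species consists of formal differences $F^+-F^-$ of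 species, where $F^+-F^-$ and $G^+-G^-$ are identified when the species $F^++G^-$ and $G^++F^-$ are isomorphic; addition and multiplication extend those of species, with $0$ and $1$ as identities. A virtual species whose part of size $0$ is $1$ or $-1$ is a unit of this ring; for a unit $F$, $1/F$ denotes its multiplicative inverse, and fractions are written accordingly. (In particular $(1-X)\cdot E$ is a unit.) -}

module Defs where

open import Level using (0ℓ)
open import Algebra.Definitions using (Invertible)
open import Data.Bool.Base using (Bool; true; false)
import Data.Bool.Properties as Bool
open import Data.Empty using (⊥)
open import Data.Fin.Base using (Fin; zero; suc; combine; funToFin; finToFun)
import Data.Fin.Properties as Fin
open import Data.Fin.Permutation using (↔⇒≡)
open import Data.List.Base using (List; []; _∷_; map; concatMap; cartesianProductWith; deduplicate; allFin; lookup; length)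
import Data.List.Membership.Setoid as Membership
import Data.List.Membership.Setoid.Properties as Membershipₚ
open import Data.List.Membership.Propositional.Properties using (∈-allFin)
import Data.List.Relation.Unary.Any as Any
open import Data.List.Relation.Unary.Any using (here)
import Data.List.Relation.Unary.Any.Properties as Anyₚ
open import Data.List.Relation.Unary.Enumerates.Setoid using (IsEnumeration)
open import Data.List.Relation.Unary.Enumerates.Setoid.Properties using (deduplicate⁺)
import Data.List.Relation.Unary.Unique.DecSetoid.Properties as UniqueDec
open import Data.List.Relation.Unary.AllPairs using (AllPairs; _∷_)
import Data.List.Relation.Unary.All as All
open import Data.Nat.Base using (ℕ; zero; suc; _^_)
import Data.Nat.Properties as ℕ
open import Data.Product.Base using (Σ; ∃; ∃-syntax; _×_; _,_; proj₁; proj₂)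
open import Data.Sum.Base using (inj₁; inj₂)
open import Data.Sum.Function.Setoid using (_⊎-inverse_)
open import Data.Sum.Relation.Binary.Pointwise using (_⊎ₛ_; inj₁; inj₂; Pointwise-≡↔≡)
open import Data.Unit.Base using (⊤; tt)
open import Function.Base using (_∘_; id)
open import Function.Bundles using (Func; Inverse; _↔_; mk↔ₛ′)
open import Function.Construct.Composition using (inverse; _↔-∘_)
open import Function.Construct.Identity using (↔-id)
open import Function.Construct.Symmetry using (↔-sym)
open import Relation.Binary.Bundles using (Setoid; DecSetoid)
import Relation.Binary.Construct.On as On
open import Relation.Binary.Definitions using (Decidable)
open import Relation.Binary.PropositionalEquality
  using (_≡_; _≢_; _≗_; refl; sym; trans; cong; cong₂; setoid)
open import Axiom.UniquenessOfIdentityProofs using (module Decidable⇒UIP)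
import Relation.Binary.Reasoning.Setoid as ≈-Reasoning
open import Relation.Nullary using (¬_; Dec; yes; no; contradiction)
open import Relation.Nullary.Decidable using (map′; _×-dec_; _→-dec_; ¬?)
open import Relation.Unary using () renaming (Decidable to Decidable₁)

Finite : Setoid 0ℓ 0ℓ → Set
Finite A = ∃ λ n → Inverse A (setoid (Fin n))

module _ {A : Setoid 0ℓ 0ℓ} where
  open Setoid A using (Carrier; _≈_)

  finite⇒dec : Finite A → Decidable _≈_
  finite⇒dec (n , e) x y =
    map′ (λ p → Setoid.trans A (Setoid.sym A (strictlyInverseʳ x))
                  (Setoid.trans A (from-cong p) (strictlyInverseʳ y)))
         to-cong (to x Fin.≟ to y)
    where open Inverse e

  finite⇒list : Finite A → ∃ (IsEnumeration A)
  finite⇒list (n , e) = map from (allFin n) , λ x →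
    Membershipₚ.∈-resp-≈ A (strictlyInverseʳ x)
      (Membershipₚ.∈-map⁺ (setoid (Fin n)) A from-cong (∈-allFin (to x)))
    where open Inverse e

  lookup-injective : ∀ {xs} → AllPairs (λ x y → ¬ x ≈ y) xs →
                     ∀ i j → lookup xs i ≈ lookup xs j → i ≡ j
  lookup-injective (x≉ ∷ _) zero    zero    _ = refl
  lookup-injective (x≉ ∷ _) zero    (suc j) p =
    contradiction p (All.lookupₛ A resp x≉ (Membershipₚ.∈-lookup A _ j))
    where
    resp : ∀ {x y z} → y ≈ z → ¬ x ≈ y → ¬ x ≈ z
    resp y≈z x≉y x≈z = x≉y (Setoid.trans A x≈z (Setoid.sym A y≈z))
  lookup-injective (x≉ ∷ _) (suc i) zero    p =
    contradiction (Setoid.sym A p) (All.lookupₛ A resp x≉ (Membershipₚ.∈-lookup A _ i))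
    where
    resp : ∀ {x y z} → y ≈ z → ¬ x ≈ y → ¬ x ≈ z
    resp y≈z x≉y x≈z = x≉y (Setoid.trans A x≈z (Setoid.sym A y≈z))
  lookup-injective (_ ∷ u) (suc i) (suc j) p = cong suc (lookup-injective u i j p)

  enumerated⇒finite : Decidable _≈_ → ∃ (IsEnumeration A) → Finite A
  enumerated⇒finite _≟_ (xs₀ , ∈xs₀) = length xs , record
    { to        = λ x → Any.index (∈xs x)
    ; from      = lookup xs
    ; to-cong   = λ {x} {y} x≈y → inj
                    (A.trans (A.sym (at x)) (A.trans x≈y (at y)))
    ; from-cong = λ { refl → A.refl }
    ; inverse   = (λ {i} {x} x≈ → inj (A.trans (A.sym (at x)) x≈))
                , (λ { {x} refl → A.sym (at x) })
    }
    where
    module A = Setoid A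
    A? : DecSetoid 0ℓ 0ℓ
    A? = record { isDecEquivalence = record { isEquivalence = A.isEquivalence ; _≟_ = _≟_ } }
    xs = deduplicate _≟_ xs₀
    ∈xs : IsEnumeration A xs
    ∈xs = deduplicate⁺ A? ∈xs₀
    at : ∀ x → x ≈ lookup xs (Any.index (∈xs x))
    at x = Anyₚ.lookup-index (∈xs x)
    inj : ∀ {i j} → lookup xs i ≈ lookup xs j → i ≡ j
    inj = lookup-injective (UniqueDec.deduplicate-! A? xs₀) _ _

  any? : Finite A → {P : Carrier → Set} → (∀ {x y} → x ≈ y → P x → P y) →
         Decidable₁ P → Dec (∃ P)
  any? (n , e) resp P? =
    map′ (λ (i , p) → from i , p)
         (λ (x , p) → to x , resp (Setoid.sym A (strictlyInverseʳ x)) p)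
         (Fin.any? (P? ∘ from))
    where open Inverse e

  all? : Finite A → {P : Carrier → Set} → (∀ {x y} → x ≈ y → P x → P y) →
         Decidable₁ P → Dec (∀ x → P x)
  all? (n , e) resp P? =
    map′ (λ h x → resp (strictlyInverseʳ x) (h (to x))) (λ h i → h (from i))
         (Fin.all? (P? ∘ from))
    where open Inverse e

finite-fibred : (A C : Setoid 0ℓ 0ℓ) → Finite A → Decidable (Setoid._≈_ C) →
  (key : Setoid.Carrier C → Setoid.Carrier A)
  (over : Setoid.Carrier A → List (Setoid.Carrier C)) →
  (∀ c a → Setoid._≈_ A (key c) a → Membership._∈_ C c (over a)) →
  Finite C
finite-fibred A C finA dec key over covers =
  enumerated⇒finite dec
    ( concatMap over (proj₁ (finite⇒list finA))
    , λ c → Anyₚ.concatMap⁺ over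
        (Any.map (λ {a} → covers c a) (proj₂ (finite⇒list finA) (key c))))

finite-subset : (A C : Setoid 0ℓ 0ℓ) → Finite A →
  (key : Setoid.Carrier C → Setoid.Carrier A) →
  (∀ {c d} → Setoid._≈_ C c d → Setoid._≈_ A (key c) (key d)) →
  (∀ {c d} → Setoid._≈_ A (key c) (key d) → Setoid._≈_ C c d) →
  (∀ a → Dec (∃[ c ] Setoid._≈_ A (key c) a)) →
  Finite C
finite-subset A C finA key key-cong key-inj image? =
  finite-fibred A C finA
    (λ c d → map′ key-inj key-cong (finite⇒dec finA (key c) (key d)))
    key (λ a → over (image? a)) (λ c a p → covers c a p (image? a))
  where
  over : ∀ {a} → Dec (∃[ c ] Setoid._≈_ A (key c) a) → List (Setoid.Carrier C)
  over (yes (c , _)) = c ∷ []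
  over (no _)        = []
  covers : ∀ c a → Setoid._≈_ A (key c) a → ∀ im → Membership._∈_ C c (over {a} im)
  covers c a p (yes (d , q)) = here (key-inj (Setoid.trans A p (Setoid.sym A q)))
  covers c a p (no ¬im)      = contradiction (c , p) ¬im

finite-Bool : Finite (setoid Bool)
finite-Bool = 2 , ↔-sym Fin.2↔Bool

record FinSet : Set₁ where
  field
    Elem   : Set
    finite : Finite (setoid Elem)

  ∣_∣ : ℕ
  ∣_∣ = proj₁ finite

open FinSet public using (Elem; ∣_∣)

-- Morphisms of finite sets; two of them are regarded as equal when they agree
-- pointwise.

infix 4 _≃_
infixr 9 _∘≃_

record _≃_ (I J : FinSet) : Set where
  constructor mk≃
  field
    bijection : Elem I ↔ Elem J

  open Inverse bijection public using () renaming
    (to to fwd; from to bwd; strictlyInverseˡ to fwd-bwd; strictlyInverseʳ to bwd-fwd)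

open _≃_ public

id≃ : ∀ {I} → I ≃ I
id≃ = mk≃ (↔-id _)

sym≃ : ∀ {I J} → I ≃ J → J ≃ I
sym≃ (mk≃ φ) = mk≃ (↔-sym φ)

_∘≃_ : ∀ {I J K} → J ≃ K → I ≃ J → I ≃ K
mk≃ ψ ∘≃ mk≃ φ = mk≃ (ψ ↔-∘ φ)

∣∣-cong : ∀ {I J} → I ≃ J → ∣ I ∣ ≡ ∣ J ∣
∣∣-cong {I} {J} (mk≃ φ) =
  ↔⇒≡ (proj₂ (FinSet.finite J) ↔-∘ (φ ↔-∘ ↔-sym (proj₂ (FinSet.finite I))))

Maps : FinSet → Setoid 0ℓ 0ℓ → Setoid 0ℓ 0ℓ
Maps I B = record
  { Carrier       = Elem I → Setoid.Carrier B
  ; _≈_           = λ f g → ∀ i → Setoid._≈_ B (f i) (g i)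
  ; isEquivalence = record
    { refl  = λ _ → Setoid.refl B
    ; sym   = λ p i → Setoid.sym B (p i)
    ; trans = λ p q i → Setoid.trans B (p i) (q i)
    }
  }

finite-Maps : ∀ I {B} → Finite B → Finite (Maps I B)
finite-Maps I {B} (b , β) = b ^ ∣ I ∣ , record
  { to        = encode
  ; from      = decode
  ; to-cong   = encode-cong
  ; from-cong = λ { refl → Setoid.refl (Maps I B) }
  ; inverse   =
      (λ {k} p → trans (encode-cong p) (encode-decode k))
    , (λ { {f} refl i → decode-encode f i })
  }
  where
  module β = Inverse β
  module ι = Inverse (proj₂ (FinSet.finite I))
  encode : (Elem I → Setoid.Carrier B) → Fin (b ^ ∣ I ∣)
  encode f = funToFin (λ k → β.to (f (ι.from k)))
  decode : Fin (b ^ ∣ I ∣) → Elem I → Setoid.Carrier B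
  decode k i = β.from (finToFun k (ι.to i))
  funToFin-cong : ∀ {m n} {f g : Fin m → Fin n} → f ≗ g → funToFin f ≡ funToFin g
  funToFin-cong {zero}  p = refl
  funToFin-cong {suc m} p = cong₂ combine (p zero) (funToFin-cong (p ∘ suc))
  encode-cong : ∀ {f g} → (∀ i → Setoid._≈_ B (f i) (g i)) → encode f ≡ encode g
  encode-cong p = funToFin-cong (λ k → β.to-cong (p (ι.from k)))
  encode-decode : ∀ k → encode (decode k) ≡ k
  encode-decode k = trans
    (funToFin-cong λ l → trans (β.strictlyInverseˡ _) (cong (finToFun k) (ι.strictlyInverseˡ l)))
    (Fin.funToFin-finToFin {∣ I ∣} {b} k)
  decode-encode : ∀ f i → Setoid._≈_ B (decode (encode f) i) (f i)
  decode-encode f i = Setoid.trans B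
    (β.from-cong (trans (Fin.finToFun-funToFin _ (ι.to i))
      (cong (β.to ∘ f) (ι.strictlyInverseʳ i))))
    (β.strictlyInverseʳ (f i))

-- χ : Elem I → Bool encodes the ordered partition I = V ⊔ W with
-- V = part I χ true and W = part I χ false.

PartElem : (I : FinSet) → (Elem I → Bool) → Bool → Set
PartElem I χ b = Σ (Elem I) λ i → χ i ≡ b

PartElem-≡ : ∀ {I χ b} {x y : PartElem I χ b} → proj₁ x ≡ proj₁ y → x ≡ y
PartElem-≡ {x = i , p} {y = .i , q} refl = cong (i ,_) (Decidable⇒UIP.≡-irrelevant Bool._≟_ p q)

-- Left transparent, this proof makes comparing the finite sets part I χ b
-- prohibitively expensive.

abstract
  finite-PartElem : ∀ I χ b → Finite (setoid (PartElem I χ b))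
  finite-PartElem I χ b =
    finite-subset (setoid (Elem I)) _ (FinSet.finite I) proj₁ (cong proj₁)
      (PartElem-≡ {I})
      (λ i → map′ (λ p → (i , p) , refl) (λ { ((_ , p) , refl) → p }) (χ i Bool.≟ b))

part : (I : FinSet) → (Elem I → Bool) → Bool → FinSet
part I χ b = record { Elem = PartElem I χ b ; finite = finite-PartElem I χ b }

restrict : ∀ {I J} (φ : I ≃ J) {χ : Elem I → Bool} {χ′ : Elem J → Bool} →
           (∀ i → χ′ (fwd φ i) ≡ χ i) → ∀ b → part I χ b ≃ part J χ′ b
restrict {I} {J} φ {χ} {χ′} e b = mk≃ (mk↔ₛ′
  (λ (i , p) → fwd φ i , trans (e i) p)
  (λ (j , p) → bwd φ j , trans (sym (e (bwd φ j))) (trans (cong χ′ (fwd-bwd φ j)) p))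
  (λ (j , p) → PartElem-≡ {J} (fwd-bwd φ j))
  (λ (i , p) → PartElem-≡ {I} (bwd-fwd φ i)))

-- F [ I ] is a finite setoid: two structures count as the same when they are
-- related by its equality (for graphs: same adjacency), since functions are not
-- extensional here. The relabellings are bijections by functoriality; see
-- relabel-bijection.

record Species : Set₁ where
  infix 9 _[_] _⟪_⟫

  field
    _[_]     : FinSet → Setoid 0ℓ 0ℓ
    finite   : ∀ I → Finite (_[_] I)
    relabel  : ∀ {I J} → I ≃ J → Func (_[_] I) (_[_] J)

  _⟪_⟫ : ∀ {I J} → I ≃ J → Setoid.Carrier (_[_] I) → Setoid.Carrier (_[_] J)
  _⟪_⟫ φ = Func.to (relabel φ)

  field
    relabel-resp : ∀ {I J} {φ ψ : I ≃ J} → (∀ i → fwd φ i ≡ fwd ψ i) →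
                   ∀ s → Setoid._≈_ (_[_] J) (_⟪_⟫ φ s) (_⟪_⟫ ψ s)
    relabel-id   : ∀ {I} s → Setoid._≈_ (_[_] I) (_⟪_⟫ id≃ s) s
    relabel-∘    : ∀ {I J K} (φ : I ≃ J) (ψ : J ≃ K) s →
                   Setoid._≈_ (_[_] K) (_⟪_⟫ (ψ ∘≃ φ) s) (_⟪_⟫ ψ (_⟪_⟫ φ s))

  relabel-cong : ∀ {I J} (φ : I ≃ J) {s t} → Setoid._≈_ (_[_] I) s t →
                 Setoid._≈_ (_[_] J) (_⟪_⟫ φ s) (_⟪_⟫ φ t)
  relabel-cong φ = Func.cong (relabel φ)

  relabel-bijection : ∀ {I J} → I ≃ J → Inverse (_[_] I) (_[_] J)
  relabel-bijection {I} {J} φ = record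
    { to        = _⟪_⟫ φ
    ; from      = _⟪_⟫ (sym≃ φ)
    ; to-cong   = relabel-cong φ
    ; from-cong = relabel-cong (sym≃ φ)
    ; inverse   =
        (λ p → J.trans (relabel-cong φ p) (J.trans (J.sym (relabel-∘ (sym≃ φ) φ _))
                 (J.trans (relabel-resp (fwd-bwd φ) _) (relabel-id _))))
      , (λ p → I.trans (relabel-cong (sym≃ φ) p) (I.trans (I.sym (relabel-∘ φ (sym≃ φ) _))
                 (I.trans (relabel-resp (bwd-fwd φ) _) (relabel-id _))))
    }
    where
    module I = Setoid (_[_] I)
    module J = Setoid (_[_] J)

open Species public using (_[_]; _⟪_⟫)

Structure : Species → FinSet → Set
Structure F I = Setoid.Carrier (F [ I ])

infix 4 _≅_

record _≅_ (F G : Species) : Set₁ where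
  field
    iso     : ∀ I → Inverse (F [ I ]) (G [ I ])
    natural : ∀ {I J} (φ : I ≃ J) (s : Structure F I) →
              Setoid._≈_ (G [ J ]) (Inverse.to (iso J) ((F ⟪ φ ⟫) s))
                                   ((G ⟪ φ ⟫) (Inverse.to (iso I) s))

0ˢ : Species
0ˢ = record
  { _[_]         = λ _ → setoid ⊥
  ; finite       = λ _ → 0 , mk↔ₛ′ (λ ()) (λ ()) (λ ()) (λ ())
  ; relabel      = λ _ → record { to = id ; cong = id }
  ; relabel-resp = λ _ _ → refl
  ; relabel-id   = λ _ → refl
  ; relabel-∘    = λ _ _ _ → refl
  }

-- The only structure tt on I stands for I itself.

Eˢ : Species
Eˢ = record
  { _[_]         = λ _ → setoid ⊤
  ; finite       = λ _ → 1 , mk↔ₛ′ (λ _ → zero) (λ _ → tt) (λ { zero → refl }) (λ _ → refl)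
  ; relabel      = λ _ → record { to = id ; cong = id }
  ; relabel-resp = λ _ _ → refl
  ; relabel-id   = λ _ → refl
  ; relabel-∘    = λ _ _ _ → refl
  }

-- One structure on each set of size n (a proof that the size is n, which is
-- unique) and none on the others.

Sets-of-size : ℕ → Species
Sets-of-size n = record
  { _[_]         = λ I → setoid (∣ I ∣ ≡ n)
  ; finite       = λ I → enumerated⇒finite (λ p q → yes (ℕ.≡-irrelevant p q)) (enum I)
  ; relabel      = λ φ → record
                     { to   = trans (sym (∣∣-cong φ))
                     ; cong = cong (trans (sym (∣∣-cong φ)))
                     }
  ; relabel-resp = λ _ _ → ℕ.≡-irrelevant _ _
  ; relabel-id   = λ _ → ℕ.≡-irrelevant _ _
  ; relabel-∘    = λ _ _ _ → ℕ.≡-irrelevant _ _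
  }
  where
  enum : ∀ I → ∃ (IsEnumeration (setoid (∣ I ∣ ≡ n)))
  enum I with ∣ I ∣ ℕ.≟ n
  ... | yes p = p ∷ [] , λ q → here (ℕ.≡-irrelevant q p)
  ... | no ¬p = []     , λ q → contradiction q ¬p

1ˢ : Species
1ˢ = Sets-of-size 0

Xˢ : Species
Xˢ = Sets-of-size 1

infixl 6 _+ˢ_
infixl 7 _*ˢ_

_+ˢ_ : Species → Species → Species
F +ˢ G = record
  { _[_]         = λ I → (F [ I ]) ⊎ₛ (G [ I ])
  ; finite       = λ I → let (m , e) = F.finite I ; (n , f) = G.finite I in
                     _ , inverse (e ⊎-inverse f)
                           (inverse (Pointwise-≡↔≡ (Fin m) (Fin n)) (↔-sym Fin.+↔⊎))
  ; relabel      = λ φ → record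
                     { to   = λ { (inj₁ s) → inj₁ ((F ⟪ φ ⟫) s) ; (inj₂ t) → inj₂ ((G ⟪ φ ⟫) t) }
                     ; cong = λ { (inj₁ p) → inj₁ (F.relabel-cong φ p)
                                ; (inj₂ p) → inj₂ (G.relabel-cong φ p) }
                     }
  ; relabel-resp = λ p → λ { (inj₁ s) → inj₁ (F.relabel-resp p s)
                           ; (inj₂ t) → inj₂ (G.relabel-resp p t) }
  ; relabel-id   = λ { (inj₁ s) → inj₁ (F.relabel-id s) ; (inj₂ t) → inj₂ (G.relabel-id t) }
  ; relabel-∘    = λ φ ψ → λ { (inj₁ s) → inj₁ (F.relabel-∘ φ ψ s)
                             ; (inj₂ t) → inj₂ (G.relabel-∘ φ ψ t) }
  }
  where
  module F = Species F
  module G = Species G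

module Restriction (F : Species) where
  open Species F hiding (_[_]; _⟪_⟫)

  restrict-id : ∀ {I} (φ : I ≃ I) {χ : Elem I → Bool} (e : ∀ i → χ (fwd φ i) ≡ χ i) b →
    (∀ i → fwd φ i ≡ i) → ∀ s →
    Setoid._≈_ (F [ part I χ b ]) ((F ⟪ restrict φ e b ⟫) s) s
  restrict-id {I} φ {χ} e b p s = Setoid.trans (F [ part I χ b ])
    (relabel-resp (λ (i , _) → PartElem-≡ {I} (p i)) s) (relabel-id s)

  restrict-∘ : ∀ {I J K} (φ : I ≃ J) (ψ : J ≃ K) (θ : I ≃ K)
    {χ : Elem I → Bool} {χ′ : Elem J → Bool} {χ″ : Elem K → Bool}
    (e : ∀ i → χ′ (fwd φ i) ≡ χ i) (e′ : ∀ j → χ″ (fwd ψ j) ≡ χ′ j)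
    (e″ : ∀ i → χ″ (fwd θ i) ≡ χ i) b →
    (∀ i → fwd ψ (fwd φ i) ≡ fwd θ i) → ∀ s →
    Setoid._≈_ (F [ part K χ″ b ])
      ((F ⟪ restrict ψ e′ b ⟫) ((F ⟪ restrict φ e b ⟫) s)) ((F ⟪ restrict θ e″ b ⟫) s)
  restrict-∘ {K = K} φ ψ θ {χ″ = χ″} e e′ e″ b p s = Setoid.trans (F [ part K χ″ b ])
    (Setoid.sym (F [ part K χ″ b ]) (relabel-∘ (restrict φ e b) (restrict ψ e′ b) s))
    (relabel-resp (λ (i , _) → PartElem-≡ {K} (p i)) s)

  -- An identification f ≈ f′ over χ′ ≡ χ of structures on parts of I is carried
  -- along φ : I ≃ J.

  restrict-square : ∀ {I J} (φ ψ : I ≃ J) {χ χ′ : Elem I → Bool} {ξ ξ′ : Elem J → Bool}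
    (e : ∀ i → ξ (fwd φ i) ≡ χ i) (e′ : ∀ i → ξ′ (fwd ψ i) ≡ χ′ i)
    (p : ∀ i → χ′ i ≡ χ i) (q : ∀ j → ξ′ j ≡ ξ j) b →
    (∀ i → fwd φ i ≡ fwd ψ i) → ∀ {f f′} →
    Setoid._≈_ (F [ part I χ′ b ]) ((F ⟪ restrict id≃ p b ⟫) f) f′ →
    Setoid._≈_ (F [ part J ξ′ b ])
      ((F ⟪ restrict id≃ q b ⟫) ((F ⟪ restrict φ e b ⟫) f)) ((F ⟪ restrict ψ e′ b ⟫) f′)
  restrict-square {J = J} φ ψ {ξ′ = ξ′} e e′ p q b φ≗ψ {f} {f′} f≈f′ = begin
    (F ⟪ restrict id≃ q b ⟫) ((F ⟪ restrict φ e b ⟫) f)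
      ≈⟨ restrict-∘ φ id≃ ψ e q (λ i → trans (e′ i) (p i)) b φ≗ψ f ⟩
    (F ⟪ restrict ψ (λ i → trans (e′ i) (p i)) b ⟫) f
      ≈⟨ restrict-∘ id≃ ψ ψ p e′ (λ i → trans (e′ i) (p i)) b (λ _ → refl) f ⟨
    (F ⟪ restrict ψ e′ b ⟫) ((F ⟪ restrict id≃ p b ⟫) f)
      ≈⟨ relabel-cong (restrict ψ e′ b) f≈f′ ⟩
    (F ⟪ restrict ψ e′ b ⟫) f′ ∎
    where open ≈-Reasoning (F [ part J ξ′ b ])

  restrict-sym : ∀ {I} {χ χ′ : Elem I → Bool} (p : ∀ i → χ′ i ≡ χ i) b {f f′} →
    Setoid._≈_ (F [ part I χ′ b ]) ((F ⟪ restrict id≃ p b ⟫) f) f′ →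
    Setoid._≈_ (F [ part I χ b ]) ((F ⟪ restrict id≃ (sym ∘ p) b ⟫) f′) f
  restrict-sym {I} {χ} p b {f} {f′} f≈f′ = begin
    (F ⟪ restrict id≃ (sym ∘ p) b ⟫) f′
      ≈⟨ relabel-cong (restrict id≃ (sym ∘ p) b) f≈f′ ⟨
    (F ⟪ restrict id≃ (sym ∘ p) b ⟫) ((F ⟪ restrict id≃ p b ⟫) f)
      ≈⟨ restrict-∘ id≃ id≃ id≃ p (sym ∘ p) (λ _ → refl) b (λ _ → refl) f ⟩
    (F ⟪ restrict id≃ {χ} (λ _ → refl) b ⟫) f
      ≈⟨ restrict-id id≃ (λ _ → refl) b (λ _ → refl) f ⟩
    f ∎
    where open ≈-Reasoning (F [ part I χ b ])

  restrict-trans : ∀ {I} {χ χ′ χ″ : Elem I → Bool}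
    (p : ∀ i → χ′ i ≡ χ i) (p′ : ∀ i → χ″ i ≡ χ′ i) b {f f′ f″} →
    Setoid._≈_ (F [ part I χ′ b ]) ((F ⟪ restrict id≃ p b ⟫) f) f′ →
    Setoid._≈_ (F [ part I χ″ b ]) ((F ⟪ restrict id≃ p′ b ⟫) f′) f″ →
    Setoid._≈_ (F [ part I χ″ b ])
      ((F ⟪ restrict id≃ (λ i → trans (p′ i) (p i)) b ⟫) f) f″
  restrict-trans {I} {χ″ = χ″} p p′ b {f} {f′} {f″} u u′ = begin
    (F ⟪ restrict id≃ (λ i → trans (p′ i) (p i)) b ⟫) f
      ≈⟨ restrict-∘ id≃ id≃ id≃ p p′ (λ i → trans (p′ i) (p i)) b (λ _ → refl) f ⟨
    (F ⟪ restrict id≃ p′ b ⟫) ((F ⟪ restrict id≃ p b ⟫) f)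
      ≈⟨ relabel-cong (restrict id≃ p′ b) u ⟩
    (F ⟪ restrict id≃ p′ b ⟫) f′
      ≈⟨ u′ ⟩
    f″ ∎
    where open ≈-Reasoning (F [ part I χ″ b ])

  restrict-irr : ∀ {I} {χ χ′ : Elem I → Bool} (p q : ∀ i → χ′ i ≡ χ i) b f →
    Setoid._≈_ (F [ part I χ′ b ])
      ((F ⟪ restrict id≃ p b ⟫) f) ((F ⟪ restrict id≃ q b ⟫) f)
  restrict-irr {I} p q b f = relabel-resp (λ _ → PartElem-≡ {I} refl) f

module Product (F G : Species) where
  private
    module F = Species F
    module G = Species G
    module RF = Restriction F
    module RG = Restriction G

  record Pair (I : FinSet) : Set where
    constructor pair
    field
      χ : Elem I → Bool
      f : Structure F (part I χ true)
      g : Structure G (part I χ false)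

  open Pair public

  -- Equality of the triples (χ , f , g): the partitions agree, and f and g agree
  -- once moved along the resulting identity bijections between the parts.

  record _≈ᵖ_ {I : FinSet} (s t : Pair I) : Set where
    constructor pair≈
    field
      χ≗ : ∀ i → χ t i ≡ χ s i
      f≈ : Setoid._≈_ (F [ part I (χ t) true ])  ((F ⟪ restrict id≃ χ≗ true ⟫)  (f s)) (f t)
      g≈ : Setoid._≈_ (G [ part I (χ t) false ]) ((G ⟪ restrict id≃ χ≗ false ⟫) (g s)) (g t)

  Pairs : FinSet → Setoid 0ℓ 0ℓ
  Pairs I = record
    { Carrier       = Pair I
    ; _≈_           = _≈ᵖ_
    ; isEquivalence = record
      { refl  = pair≈ (λ _ → refl) (RF.restrict-id id≃ _ true  (λ _ → refl) _)
                                   (RG.restrict-id id≃ _ false (λ _ → refl) _)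
      ; sym   = λ (pair≈ p u v) → pair≈ (sym ∘ p)
          (RF.restrict-sym p true u) (RG.restrict-sym p false v)
      ; trans = λ (pair≈ p u v) (pair≈ p′ u′ v′) → pair≈ (λ i → trans (p′ i) (p i))
          (RF.restrict-trans p p′ true u u′) (RG.restrict-trans p p′ false v v′)
      }
    }

  move : ∀ {I J} → I ≃ J → Pair I → Pair J
  move {I} {J} φ (pair χ f g) =
    pair (χ ∘ bwd φ) ((F ⟪ restrict φ χ-fwd true ⟫) f) ((G ⟪ restrict φ χ-fwd false ⟫) g)
    where
    χ-fwd : ∀ i → χ (bwd φ (fwd φ i)) ≡ χ i
    χ-fwd i = cong χ (bwd-fwd φ i)

  move-cong : ∀ {I J} (φ : I ≃ J) {s t} → s ≈ᵖ t → move φ s ≈ᵖ move φ t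
  move-cong φ (pair≈ p u v) = pair≈ (p ∘ bwd φ)
    (RF.restrict-square φ φ _ _ p _ true  (λ _ → refl) u)
    (RG.restrict-square φ φ _ _ p _ false (λ _ → refl) v)

  move-resp : ∀ {I J} {φ ψ : I ≃ J} → (∀ i → fwd φ i ≡ fwd ψ i) →
              ∀ s → move φ s ≈ᵖ move ψ s
  move-resp {I} {J} {φ} {ψ} φ≗ψ (pair χ f g) = pair≈ bwd≗
    (RF.restrict-square φ ψ _ _ (λ _ → refl) _ true  φ≗ψ (RF.restrict-id id≃ _ true  (λ _ → refl) f))
    (RG.restrict-square φ ψ _ _ (λ _ → refl) _ false φ≗ψ (RG.restrict-id id≃ _ false (λ _ → refl) g))
    where
    bwd≗ : ∀ j → χ (bwd ψ j) ≡ χ (bwd φ j)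
    bwd≗ j = cong χ (trans (cong (bwd ψ) (trans (sym (fwd-bwd φ j)) (φ≗ψ (bwd φ j))))
                           (bwd-fwd ψ (bwd φ j)))

  move-id : ∀ {I} (s : Pair I) → move id≃ s ≈ᵖ s
  move-id {I} (pair χ f g) = pair≈ (λ _ → refl)
    (Setoid.trans (F [ part I χ true ])  (RF.restrict-id id≃ _ true  (λ _ → refl) _)
                                         (RF.restrict-id id≃ _ true  (λ _ → refl) f))
    (Setoid.trans (G [ part I χ false ]) (RG.restrict-id id≃ _ false (λ _ → refl) _)
                                         (RG.restrict-id id≃ _ false (λ _ → refl) g))

  move-∘ : ∀ {I J K} (φ : I ≃ J) (ψ : J ≃ K) (s : Pair I) →
           move (ψ ∘≃ φ) s ≈ᵖ move ψ (move φ s)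
  move-∘ {I} {J} {K} φ ψ (pair χ f g) = pair≈ (λ _ → refl)
    (F′.trans (RF.restrict-id id≃ _ true (λ _ → refl) _)
              (F′.sym (RF.restrict-∘ φ ψ (ψ ∘≃ φ) _ _ _ true (λ _ → refl) f)))
    (G′.trans (RG.restrict-id id≃ _ false (λ _ → refl) _)
              (G′.sym (RG.restrict-∘ φ ψ (ψ ∘≃ φ) _ _ _ false (λ _ → refl) g)))
    where
    module F′ = Setoid (F [ part K (χ ∘ bwd φ ∘ bwd ψ) true ])
    module G′ = Setoid (G [ part K (χ ∘ bwd φ ∘ bwd ψ) false ])

  _≈ᵖ?_ : ∀ {I} → Decidable (_≈ᵖ_ {I})
  _≈ᵖ?_ {I} s t with all? (FinSet.finite I) (λ { refl → id }) (λ i → χ t i Bool.≟ χ s i)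
  ... | no ¬p = no (¬p ∘ _≈ᵖ_.χ≗)
  ... | yes p = map′
    (λ (u , v) → pair≈ p u v)
    (λ (pair≈ q u v) →
        Setoid.trans (F [ part I (χ t) true ])  (RF.restrict-irr p q true  (f s)) u
      , Setoid.trans (G [ part I (χ t) false ]) (RG.restrict-irr p q false (g s)) v)
    (finite⇒dec (F.finite (part I (χ t) true))
                ((F ⟪ restrict id≃ p true ⟫) (f s)) (f t)
     ×-dec
     finite⇒dec (G.finite (part I (χ t) false))
                ((G ⟪ restrict id≃ p false ⟫) (g s)) (g t))

  finite-Pairs : ∀ I → Finite (Pairs I)
  finite-Pairs I =
    finite-fibred (Maps I (setoid Bool)) (Pairs I) (finite-Maps I finite-Bool) _≈ᵖ?_ χ over covers
    where
    Fs : ∀ χ → ∃ (IsEnumeration (F [ part I χ true ]))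
    Fs χ = finite⇒list (F.finite (part I χ true))
    Gs : ∀ χ → ∃ (IsEnumeration (G [ part I χ false ]))
    Gs χ = finite⇒list (G.finite (part I χ false))
    over : (Elem I → Bool) → List (Pair I)
    over χ = cartesianProductWith (pair χ) (proj₁ (Fs χ)) (proj₁ (Gs χ))
    covers : ∀ s χ′ → (∀ i → χ s i ≡ χ′ i) → Membership._∈_ (Pairs I) s (over χ′)
    covers s χ′ p = Membershipₚ.∈-resp-≈ (Pairs I)
      (Setoid.sym (Pairs I) (pair≈ (sym ∘ p) (Setoid.refl (F [ part I χ′ true ]))
                                             (Setoid.refl (G [ part I χ′ false ]))))
      (Membershipₚ.∈-cartesianProductWith⁺ (F [ part I χ′ true ]) (G [ part I χ′ false ]) (Pairs I)
        (λ u v → pair≈ (λ _ → refl)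
          (Setoid.trans (F [ part I χ′ true ])  (RF.restrict-id id≃ _ true  (λ _ → refl) _) u)
          (Setoid.trans (G [ part I χ′ false ]) (RG.restrict-id id≃ _ false (λ _ → refl) _) v))
        (proj₂ (Fs χ′) _) (proj₂ (Gs χ′) _))

_*ˢ_ : Species → Species → Species
F *ˢ G = record
  { _[_]         = Pairs
  ; finite       = finite-Pairs
  ; relabel      = λ φ → record { to = move φ ; cong = move-cong φ }
  ; relabel-resp = λ {_} {_} {φ} {ψ} → move-resp {φ = φ} {ψ}
  ; relabel-id   = move-id
  ; relabel-∘    = move-∘
  }
  where open Product F G

record Virtual : Set₁ where
  constructor _⊖_
  field
    pos neg : Species

open Virtual public

infix  4 _≈_
infixl 6 _+_ _-_
infixl 7 _*_ _/_

_≈_ : Virtual → Virtual → Set₁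
F ≈ G = pos F +ˢ neg G ≅ pos G +ˢ neg F

_+_ : Virtual → Virtual → Virtual
F + G = (pos F +ˢ pos G) ⊖ (neg F +ˢ neg G)

_-_ : Virtual → Virtual → Virtual
F - G = (pos F +ˢ neg G) ⊖ (neg F +ˢ pos G)

_*_ : Virtual → Virtual → Virtual
F * G = (pos F *ˢ pos G +ˢ neg F *ˢ neg G) ⊖ (pos F *ˢ neg G +ˢ neg F *ˢ pos G)

virtual : Species → Virtual
virtual F = F ⊖ 0ˢ

𝟙 𝟚 X E : Virtual
𝟙 = virtual 1ˢ
𝟚 = virtual (1ˢ +ˢ 1ˢ)
X = virtual Xˢ
E = virtual Eˢ

record IsUnit (F : Virtual) : Set₁ where
  field
    invertible : Invertible _≈_ 𝟙 _*_ F

  _⁻¹ : Virtual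
  _⁻¹ = proj₁ invertible

_/_ : (G F : Virtual) → ⦃ IsUnit F ⦄ → Virtual
(G / F) ⦃ unit ⦄ = G * IsUnit._⁻¹ unit

record Graph (I : FinSet) : Set where
  constructor graph
  field
    adj     : Elem I → Elem I → Bool
    adj-sym : ∀ i j → adj i j ≡ adj j i
    no-loop : ∀ i → adj i i ≡ false

open Graph public

-- κ i ≡ true means i ∈ K, and κ i ≡ false means i ∈ S.

record IsKSPartition {I} (g : Graph I) (κ : Elem I → Bool) : Set where
  constructor ks
  field
    clique : ∀ i j → κ i ≡ true → κ j ≡ true → i ≢ j → adj g i j ≡ true
    stable : ∀ i j → κ i ≡ false → κ j ≡ false → adj g i j ≡ false

IsSplit : ∀ {I} → Graph I → Set
IsSplit g = ∃[ κ ] IsKSPartition g κ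

IsBalanced : ∀ {I} → Graph I → Set
IsBalanced g = ∃[ κ ] IsKSPartition g κ × (∀ κ′ → IsKSPartition g κ′ → κ′ ≗ κ)

IsUnbalanced : ∀ {I} → Graph I → Set
IsUnbalanced g = IsSplit g × ¬ IsBalanced g

IsGraphIso : ∀ {I J} → I ≃ J → Graph I → Graph J → Set
IsGraphIso φ g h = ∀ i j → adj h (fwd φ i) (fwd φ j) ≡ adj g i j

record GraphProperty : Set₁ where
  field
    Holds     : ∀ {I} → Graph I → Set
    holds?    : ∀ {I} (g : Graph I) → Dec (Holds g)
    invariant : ∀ {I J} (φ : I ≃ J) {g : Graph I} {h : Graph J} →
                IsGraphIso φ g h → Holds g → Holds h

relabelGraph : ∀ {I J} → I ≃ J → Graph I → Graph J
relabelGraph φ g = record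
  { adj     = λ i j → adj g (bwd φ i) (bwd φ j)
  ; adj-sym = λ i j → adj-sym g (bwd φ i) (bwd φ j)
  ; no-loop = λ i → no-loop g (bwd φ i)
  }

GraphsWith : GraphProperty → Species
GraphsWith P = record
  { _[_]         = Graphs
  ; finite       = λ I → finite-subset (Adj I) (Graphs I)
      (finite-Maps I (finite-Maps I finite-Bool)) (adj ∘ proj₁) id id (image? I)
  ; relabel      = λ φ → record
      { to   = λ (g , p) → relabelGraph φ g , invariant φ {g}
                 (λ i j → cong₂ (adj g) (bwd-fwd φ i) (bwd-fwd φ j)) p
      ; cong = λ g≈h i j → g≈h (bwd φ i) (bwd φ j)
      }
  ; relabel-resp = λ {_} {_} {φ} {ψ} φ≗ψ (g , _) i j →
      cong₂ (adj g) (bwd≗ {φ = φ} {ψ} φ≗ψ i) (bwd≗ {φ = φ} {ψ} φ≗ψ j)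
  ; relabel-id   = λ _ _ _ → refl
  ; relabel-∘    = λ _ _ _ _ _ → refl
  }
  where
  open GraphProperty P
  Adj : FinSet → Setoid 0ℓ 0ℓ
  Adj I = Maps I (Maps I (setoid Bool))
  Graphs : FinSet → Setoid 0ℓ 0ℓ
  Graphs I = On.setoid {B = Σ (Graph I) Holds} (Adj I) (adj ∘ proj₁)
  bwd≗ : ∀ {I J} {φ ψ : I ≃ J} → (∀ i → fwd φ i ≡ fwd ψ i) → ∀ j → bwd φ j ≡ bwd ψ j
  bwd≗ {φ = φ} {ψ} φ≗ψ j = trans (sym (bwd-fwd ψ (bwd φ j)))
    (cong (bwd ψ) (trans (sym (φ≗ψ (bwd φ j))) (fwd-bwd φ j)))
  simple? : ∀ I (a : Elem I → Elem I → Bool) →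
            Dec ((∀ i j → a i j ≡ a j i) × (∀ i → a i i ≡ false))
  simple? I a =
    all? (FinSet.finite I) (λ { refl → id }) (λ i →
      all? (FinSet.finite I) (λ { refl → id }) (λ j → a i j Bool.≟ a j i))
    ×-dec all? (FinSet.finite I) (λ { refl → id }) (λ i → a i i Bool.≟ false)
  image? : ∀ I a → Dec (∃[ c ] Setoid._≈_ (Adj I) (adj (proj₁ c)) a)
  image? I a with simple? I a
  ... | no ¬s = no λ ((g , _) , e) → ¬s
    ( (λ i j → trans (sym (e i j)) (trans (adj-sym g i j) (e j i)))
    , (λ i → trans (sym (e i i)) (no-loop g i)))
  ... | yes (s , l) = map′
    (λ p → (graph a s l , p) , λ _ _ → refl)
    (λ ((g , p) , e) → invariant id≃ {g} (λ i j → sym (e i j)) p)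
    (holds? (graph a s l))

isKSPartition? : ∀ {I} (g : Graph I) κ → Dec (IsKSPartition g κ)
isKSPartition? {I} g κ = map′ (λ (c , s) → ks c s) (λ (ks c s) → c , s)
  ( ∀? (λ i → ∀? λ j → (κ i Bool.≟ true) →-dec ((κ j Bool.≟ true) →-dec
      (¬? (finite⇒dec (FinSet.finite I) i j) →-dec (adj g i j Bool.≟ true))))
  ×-dec
    ∀? (λ i → ∀? λ j → (κ i Bool.≟ false) →-dec ((κ j Bool.≟ false) →-dec
      (adj g i j Bool.≟ false))))
  where
  ∀? : ∀ {P : Elem I → Set} → Decidable₁ P → Dec (∀ i → P i)
  ∀? = all? (FinSet.finite I) (λ { refl → id })

isKSPartition-resp : ∀ {I} (g : Graph I) {κ κ′} → κ ≗ κ′ →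
                     IsKSPartition g κ → IsKSPartition g κ′
isKSPartition-resp g p (ks c s) = ks
  (λ i j u v → c i j (trans (p i) u) (trans (p j) v))
  (λ i j u v → s i j (trans (p i) u) (trans (p j) v))

isKSPartition-iso : ∀ {I J} (φ : I ≃ J) (g : Graph I) (h : Graph J) → IsGraphIso φ g h →
  ∀ {κ} → IsKSPartition g κ → IsKSPartition h (κ ∘ bwd φ)
isKSPartition-iso φ g h iso (ks c s) = ks
  (λ i j u v i≢j → trans (adj-bwd i j) (c (bwd φ i) (bwd φ j) u v (λ e → i≢j
    (trans (sym (fwd-bwd φ i)) (trans (cong (fwd φ) e) (fwd-bwd φ j))))))
  (λ i j u v → trans (adj-bwd i j) (s (bwd φ i) (bwd φ j) u v))
  where
  adj-bwd : ∀ i j → adj h i j ≡ adj g (bwd φ i) (bwd φ j)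
  adj-bwd i j = trans (sym (cong₂ (adj h) (fwd-bwd φ i) (fwd-bwd φ j)))
                      (iso (bwd φ i) (bwd φ j))

isGraphIso-sym : ∀ {I J} (φ : I ≃ J) (g : Graph I) (h : Graph J) →
                 IsGraphIso φ g h → IsGraphIso (sym≃ φ) h g
isGraphIso-sym φ g h iso i j =
  trans (sym (iso (bwd φ i) (bwd φ j))) (cong₂ (adj h) (fwd-bwd φ i) (fwd-bwd φ j))

split? : ∀ {I} (g : Graph I) → Dec (IsSplit g)
split? {I} g = any? (finite-Maps I finite-Bool) (isKSPartition-resp g) (isKSPartition? g)

balanced? : ∀ {I} (g : Graph I) → Dec (IsBalanced g)
balanced? {I} g = any? finB resp λ κ → isKSPartition? g κ ×-dec
  all? finB {λ κ′ → IsKSPartition g κ′ → κ′ ≗ κ}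
    (λ p h k i → trans (sym (p i)) (h (isKSPartition-resp g (sym ∘ p) k) i))
    (λ κ′ → isKSPartition? g κ′ →-dec finite⇒dec finB κ′ κ)
  where
  finB = finite-Maps I finite-Bool
  resp : ∀ {κ λ′ : Elem I → Bool} → κ ≗ λ′ →
    IsKSPartition g κ × (∀ κ′ → IsKSPartition g κ′ → κ′ ≗ κ) →
    IsKSPartition g λ′ × (∀ κ′ → IsKSPartition g κ′ → κ′ ≗ λ′)
  resp p (k , u) = isKSPartition-resp g p k , λ κ′ k′ i → trans (u κ′ k′ i) (p i)

split-iso : ∀ {I J} (φ : I ≃ J) (g : Graph I) (h : Graph J) → IsGraphIso φ g h →
            IsSplit g → IsSplit h
split-iso φ g h iso (κ , k) = κ ∘ bwd φ , isKSPartition-iso φ g h iso k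

balanced-iso : ∀ {I J} (φ : I ≃ J) (g : Graph I) (h : Graph J) → IsGraphIso φ g h →
               IsBalanced g → IsBalanced h
balanced-iso φ g h iso (κ , k , u) =
  κ ∘ bwd φ , isKSPartition-iso φ g h iso k , λ κ′ k′ j →
    trans (sym (cong κ′ (fwd-bwd φ j)))
      (u (κ′ ∘ fwd φ) (isKSPartition-iso (sym≃ φ) h g (isGraphIso-sym φ g h iso) k′) (bwd φ j))

S U : Virtual
S = virtual (GraphsWith record
  { Holds     = IsSplit
  ; holds?    = split?
  ; invariant = λ φ {g} {h} → split-iso φ g h
  })
U = virtual (GraphsWith record
  { Holds     = IsUnbalanced
  ; holds?    = λ g → split? g ×-dec ¬? (balanced? g)
  ; invariant = λ φ {g} {h} iso (s , ¬b) →
      split-iso φ g h iso s , ¬b ∘ balanced-iso (sym≃ φ) h g (isGraphIso-sym φ g h iso)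
  })

{-# OPTIONS --safe #-}
module Submission where

-- Let C be the species of split graphs with a chosen KS-partition, B that of
-- balanced split graphs, and call a vertex swing if it can change sides.
--
-- The KS-partitions of a split graph are the vertices of a star whose edges are the
-- swing vertices of the graph, and a graph with a swing vertex w amounts to a
-- KS-partitioned graph on the remaining vertices. As a star has one vertex more than
-- it has edges, S + X C = C; the centre of the star makes this bijection natural.
--
-- Removing all swing vertices on one side b from a KS-partition gives C = E N_b, with
-- N_b the KS-partitions without swing vertex in b. A KS-partition does not have swing
-- vertices in both K and S, so if W denotes those with one in K, then N_K + W = C and
-- B + W = N_S; hence B E + E C = E (B + W) + E N_K = 2 C. Together with U + B = S and
-- S = (1 - X) C this yields U (1 - X) E = ((2 - X) E - 2) S.
--
-- Virtual species form a ring because a common summand can be cancelled naturally, and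
-- (1 - X) E is invertible because 1 - G is, by Σ Gᵏ, whenever G has no structure on ∅.

open import Level using (Level; 0ℓ)
open import Algebra.Bundles using (CommutativeRing; CommutativeSemiring)
open import Algebra.Bundles.Raw using (RawRing)
open import Algebra.Core using (Op₁; Op₂)
open import Algebra.Definitions using (Invertible; RightCancellative)
import Algebra.Morphism.RingMonomorphism as RingMonomorphism
open import Algebra.Morphism.Structures using (IsRingMonomorphism)
import Algebra.Solver.Ring.NaturalCoefficients.Default as SemiringSolver
open import Algebra.Structures using (IsCommutativeRing; IsCommutativeSemiring)
open import Algebra.Structures.Biased using (isCommutativeSemiringˡ)
open import Data.Bool.Base using (Bool; true; false; not)
import Data.Bool.Properties as Bool
open import Data.Empty using (⊥; ⊥-elim)
open import Data.Fin.Base using (Fin; zero; suc; toℕ; fromℕ<; punchOut)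
open import Data.Fin.Permutation using (↔⇒≡)
import Data.Fin.Properties as Fin
open import Data.List.Base using (List; map)
import Data.List.Membership.Setoid as Membership
import Data.List.Membership.Setoid.Properties as Membershipₚ
open import Data.List.Relation.Unary.Enumerates.Setoid using (IsEnumeration)
open import Data.Nat.Base using (ℕ; zero; suc; _≤_; _<_; _≤′_; ≤′-refl; ≤′-step; z≤n; s≤s)
  renaming (_+_ to _ℕ+_)
import Data.Nat.Properties as ℕ
open import Data.Product.Base using (Σ; ∃; ∃-syntax; _×_; _,_; proj₁; proj₂)
open import Data.Sum.Base using (_⊎_; inj₁; inj₂)
open import Data.Sum.Relation.Binary.Pointwise using (_⊎ₛ_; inj₁; inj₂; drop-inj₁; drop-inj₂)
open import Data.Unit.Base using (tt)
open import Function.Base using (_∘_; id)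
open import Function.Bundles using (Equivalence; Func; Injection; Inverse; _⇔_; mk⇔; mk↔ₛ′)
import Function.Construct.Composition as Composition
open import Function.Construct.Identity using (↔-id)
import Function.Construct.Identity as Identity
import Function.Construct.Symmetry as Symmetry
open import Function.Properties.Inverse using (Inverse⇒Injection)
open import Relation.Binary.Bundles using (Setoid)
import Relation.Binary.Construct.On as On
open import Relation.Binary.Core using (Rel)
open import Relation.Binary.Definitions using (Decidable)
open import Relation.Binary.PropositionalEquality
  using (_≡_; _≢_; refl; sym; trans; cong; cong₂; subst; setoid)
import Relation.Binary.Reasoning.Setoid as ≈-Reasoning
open import Relation.Binary.Structures using (IsEquivalence)
open import Relation.Nullary using (¬_; Dec; yes; no; contradiction; does)
open import Relation.Nullary.Decidable
  using (decidable-stable; dec-true; does-⇔; map′; _×-dec_; _→-dec_; ¬?)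
open import Relation.Unary using () renaming (Decidable to Decidable₁)
open import Defs

open Product using (pair; pair≈)

-- The KS-partitions of a graph form a star because two of them never disagree at two vertices of
-- the same colour: these would be adjacent according to one partition and non-adjacent according to
-- the other. Hence two partitions differ at a single vertex, or exchange a vertex of K with one of
-- S, and an exchange factors through a third partition with both vertices on the same side. The
-- obstacle is that every bijection must commute with relabelling, so the centre has to be
-- determined without choice. For a graph with exactly two KS-partitions the star alone does not
-- distinguish its ends; the side of the only swing vertex breaks the tie. For the same reason a
-- vertex added as a leaf must get its side from the remaining partition alone. Storing the
-- partition on the diagonal of the adjacency matrix turns "v is swing" into the single condition
-- that row v equals the diagonal, for both sides at once.

private variable
  ℓ ℓ₁ ℓ₂ : Level

-- Identities and inverses in a commutative ring

module Fractions {A : Set ℓ₁} {_≈_ : Rel A ℓ} {_+_ _*_ : Op₂ A} { -_ : Op₁ A} {0# 1# : A}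
  (isCommutativeRing : IsCommutativeRing _≈_ _+_ _*_ -_ 0# 1#)
  {_-_ : Op₂ A} (sub : ∀ x y → (x - y) ≈ (x + (- y))) where

  private
    R : CommutativeRing _ _
    R = record { isCommutativeRing = isCommutativeRing }
    module R = CommutativeRing R
    open SemiringSolver R.commutativeSemiring using (solve; _:=_; _:+_; _:*_)
    open ≈-Reasoning R.setoid

  x-y+y≈x : ∀ x y → ((x - y) + y) ≈ x
  x-y+y≈x x y = begin
    (x - y) + y     ≈⟨ R.+-congʳ (sub x y) ⟩
    (x + (- y)) + y ≈⟨ R.+-assoc x (- y) y ⟩
    x + ((- y) + y) ≈⟨ R.+-congˡ (R.-‿inverseˡ y) ⟩
    x + 0#          ≈⟨ R.+-identityʳ x ⟩
    x               ∎

  +-cancelʳ : RightCancellative _≈_ _+_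
  +-cancelʳ z x y p = begin
    x               ≈⟨ x+z-z≈x x ⟨
    (x + z) + (- z) ≈⟨ R.+-congʳ p ⟩
    (y + z) + (- z) ≈⟨ x+z-z≈x y ⟩
    y               ∎
    where
    x+z-z≈x : ∀ x → ((x + z) + (- z)) ≈ x
    x+z-z≈x x = begin
      (x + z) + (- z) ≈⟨ R.+-assoc x z (- z) ⟩
      x + (z + (- z)) ≈⟨ R.+-congˡ (R.-‿inverseʳ z) ⟩
      x + 0#          ≈⟨ R.+-identityʳ x ⟩
      x               ∎

  x≈y+z⇒x-z≈y : ∀ {x y z} → x ≈ (y + z) → (x - z) ≈ y
  x≈y+z⇒x-z≈y {x} {y} {z} p = +-cancelʳ z _ _ (R.trans (x-y+y≈x x z) p)

  -- The series `l` is known only through its unfolding; cancelling `x l` suffices.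
  geometric : ∀ {x l} → l ≈ (1# + (x * l)) → ((1# - x) * l) ≈ 1#
  geometric {x} {l} p = +-cancelʳ (x * l) _ _ (begin
    ((1# - x) * l) + (x * l) ≈⟨ R.distribʳ l (1# - x) x ⟨
    ((1# - x) + x) * l       ≈⟨ R.*-congʳ (x-y+y≈x 1# x) ⟩
    1# * l                   ≈⟨ R.*-identityˡ l ⟩
    l                        ≈⟨ p ⟩
    1# + (x * l)             ∎)

  -- 1 / e = (1 - p) / (1 - p²) for e = 1 + p, and the geometric series inverts 1 - x
  -- and 1 - p².

  invertible : ∀ {x e p l m} → l ≈ (1# + (x * l)) → e ≈ (1# + p) → m ≈ (1# + ((p * p) * m)) →
               Invertible _≈_ 1# _*_ ((1# - x) * e)
  invertible {x} {e} {p} {l} {m} l≈ e≈ m≈ =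
    v , R.trans (R.*-comm _ _) vʳ , vʳ
    where
    d q r v : A
    d = 1# - x
    q = 1# - p
    r = 1# - (p * p)
    v = l * (q * m)
    -- The difference of squares (1 + p)(1 - p) = 1 - p², read as 1 = e q + p p so that the solver
    -- meets no subtraction.
    eq≈r : (e * q) ≈ r
    eq≈r = R.sym (x≈y+z⇒x-z≈y (begin
      1#                             ≈⟨ x-y+y≈x 1# p ⟨
      q + p                          ≈⟨ R.+-congˡ (R.*-identityʳ p) ⟨
      q + (p * 1#)                   ≈⟨ R.+-congˡ (R.*-congˡ (x-y+y≈x 1# p)) ⟨
      q + (p * (q + p))              ≈⟨ solve 2 (λ q p →
        q :+ p :* (q :+ p) := (q :+ p :* q) :+ p :* p) R.refl q p ⟩
      (q + (p * q)) + (p * p)        ≈⟨ R.+-congʳ (R.+-congʳ (R.*-identityˡ q)) ⟨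
      ((1# * q) + (p * q)) + (p * p) ≈⟨ R.+-congʳ (R.distribʳ q 1# p) ⟨
      ((1# + p) * q) + (p * p)       ≈⟨ R.+-congʳ (R.*-congʳ e≈) ⟨
      (e * q) + (p * p)              ∎))
    vʳ : ((d * e) * v) ≈ 1#
    vʳ = begin
      (d * e) * (l * (q * m))
        ≈⟨ solve 5 (λ d e l q m → (d :* e) :* (l :* (q :* m)) := (d :* l) :* ((e :* q) :* m))
             R.refl d e l q m ⟩
      (d * l) * ((e * q) * m)
        ≈⟨ R.*-cong (geometric l≈) (R.*-congʳ eq≈r) ⟩
      1# * (r * m)
        ≈⟨ R.*-identityˡ _ ⟩
      r * m
        ≈⟨ geometric m≈ ⟩
      1# ∎

  -- With `d = 1 - x` one has `s = d c` and `2 - x = 1 + d`, so `n s + 2 s = e s + d e s`. Writing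
  -- the first `s` as `d c` and the second as `u + b` collects `d (b e + e c) = 2 d c = 2 s` next to
  -- `u d e`, and `2 s` cancels.
  fraction : ∀ {b c e s t u x a⁻¹} → t ≈ (1# + 1#) → (s + (x * c)) ≈ c → (u + b) ≈ s →
    ((b * e) + (e * c)) ≈ (c + c) → (((1# - x) * e) * a⁻¹) ≈ 1# →
    u ≈ (((((t - x) * e) - t) * a⁻¹) * s)
  fraction {b} {c} {e} {s} {t} {u} {x} {a⁻¹} t≈ s+xc≈c u+b≈s be+ec≈2c a⁻¹ʳ = begin
    u                    ≈⟨ R.*-identityʳ u ⟨
    u * 1#               ≈⟨ R.*-congˡ a⁻¹ʳ ⟨
    u * ((d * e) * a⁻¹)  ≈⟨ R.*-assoc _ _ _ ⟨
    (u * (d * e)) * a⁻¹  ≈⟨ R.*-congʳ numerator ⟨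
    (n * s) * a⁻¹        ≈⟨ solve 3 (λ n s i → (n :* s) :* i := (n :* i) :* s) R.refl n s a⁻¹ ⟩
    (n * a⁻¹) * s        ∎
    where
    d n : A
    d = 1# - x
    n = ((t - x) * e) - t
    s≈dc : s ≈ (d * c)
    s≈dc = +-cancelʳ (x * c) _ _ (begin
      s + (x * c)       ≈⟨ s+xc≈c ⟩
      c                 ≈⟨ R.*-identityˡ c ⟨
      1# * c            ≈⟨ R.*-congʳ (x-y+y≈x 1# x) ⟨
      (d + x) * c       ≈⟨ R.distribʳ c d x ⟩
      (d * c) + (x * c) ∎)
    t-x≈1+d : (t - x) ≈ (1# + d)
    t-x≈1+d = x≈y+z⇒x-z≈y (begin
      t             ≈⟨ t≈ ⟩
      1# + 1#       ≈⟨ R.+-congˡ (x-y+y≈x 1# x) ⟨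
      1# + (d + x)  ≈⟨ R.+-assoc 1# d x ⟨
      (1# + d) + x  ∎)
    numerator : (n * s) ≈ (u * (d * e))
    numerator = +-cancelʳ (t * s) _ _ (begin
      (n * s) + (t * s)              ≈⟨ R.distribʳ s n t ⟨
      (n + t) * s                    ≈⟨ R.*-congʳ (x-y+y≈x _ t) ⟩
      ((t - x) * e) * s              ≈⟨ R.*-congʳ (R.*-congʳ t-x≈1+d) ⟩
      ((1# + d) * e) * s             ≈⟨ R.*-congʳ (R.distribʳ e 1# d) ⟩
      ((1# * e) + (d * e)) * s       ≈⟨ R.*-congʳ (R.+-congʳ (R.*-identityˡ e)) ⟩
      (e + (d * e)) * s              ≈⟨ R.distribʳ s e (d * e) ⟩
      (e * s) + ((d * e) * s)        ≈⟨ R.+-cong (R.*-congˡ s≈dc) (R.*-congˡ (R.sym u+b≈s)) ⟩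
      (e * (d * c)) + ((d * e) * (u + b))
        ≈⟨ solve 5 (λ b c d e u → e :* (d :* c) :+ (d :* e) :* (u :+ b)
             := u :* (d :* e) :+ d :* (b :* e :+ e :* c)) R.refl b c d e u ⟩
      (u * (d * e)) + (d * ((b * e) + (e * c)))
        ≈⟨ R.+-congˡ (R.*-congˡ be+ec≈2c) ⟩
      (u * (d * e)) + (d * (c + c))  ≈⟨ R.+-congˡ (R.distribˡ d c c) ⟩
      (u * (d * e)) + ((d * c) + (d * c))
        ≈⟨ R.+-congˡ (R.+-cong s≈dc s≈dc) ⟨
      (u * (d * e)) + (s + s)
        ≈⟨ R.+-congˡ (R.+-cong (R.*-identityˡ s) (R.*-identityˡ s)) ⟨
      (u * (d * e)) + ((1# * s) + (1# * s))
        ≈⟨ R.+-congˡ (R.distribʳ s 1# 1#) ⟨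
      (u * (d * e)) + ((1# + 1#) * s)
        ≈⟨ R.+-congˡ (R.*-congʳ t≈) ⟨
      (u * (d * e)) + (t * s) ∎)

-- Formal differences over a cancellative semiring

module Differences {A : Set ℓ₁} {_≈_ : Rel A ℓ} {_+_ _*_ : Op₂ A} {0# 1# : A}
  (isCommutativeSemiring : IsCommutativeSemiring _≈_ _+_ _*_ 0# 1#)
  (+-cancelʳ : RightCancellative _≈_ _+_) where

  private
    R : CommutativeSemiring _ _
    R = record { isCommutativeSemiring = isCommutativeSemiring }
    module R = CommutativeSemiring R
    open SemiringSolver R using (solve; _:=_; _:+_; _:*_; con)
    open ≈-Reasoning R.setoid

  infix  4 _∼_
  infixl 6 _⊕_
  infixl 7 _⊗_

  record Difference : Set ℓ₁ where
    constructor _⊟_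
    field
      posᴰ negᴰ : A

  open Difference

  _∼_ : Rel Difference ℓ
  F ∼ G = (posᴰ F + negᴰ G) ≈ (posᴰ G + negᴰ F)

  _⊕_ _⊗_ : Op₂ Difference
  F ⊕ G = (posᴰ F + posᴰ G) ⊟ (negᴰ F + negᴰ G)
  F ⊗ G = ((posᴰ F * posᴰ G) + (negᴰ F * negᴰ G)) ⊟ ((posᴰ F * negᴰ G) + (negᴰ F * posᴰ G))

  ⊝_ : Op₁ Difference
  ⊝ F = negᴰ F ⊟ posᴰ F

  0ᴰ 1ᴰ : Difference
  0ᴰ = 0# ⊟ 0#
  1ᴰ = 1# ⊟ 0#

  -- This is what cancellation is for: the middle difference `G` can only be removed from both
  -- sides.
  ∼-trans : ∀ {F G H} → F ∼ G → G ∼ H → F ∼ H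
  ∼-trans {F⁺ ⊟ F⁻} {G⁺ ⊟ G⁻} {H⁺ ⊟ H⁻} p q = +-cancelʳ (G⁺ + G⁻) _ _ (begin
    (F⁺ + H⁻) + (G⁺ + G⁻)
      ≈⟨ solve 4 (λ f h g g′ → (f :+ h) :+ (g :+ g′) := (f :+ g′) :+ (g :+ h))
           R.refl F⁺ H⁻ G⁺ G⁻ ⟩
    (F⁺ + G⁻) + (G⁺ + H⁻)
      ≈⟨ R.+-cong p q ⟩
    (G⁺ + F⁻) + (H⁺ + G⁻)
      ≈⟨ solve 4 (λ g f h g′ → (g :+ f) :+ (h :+ g′) := (h :+ f) :+ (g :+ g′))
           R.refl G⁺ F⁻ H⁺ G⁻ ⟩
    (H⁺ + F⁻) + (G⁺ + G⁻) ∎)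

  ∼-isEquivalence : IsEquivalence _∼_
  ∼-isEquivalence = record
    { refl  = R.refl
    ; sym   = R.sym
    ; trans = ∼-trans
    }

  ⊕-cong : ∀ {F F′ G G′} → F ∼ F′ → G ∼ G′ → F ⊕ G ∼ F′ ⊕ G′
  ⊕-cong {F⁺ ⊟ F⁻} {F′⁺ ⊟ F′⁻} {G⁺ ⊟ G⁻} {G′⁺ ⊟ G′⁻} p q = begin
    (F⁺ + G⁺) + (F′⁻ + G′⁻)
      ≈⟨ interchange F⁺ G⁺ F′⁻ G′⁻ ⟩
    (F⁺ + F′⁻) + (G⁺ + G′⁻)
      ≈⟨ R.+-cong p q ⟩
    (F′⁺ + F⁻) + (G′⁺ + G⁻)
      ≈⟨ interchange F′⁺ F⁻ G′⁺ G⁻ ⟩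
    (F′⁺ + G′⁺) + (F⁻ + G⁻) ∎
    where
    interchange : ∀ w x y z → ((w + x) + (y + z)) ≈ ((w + y) + (x + z))
    interchange = solve 4 (λ w x y z → (w :+ x) :+ (y :+ z) := (w :+ y) :+ (x :+ z)) R.refl

  ⊗-comm : ∀ F G → F ⊗ G ∼ G ⊗ F
  ⊗-comm (F⁺ ⊟ F⁻) (G⁺ ⊟ G⁻) =
    solve 4 (λ f f′ g g′ →
        (f :* g :+ f′ :* g′) :+ (g :* f′ :+ g′ :* f)
      := (g :* f :+ g′ :* f′) :+ (f :* g′ :+ f′ :* g)) R.refl F⁺ F⁻ G⁺ G⁻

  ⊗-congʳ : ∀ {F F′} G → F ∼ F′ → F ⊗ G ∼ F′ ⊗ G
  ⊗-congʳ {F⁺ ⊟ F⁻} {F′⁺ ⊟ F′⁻} (G⁺ ⊟ G⁻) p = begin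
    ((F⁺ * G⁺) + (F⁻ * G⁻)) + ((F′⁺ * G⁻) + (F′⁻ * G⁺))
      ≈⟨ regroup F⁺ F⁻ F′⁺ F′⁻ G⁺ G⁻ ⟩
    ((F⁺ + F′⁻) * G⁺) + ((F′⁺ + F⁻) * G⁻)
      ≈⟨ R.+-cong (R.*-congʳ p) (R.*-congʳ (R.sym p)) ⟩
    ((F′⁺ + F⁻) * G⁺) + ((F⁺ + F′⁻) * G⁻)
      ≈⟨ regroup F′⁺ F′⁻ F⁺ F⁻ G⁺ G⁻ ⟨
    ((F′⁺ * G⁺) + (F′⁻ * G⁻)) + ((F⁺ * G⁻) + (F⁻ * G⁺)) ∎
    where
    regroup : ∀ f f′ h h′ g g′ →
      (((f * g) + (f′ * g′)) + ((h * g′) + (h′ * g))) ≈ (((f + h′) * g) + ((h + f′) * g′))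
    regroup = solve 6 (λ f f′ h h′ g g′ →
        ((f :* g) :+ (f′ :* g′)) :+ ((h :* g′) :+ (h′ :* g))
      := ((f :+ h′) :* g) :+ ((h :+ f′) :* g′)) R.refl

  ⊗-cong : ∀ {F F′ G G′} → F ∼ F′ → G ∼ G′ → F ⊗ G ∼ F′ ⊗ G′
  ⊗-cong {F} {F′} {G} {G′} p q =
    ∼-trans (⊗-congʳ G p) (∼-trans (⊗-comm F′ G) (∼-trans (⊗-congʳ F′ q) (⊗-comm G′ F′)))

  ⊗-assoc : ∀ F G H → (F ⊗ G) ⊗ H ∼ F ⊗ (G ⊗ H)
  ⊗-assoc (F⁺ ⊟ F⁻) (G⁺ ⊟ G⁻) (H⁺ ⊟ H⁻) = solve 6 (λ f f′ g g′ h h′ →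
      ((f :* g :+ f′ :* g′) :* h :+ (f :* g′ :+ f′ :* g) :* h′)
        :+ (f :* (g :* h′ :+ g′ :* h) :+ f′ :* (g :* h :+ g′ :* h′))
    := (f :* (g :* h :+ g′ :* h′) :+ f′ :* (g :* h′ :+ g′ :* h))
        :+ ((f :* g :+ f′ :* g′) :* h′ :+ (f :* g′ :+ f′ :* g) :* h))
    R.refl F⁺ F⁻ G⁺ G⁻ H⁺ H⁻

  ⊗-distribˡ-⊕ : ∀ F G H → F ⊗ (G ⊕ H) ∼ F ⊗ G ⊕ F ⊗ H
  ⊗-distribˡ-⊕ (F⁺ ⊟ F⁻) (G⁺ ⊟ G⁻) (H⁺ ⊟ H⁻) = solve 6 (λ f f′ g g′ h h′ →
      (f :* (g :+ h) :+ f′ :* (g′ :+ h′))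
        :+ ((f :* g′ :+ f′ :* g) :+ (f :* h′ :+ f′ :* h))
    := ((f :* g :+ f′ :* g′) :+ (f :* h :+ f′ :* h′))
        :+ (f :* (g′ :+ h′) :+ f′ :* (g :+ h)))
    R.refl F⁺ F⁻ G⁺ G⁻ H⁺ H⁻

  ⊗-identityˡ : ∀ F → 1ᴰ ⊗ F ∼ F
  ⊗-identityˡ (F⁺ ⊟ F⁻) = solve 2 (λ f f′ →
      (con 1 :* f :+ con 0 :* f′) :+ f′ := f :+ (con 1 :* f′ :+ con 0 :* f)) R.refl F⁺ F⁻

  ⊕-assoc : ∀ F G H → (F ⊕ G) ⊕ H ∼ F ⊕ (G ⊕ H)
  ⊕-assoc (F⁺ ⊟ F⁻) (G⁺ ⊟ G⁻) (H⁺ ⊟ H⁻) =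
    R.+-cong (R.+-assoc _ _ _) (R.sym (R.+-assoc _ _ _))

  ⊕-comm : ∀ F G → F ⊕ G ∼ G ⊕ F
  ⊕-comm (F⁺ ⊟ F⁻) (G⁺ ⊟ G⁻) = R.+-cong (R.+-comm _ _) (R.+-comm _ _)

  ⊕-identityˡ : ∀ F → 0ᴰ ⊕ F ∼ F
  ⊕-identityˡ (F⁺ ⊟ F⁻) = R.+-cong (R.+-identityˡ _) (R.sym (R.+-identityˡ _))

  ⊕-inverseˡ : ∀ F → (⊝ F) ⊕ F ∼ 0ᴰ
  ⊕-inverseˡ (F⁺ ⊟ F⁻) = R.trans (R.+-comm _ _) (R.+-congˡ (R.+-comm _ _))

  ∼-isCommutativeRing : IsCommutativeRing _∼_ _⊕_ _⊗_ ⊝_ 0ᴰ 1ᴰ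
  ∼-isCommutativeRing = record
    { isRing = record
      { +-isAbelianGroup = record
        { isGroup = record
          { isMonoid = record
            { isSemigroup = record
              { isMagma = record { isEquivalence = ∼-isEquivalence ; ∙-cong = ⊕-cong }
              ; assoc   = ⊕-assoc
              }
            ; identity = ⊕-identityˡ
                       , λ F → ∼-trans (⊕-comm F 0ᴰ) (⊕-identityˡ F)
            }
          ; inverse = ⊕-inverseˡ
                    , λ F → ∼-trans (⊕-comm F (⊝ F)) (⊕-inverseˡ F)
          ; ⁻¹-cong = λ {F} {G} p → R.trans (R.+-comm (negᴰ F) (posᴰ G))
                                      (R.trans (R.sym p) (R.+-comm (posᴰ F) (negᴰ G)))
          }
        ; comm = ⊕-comm
        }
      ; *-cong     = ⊗-cong
      ; *-assoc    = ⊗-assoc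
      ; *-identity = ⊗-identityˡ
                   , λ F → ∼-trans (⊗-comm F 1ᴰ) (⊗-identityˡ F)
      ; distrib    = ⊗-distribˡ-⊕
                   , λ F G H → ∼-trans (⊗-comm (G ⊕ H) F) (∼-trans (⊗-distribˡ-⊕ F G H)
                                 (⊕-cong (⊗-comm F G) (⊗-comm F H)))
      }
    ; *-comm = ⊗-comm
    }

  be+ec≈c+c : ∀ {b c e n₀ n₁ w} → (b + w) ≈ n₀ → (n₁ + w) ≈ c →
    (e * n₀) ≈ c → (e * n₁) ≈ c → ((b * e) + (e * c)) ≈ (c + c)
  be+ec≈c+c {b} {c} {e} {n₀} {n₁} {w} b+w≈n₀ n₁+w≈c en₀≈c en₁≈c = begin
    (b * e) + (e * c)          ≈⟨ R.+-congˡ (R.*-congˡ n₁+w≈c) ⟨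
    (b * e) + (e * (n₁ + w))   ≈⟨ solve 4 (λ b e n w →
      b :* e :+ e :* (n :+ w) := e :* (b :+ w) :+ e :* n) R.refl b e n₁ w ⟩
    (e * (b + w)) + (e * n₁)   ≈⟨ R.+-cong (R.*-congˡ b+w≈n₀) en₁≈c ⟩
    (e * n₀) + c               ≈⟨ R.+-congʳ en₀≈c ⟩
    c + c                      ∎

  -- Isolates the unfolding of a concrete type of differences in the hypotheses,
  -- where it is shallow: unfolding sums and products of species is costly.

  module Presentation {V : Set ℓ₂} (pos⟨_⟩ neg⟨_⟩ : V → A)
    (_+ⱽ_ _-ⱽ_ _*ⱽ_ : Op₂ V) (-ⱽ_ : Op₁ V) (ι : A → V)
    (-ⱽ≡ : ∀ F G → F -ⱽ G ≡ F +ⱽ (-ⱽ G))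
    (pos-+ : ∀ F G → pos⟨ F +ⱽ G ⟩ ≡ pos⟨ F ⟩ + pos⟨ G ⟩)
    (neg-+ : ∀ F G → neg⟨ F +ⱽ G ⟩ ≡ neg⟨ F ⟩ + neg⟨ G ⟩)
    (pos-* : ∀ F G → pos⟨ F *ⱽ G ⟩ ≡ (pos⟨ F ⟩ * pos⟨ G ⟩) + (neg⟨ F ⟩ * neg⟨ G ⟩))
    (neg-* : ∀ F G → neg⟨ F *ⱽ G ⟩ ≡ (pos⟨ F ⟩ * neg⟨ G ⟩) + (neg⟨ F ⟩ * pos⟨ G ⟩))
    (pos-- : ∀ F → pos⟨ -ⱽ F ⟩ ≡ neg⟨ F ⟩)
    (neg-- : ∀ F → neg⟨ -ⱽ F ⟩ ≡ pos⟨ F ⟩)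
    (pos-ι : ∀ x → pos⟨ ι x ⟩ ≡ x) (neg-ι : ∀ x → neg⟨ ι x ⟩ ≡ 0#) where

    _≈ⱽ_ : Rel V ℓ
    F ≈ⱽ G = (pos⟨ F ⟩ + neg⟨ G ⟩) ≈ (pos⟨ G ⟩ + neg⟨ F ⟩)

    private
      ⟦_⟧ : V → Difference
      ⟦ F ⟧ = pos⟨ F ⟩ ⊟ neg⟨ F ⟩

      rawⱽ rawᴰ : RawRing _ _
      rawⱽ = record { _≈_ = _≈ⱽ_ ; _+_ = _+ⱽ_ ; _*_ = _*ⱽ_ ; -_ = -ⱽ_ ; 0# = ι 0# ; 1# = ι 1# }
      rawᴰ = record { _≈_ = _∼_ ; _+_ = _⊕_ ; _*_ = _⊗_ ; -_ = ⊝_ ; 0# = 0ᴰ ; 1# = 1ᴰ }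

      reflexive : ∀ {F G} → F ≡ G → F ∼ G
      reflexive refl = R.refl

      isRingMonomorphism : IsRingMonomorphism rawⱽ rawᴰ ⟦_⟧
      isRingMonomorphism = record
        { isRingHomomorphism = record
          { isSemiringHomomorphism = record
            { isNearSemiringHomomorphism = record
              { +-isMonoidHomomorphism = record
                { isMagmaHomomorphism = record
                  { isRelHomomorphism = record { cong = λ p → p }
                  ; homo = λ F G → reflexive (cong₂ _⊟_ (pos-+ F G) (neg-+ F G))
                  }
                ; ε-homo = reflexive (cong₂ _⊟_ (pos-ι 0#) (neg-ι 0#))
                }
              ; *-homo = λ F G → reflexive (cong₂ _⊟_ (pos-* F G) (neg-* F G))
              }
            ; 1#-homo = reflexive (cong₂ _⊟_ (pos-ι 1#) (neg-ι 1#))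
            }
          ; -‿homo = λ F → reflexive (cong₂ _⊟_ (pos-- F) (neg-- F))
          }
        ; injective = λ p → p
        }

    isCommutativeRing : IsCommutativeRing _≈ⱽ_ _+ⱽ_ _*ⱽ_ -ⱽ_ (ι 0#) (ι 1#)
    isCommutativeRing =
      RingMonomorphism.isCommutativeRing isRingMonomorphism ∼-isCommutativeRing

    ι-cong : ∀ {x y} → x ≈ y → ι x ≈ⱽ ι y
    ι-cong {x} {y} p rewrite pos-ι x | pos-ι y | neg-ι x | neg-ι y = R.+-congʳ p

    ι-+ : ∀ x y → ι (x + y) ≈ⱽ (ι x +ⱽ ι y)
    ι-+ x y rewrite pos-+ (ι x) (ι y) | neg-+ (ι x) (ι y) | pos-ι (x + y) | neg-ι (x + y)
                  | pos-ι x | pos-ι y | neg-ι x | neg-ι y = R.+-congˡ (R.+-identityˡ 0#)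

    ι-* : ∀ x y → ι (x * y) ≈ⱽ (ι x *ⱽ ι y)
    ι-* x y rewrite pos-* (ι x) (ι y) | neg-* (ι x) (ι y) | pos-ι (x * y) | neg-ι (x * y)
                  | pos-ι x | pos-ι y | neg-ι x | neg-ι y = begin
      (x * y) + ((x * 0#) + (0# * y)) ≈⟨ R.+-congˡ (R.+-cong (R.zeroʳ x) (R.zeroˡ y)) ⟩
      (x * y) + (0# + 0#)             ≈⟨ R.+-congˡ (R.+-congʳ (R.zeroˡ 0#)) ⟨
      (x * y) + ((0# * 0#) + 0#)      ≈⟨ R.+-assoc _ _ _ ⟨
      ((x * y) + (0# * 0#)) + 0#      ∎

    private
      module V = IsCommutativeRing isCommutativeRing
      open Fractions isCommutativeRing {_-ⱽ_} (λ F G → V.reflexive (-ⱽ≡ F G))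

    -- The equations for `i`, `x̂` and `ê` let the named constants `𝟙`, `X` and `E` be recognised as
    -- images under `ι` once, by `refl`.
    ι-invertible : ∀ {x e p l m i x̂ ê} → i ≡ ι 1# → x̂ ≡ ι x → ê ≡ ι e →
      l ≈ (1# + (x * l)) → e ≈ (1# + p) → m ≈ (1# + ((p * p) * m)) →
      Invertible _≈ⱽ_ i _*ⱽ_ ((i -ⱽ x̂) *ⱽ ê)
    ι-invertible {x} {e} {p} {l} {m} refl refl refl l≈ e≈ m≈ = invertible
      (V.trans (ι-cong+ l≈) (V.+-congˡ (ι-* x l)))
      (V.trans (ι-cong e≈) (ι-+ 1# p))
      (V.trans (ι-cong+ m≈) (V.+-congˡ (V.trans (ι-* (p * p) m) (V.*-congʳ (ι-* p p)))))
      where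
      ι-cong+ : ∀ {x y z} → x ≈ (y + z) → ι x ≈ⱽ (ι y +ⱽ ι z)
      ι-cong+ p = V.trans (ι-cong p) (ι-+ _ _)

    ι-fraction : ∀ {b c e s u x i t x̂ ê ŝ û a⁻¹ q} → i ≡ ι 1# → t ≡ ι (1# + 1#) →
      x̂ ≡ ι x → ê ≡ ι e → ŝ ≡ ι s → û ≡ ι u →
      (s + (x * c)) ≈ c → (u + b) ≈ s → ((b * e) + (e * c)) ≈ (c + c) →
      (((i -ⱽ x̂) *ⱽ ê) *ⱽ a⁻¹) ≈ⱽ i →
      q ≡ ((((t -ⱽ x̂) *ⱽ ê) -ⱽ t) *ⱽ a⁻¹) → û ≈ⱽ (q *ⱽ ŝ)
    ι-fraction {b} {c} {e} {s} {u} {x} refl refl refl refl refl refl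
      s+xc≈c u+b≈s be+ec≈2c a⁻¹ʳ refl = fraction
      (ι-+ 1# 1#)
      (V.trans (V.sym (V.trans (ι-+ s (x * c)) (V.+-congˡ (ι-* x c)))) (ι-cong s+xc≈c))
      (V.trans (V.sym (ι-+ u b)) (ι-cong u+b≈s))
      (V.trans (V.sym (V.trans (ι-+ (b * e) (e * c)) (V.+-cong (ι-* b e) (ι-* e c))))
        (V.trans (ι-cong be+ec≈2c) (ι-+ c c)))
      a⁻¹ʳ

-- Isomorphisms and sums of species

inverse-injective : ∀ {A B : Setoid 0ℓ 0ℓ} (e : Inverse A B) {x y} →
  Setoid._≈_ B (Inverse.to e x) (Inverse.to e y) → Setoid._≈_ A x y
inverse-injective e = Injection.injective (Inverse⇒Injection e)

module _ {F G : Species} where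
  private
    module F {I} = Setoid (F [ I ])
    module G {I} = Setoid (G [ I ])

  -- The preimages need not be chosen compatibly with equality or with relabelling: injectivity
  -- makes the inverse respect equality, and naturality is asked of the forward direction only.
  bijective⇒≅ : (to : ∀ {I} → Structure F I → Structure G I) →
    (∀ {I} {s t : Structure F I} → s F.≈ t → to s G.≈ to t) →
    (∀ {I J} (φ : I ≃ J) s → to ((F ⟪ φ ⟫) s) G.≈ (G ⟪ φ ⟫) (to s)) →
    (∀ {I} {s t : Structure F I} → to s G.≈ to t → s F.≈ t) →
    (∀ {I} (t : Structure G I) → ∃[ s ] to s G.≈ t) →
    F ≅ G
  bijective⇒≅ to to-cong to-natural to-injective to-surjective = record
    { iso     = λ I → record
      { to        = to
      ; from      = proj₁ ∘ to-surjective
      ; to-cong   = to-cong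
      ; from-cong = λ {t} {u} t≈u → to-injective
          (G.trans (proj₂ (to-surjective t)) (G.trans t≈u (G.sym (proj₂ (to-surjective u)))))
      ; inverse   =
          (λ {t} s≈ → G.trans (to-cong s≈) (proj₂ (to-surjective t)))
        , (λ {s} {t} t≈ → to-injective (G.trans (proj₂ (to-surjective t)) t≈))
      }
    ; natural = to-natural
    }

≅-refl : ∀ {F} → F ≅ F
≅-refl {F} = record
  { iso     = λ I → Identity.inverse (F [ I ])
  ; natural = λ {_} {J} _ _ → Setoid.refl (F [ J ])
  }

≅-sym : ∀ {F G} → F ≅ G → G ≅ F
≅-sym {F} {G} F≅G = record
  { iso     = λ I → Symmetry.inverse (iso I)
  ; natural = λ {I} {J} φ t → let open Setoid (F [ J ]) in
      Setoid.trans (F [ J ])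
        (from-cong (iso J) (Setoid.sym (G [ J ]) (Setoid.trans (G [ J ])
          (natural φ _) (Species.relabel-cong G φ (strictlyInverseˡ (iso I) t)))))
        (strictlyInverseʳ (iso J) _)
  }
  where
  open _≅_ F≅G
  open Inverse

≅-trans : ∀ {F G H} → F ≅ G → G ≅ H → F ≅ H
≅-trans {H = H} F≅G G≅H = record
  { iso     = λ I → Composition.inverse (F≅G.iso I) (G≅H.iso I)
  ; natural = λ {I} {J} φ s → Setoid.trans (H [ J ])
      (Inverse.to-cong (G≅H.iso J) (F≅G.natural φ s)) (G≅H.natural φ _)
  }
  where
  module F≅G = _≅_ F≅G
  module G≅H = _≅_ G≅H

≅-isEquivalence : IsEquivalence _≅_
≅-isEquivalence = record { refl = ≅-refl ; sym = ≅-sym ; trans = ≅-trans }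

+ˢ-cong : ∀ {F F′ G G′} → F ≅ F′ → G ≅ G′ → F +ˢ G ≅ F′ +ˢ G′
+ˢ-cong {F′ = F′} {G′ = G′} F≅F′ G≅G′ = bijective⇒≅
  (λ { (inj₁ s) → inj₁ (f.to _ s) ; (inj₂ t) → inj₂ (g.to _ t) })
  (λ { (inj₁ p) → inj₁ (f.to-cong _ p) ; (inj₂ p) → inj₂ (g.to-cong _ p) })
  (λ φ → λ { (inj₁ s) → inj₁ (_≅_.natural F≅F′ φ s) ; (inj₂ t) → inj₂ (_≅_.natural G≅G′ φ t) })
  (λ { {_} {inj₁ _} {inj₁ _} (inj₁ p) → inj₁ (inverse-injective (_≅_.iso F≅F′ _) p)
     ; {_} {inj₂ _} {inj₂ _} (inj₂ p) → inj₂ (inverse-injective (_≅_.iso G≅G′ _) p) })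
  (λ { (inj₁ s) → inj₁ (f.from _ s) , inj₁ (f.strictlyInverseˡ _ s)
     ; (inj₂ t) → inj₂ (g.from _ t) , inj₂ (g.strictlyInverseˡ _ t) })
  where
  module f I = Inverse (_≅_.iso F≅F′ I)
  module g I = Inverse (_≅_.iso G≅G′ I)

+ˢ-comm : ∀ F G → F +ˢ G ≅ G +ˢ F
+ˢ-comm F G = bijective⇒≅
  (λ { (inj₁ s) → inj₂ s ; (inj₂ t) → inj₁ t })
  (λ { (inj₁ p) → inj₂ p ; (inj₂ p) → inj₁ p })
  (λ φ → λ { (inj₁ s) → inj₂ (Setoid.refl (F [ _ ])) ; (inj₂ t) → inj₁ (Setoid.refl (G [ _ ])) })
  (λ { {_} {inj₁ _} {inj₁ _} (inj₂ p) → inj₁ p ; {_} {inj₂ _} {inj₂ _} (inj₁ p) → inj₂ p })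
  (λ { (inj₁ t) → inj₂ t , inj₁ (Setoid.refl (G [ _ ]))
     ; (inj₂ s) → inj₁ s , inj₂ (Setoid.refl (F [ _ ])) })

+ˢ-assoc : ∀ F G H → (F +ˢ G) +ˢ H ≅ F +ˢ (G +ˢ H)
+ˢ-assoc F G H = bijective⇒≅
  (λ { (inj₁ (inj₁ s)) → inj₁ s ; (inj₁ (inj₂ t)) → inj₂ (inj₁ t) ; (inj₂ u) → inj₂ (inj₂ u) })
  (λ { (inj₁ (inj₁ p)) → inj₁ p ; (inj₁ (inj₂ p)) → inj₂ (inj₁ p) ; (inj₂ p) → inj₂ (inj₂ p) })
  (λ φ → λ { (inj₁ (inj₁ s)) → inj₁ (Setoid.refl (F [ _ ]))
           ; (inj₁ (inj₂ t)) → inj₂ (inj₁ (Setoid.refl (G [ _ ])))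
           ; (inj₂ u) → inj₂ (inj₂ (Setoid.refl (H [ _ ]))) })
  (λ { {_} {inj₁ (inj₁ _)} {inj₁ (inj₁ _)} (inj₁ p) → inj₁ (inj₁ p)
     ; {_} {inj₁ (inj₂ _)} {inj₁ (inj₂ _)} (inj₂ (inj₁ p)) → inj₁ (inj₂ p)
     ; {_} {inj₁ (inj₁ _)} {inj₁ (inj₂ _)} ()
     ; {_} {inj₁ (inj₂ _)} {inj₁ (inj₁ _)} ()
     ; {_} {inj₁ (inj₂ _)} {inj₂ _} (inj₂ ())
     ; {_} {inj₂ _} {inj₁ (inj₂ _)} (inj₂ ())
     ; {_} {inj₂ _} {inj₂ _} (inj₂ (inj₂ p)) → inj₂ p })
  (λ { (inj₁ s) → inj₁ (inj₁ s) , inj₁ (Setoid.refl (F [ _ ]))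
     ; (inj₂ (inj₁ t)) → inj₁ (inj₂ t) , inj₂ (inj₁ (Setoid.refl (G [ _ ])))
     ; (inj₂ (inj₂ u)) → inj₂ u , inj₂ (inj₂ (Setoid.refl (H [ _ ]))) })

+ˢ-identityˡ : ∀ F → 0ˢ +ˢ F ≅ F
+ˢ-identityˡ F = bijective⇒≅
  (λ { (inj₂ s) → s })
  (λ { (inj₂ p) → p })
  (λ φ → λ { (inj₂ s) → Setoid.refl (F [ _ ]) })
  (λ { {_} {inj₂ _} {inj₂ _} p → inj₂ p })
  (λ s → inj₂ s , Setoid.refl (F [ _ ]))

-- Cancellation of a common finite summand C: chase an element of A through
-- A ⊎ C → B ⊎ C, feeding every value in C back in, until it leaves C. No choice
-- is involved, so the resulting bijection is natural.

module Chase {A B C : Setoid 0ℓ 0ℓ} (f : Func (A ⊎ₛ C) (B ⊎ₛ C)) where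
  private
    module A = Setoid A
    module B = Setoid B
    module C = Setoid C
    module B⊎C = Setoid (B ⊎ₛ C)
  open Func f renaming (cong to to-cong)

  -- The chase is a relation rather than a recursive function, so that uniqueness, reversal and
  -- naturality are inductions on derivations; the finiteness of C matters only for existence.
  data Exit (y : B⊎C.Carrier) (b : B.Carrier) : Set where
    exit : y B⊎C.≈ inj₁ b → Exit y b
    feed : ∀ {c} → y B⊎C.≈ inj₂ c → Exit (to (inj₂ c)) b → Exit y b

  Exit-resp : ∀ {y y′ b} → y B⊎C.≈ y′ → Exit y b → Exit y′ b
  Exit-resp y≈y′ (exit p)   = exit (B⊎C.trans (B⊎C.sym y≈y′) p)
  Exit-resp y≈y′ (feed p e) = feed (B⊎C.trans (B⊎C.sym y≈y′) p) e

  Exit-unique : ∀ {y y′ b b′} → y B⊎C.≈ y′ → Exit y b → Exit y′ b′ → b B.≈ b′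
  Exit-unique y≈y′ (exit p)   (exit p′)    =
    drop-inj₁ (B⊎C.trans (B⊎C.sym p) (B⊎C.trans y≈y′ p′))
  Exit-unique y≈y′ (feed p e) (feed p′ e′) = Exit-unique
    (to-cong (inj₂ (drop-inj₂ (B⊎C.trans (B⊎C.sym p) (B⊎C.trans y≈y′ p′))))) e e′
  Exit-unique y≈y′ (exit p)   (feed p′ _)
    with () ← B⊎C.trans (B⊎C.sym p) (B⊎C.trans y≈y′ p′)
  Exit-unique y≈y′ (feed p _) (exit p′)
    with () ← B⊎C.trans (B⊎C.sym p) (B⊎C.trans y≈y′ p′)

  module _ (to-injective : ∀ {x y} → to x B⊎C.≈ to y → Setoid._≈_ (A ⊎ₛ C) x y)
           (finC : Finite C) (a : A.Carrier) where

    data Orbit : ℕ → C.Carrier → Set where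
      start : ∀ {c} → to (inj₁ a) B⊎C.≈ inj₂ c → Orbit 0 c
      step  : ∀ {k c d} → Orbit k c → to (inj₂ c) B⊎C.≈ inj₂ d → Orbit (suc k) d

    -- Injectivity of `to` traces two equal values back in parallel. If one orbit reaches its start
    -- earlier, an element of A would equal one of C.
    Orbit-injective : ∀ {k l c d} → Orbit k c → Orbit l d → c C.≈ d → k ≡ l
    Orbit-injective (start _) (start _) _ = refl
    Orbit-injective (step o p) (step o′ p′) c≈d = cong suc
      (Orbit-injective o o′ (drop-inj₂ (to-injective
        (B⊎C.trans p (B⊎C.trans (inj₂ c≈d) (B⊎C.sym p′))))))
    Orbit-injective (start p) (step _ p′) c≈d
      with () ← to-injective (B⊎C.trans p (B⊎C.trans (inj₂ c≈d) (B⊎C.sym p′)))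
    Orbit-injective (step _ p) (start p′) c≈d
      with () ← to-injective (B⊎C.trans p (B⊎C.trans (inj₂ c≈d) (B⊎C.sym p′)))

    visited : ∀ {k m c} → Orbit k c → m ≤′ k → ∃ (Orbit m)
    visited o          ≤′-refl     = _ , o
    visited (step o _) (≤′-step p) = visited o p

    -- An orbit of index n has visited n + 1 pairwise different values, which is one too many for n
    -- = |C|.
    Orbit-bounded : ∀ {c} → ¬ Orbit (proj₁ finC) c
    Orbit-bounded o =
      let i , j , i<j , eq = Fin.pigeonhole (ℕ.n<1+n (proj₁ finC)) (code ∘ proj₁ ∘ at)
      in ℕ.<⇒≢ i<j (Orbit-injective (proj₂ (at i)) (proj₂ (at j)) (inverse-injective (proj₂ finC) eq))
      where
      open Inverse (proj₂ finC) using () renaming (to to code)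
      at : ∀ (i : Fin (suc (proj₁ finC))) → ∃ (Orbit (toℕ i))
      at i = visited o (ℕ.≤⇒≤′ (Fin.toℕ≤pred[n] i))

    -- `m` is fuel: when it runs out, the chase has stayed in C long enough to extend the orbit by
    -- `m` steps.
    run : ∀ m {k} y → (∀ {c} → y B⊎C.≈ inj₂ c → Orbit k c) →
          ∃ (Exit y) ⊎ ∃ (Orbit (m ℕ+ k))
    run m       (inj₁ b) o = inj₁ (b , exit B⊎C.refl)
    run zero    (inj₂ c) o = inj₂ (c , o B⊎C.refl)
    run (suc m) {k} (inj₂ c) o with run m {suc k} (to (inj₂ c)) (step (o B⊎C.refl))
    ... | inj₁ (b , e)  = inj₁ (b , feed B⊎C.refl e)
    ... | inj₂ (d , o′) = inj₂ (d , subst (λ k → Orbit k d) (ℕ.+-suc m k) o′)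

    Exit-exists : ∃ (Exit (to (inj₁ a)))
    Exit-exists with run (proj₁ finC) (to (inj₁ a)) start
    ... | inj₁ e       = e
    ... | inj₂ (c , o) = ⊥-elim (Orbit-bounded (subst (λ k → Orbit k c) (ℕ.+-identityʳ _) o))

module _ {A B C : Setoid 0ℓ 0ℓ} (e : Inverse (A ⊎ₛ C) (B ⊎ₛ C)) where
  private
    module A⊎C = Setoid (A ⊎ₛ C)
    module B⊎C = Setoid (B ⊎ₛ C)
    forward : Func (A ⊎ₛ C) (B ⊎ₛ C)
    forward = record { to = Inverse.to e ; cong = Inverse.to-cong e }
    backward : Func (B ⊎ₛ C) (A ⊎ₛ C)
    backward = record { to = Inverse.from e ; cong = Inverse.from-cong e }
    module Fwd = Chase {A} {B} {C} forward
    module Bwd = Chase {B} {A} {C} backward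

  -- The forward chase, read backwards, is a chase for the inverse; `go` accumulates it in its first
  -- argument. Together with uniqueness of exits this makes the chase injective and surjective.
  Exit-reverse : ∀ {a b} → Fwd.Exit (Inverse.to e (inj₁ a)) b → Bwd.Exit (Inverse.from e (inj₁ b)) a
  Exit-reverse = go (Bwd.exit A⊎C.refl)
    where
    go : ∀ {z a b} → Bwd.Exit z a → Fwd.Exit (Inverse.to e z) b → Bwd.Exit (Inverse.from e (inj₁ b)) a
    go {z} back (Fwd.exit p)   =
      Bwd.Exit-resp (A⊎C.sym (Inverse.inverseʳ e (B⊎C.sym p))) back
    go {z} back (Fwd.feed p x) =
      go (Bwd.feed A⊎C.refl (Bwd.Exit-resp (A⊎C.sym (Inverse.inverseʳ e (B⊎C.sym p))) back)) x

+ˢ-cancelʳ : RightCancellative _≅_ _+ˢ_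
+ˢ-cancelʳ H F G F+H≅G+H = bijective⇒≅
  (λ {I} s → proj₁ (path s))
  (λ {I} {s} {t} s≈t → Fwd.Exit-unique I (to-cong (iso I) (inj₁ s≈t)) (proj₂ (path s)) (proj₂ (path t)))
  (λ {I} {J} φ s → Fwd.Exit-unique J (natural φ (inj₁ s))
    (proj₂ (path ((F ⟪ φ ⟫) s))) (moved φ (proj₂ (path s))))
  (λ {I} {s} {t} p → Bwd.Exit-unique I (from-cong (iso I) (inj₁ p))
    (Exit-reverse (iso I) (proj₂ (path s))) (Exit-reverse (iso I) (proj₂ (path t))))
  (λ {I} t →
    let s , back = Bwd.Exit-exists I (inverse-injective (Symmetry.inverse (iso I))) (H.finite I) t
    in s , Fwd.Exit-unique I (Setoid.refl ((G +ˢ H) [ I ])) (proj₂ (path s))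
      (Exit-reverse (Symmetry.inverse (iso I)) back))
  where
  open _≅_ F+H≅G+H
  open Inverse
  module H = Species H
  forward : ∀ I → Func ((F +ˢ H) [ I ]) ((G +ˢ H) [ I ])
  forward I = record { to = to (iso I) ; cong = to-cong (iso I) }
  backward : ∀ I → Func ((G +ˢ H) [ I ]) ((F +ˢ H) [ I ])
  backward I = record { to = from (iso I) ; cong = from-cong (iso I) }
  module Fwd I = Chase {F [ I ]} {G [ I ]} {H [ I ]} (forward I)
  module Bwd I = Chase {G [ I ]} {F [ I ]} {H [ I ]} (backward I)
  path : ∀ {I} s → ∃ (Fwd.Exit I (to (iso I) (inj₁ s)))
  path {I} s = Fwd.Exit-exists I (inverse-injective (iso I)) (H.finite I) s
  -- Relabelling maps a chase step by step to a chase, and exits are unique; this is naturality.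
  moved : ∀ {I J} (φ : I ≃ J) {y g} → Fwd.Exit I y g →
          Fwd.Exit J (((G +ˢ H) ⟪ φ ⟫) y) ((G ⟪ φ ⟫) g)
  moved {I} {J} φ (Fwd.exit p)   = Fwd.exit (Species.relabel-cong (G +ˢ H) φ p)
  moved {I} {J} φ (Fwd.feed {c} p e) = Fwd.feed (Species.relabel-cong (G +ˢ H) φ p)
    (Fwd.Exit-resp J (Setoid.sym ((G +ˢ H) [ J ]) (natural φ (inj₂ c))) (moved φ e))

true-or-false : ∀ b → b ≡ true ⊎ b ≡ false
true-or-false true  = inj₁ refl
true-or-false false = inj₂ refl

part-≡ : ∀ {A : Set} {χ : A → Bool} {b} {x y : Σ A λ i → χ i ≡ b} → proj₁ x ≡ proj₁ y → x ≡ y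
part-≡ {x = i , refl} {y = .i , refl} refl = refl

fwd-injective : ∀ {I J} (φ : I ≃ J) {i j} → fwd φ i ≡ fwd φ j → i ≡ j
fwd-injective φ {i} {j} p = trans (sym (bwd-fwd φ i)) (trans (cong (bwd φ) p) (bwd-fwd φ j))

-- Composites of relabellings

infixr 5 _∷_

data Path (I : FinSet) : FinSet → Set₁ where
  []  : Path I I
  _∷_ : ∀ {J K} → I ≃ J → Path J K → Path I K

walk : ∀ {I J} → Path I J → Elem I → Elem J
walk []      i = i
walk (φ ∷ p) i = walk p (fwd φ i)

module Relabelling (F : Species) where
  open Species F hiding (_[_]; _⟪_⟫; finite)

  along : ∀ {I J} → Path I J → Structure F I → Structure F J
  along []      s = s
  along (φ ∷ p) s = along p ((F ⟪ φ ⟫) s)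

  composite : ∀ {I J} → Path I J → I ≃ J
  composite []      = id≃
  composite (φ ∷ p) = composite p ∘≃ φ

  fwd-composite : ∀ {I J} (p : Path I J) i → fwd (composite p) i ≡ walk p i
  fwd-composite []      i = refl
  fwd-composite (φ ∷ p) i = fwd-composite p (fwd φ i)

  along≈composite : ∀ {I J} (p : Path I J) s →
    Setoid._≈_ (F [ J ]) (along p s) ((F ⟪ composite p ⟫) s)
  along≈composite {I} [] s = Setoid.sym (F [ I ]) (relabel-id s)
  along≈composite {J = J} (φ ∷ p) s = Setoid.trans (F [ J ]) (along≈composite p _)
    (Setoid.sym (F [ J ]) (relabel-∘ φ (composite p) s))

  -- Coherence for relabellings: only the underlying map of labels matters. Every comparison of
  -- relabelled structures below thereby reduces to an equation between labels, usually `refl` up to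
  -- the membership proofs.
  along-resp : ∀ {I J} (p q : Path I J) → (∀ i → walk p i ≡ walk q i) → ∀ s →
    Setoid._≈_ (F [ J ]) (along p s) (along q s)
  along-resp {J = J} p q p≗q s = begin
    along p s              ≈⟨ along≈composite p s ⟩
    (F ⟪ composite p ⟫) s  ≈⟨ relabel-resp (λ i → trans (fwd-composite p i)
                                (trans (p≗q i) (sym (fwd-composite q i)))) s ⟩
    (F ⟪ composite q ⟫) s  ≈⟨ along≈composite q s ⟨
    along q s              ∎
    where open ≈-Reasoning (F [ J ])

  relabel-injective : ∀ {I J} (φ : I ≃ J) {s t} →
    Setoid._≈_ (F [ J ]) ((F ⟪ φ ⟫) s) ((F ⟪ φ ⟫) t) → Setoid._≈_ (F [ I ]) s t
  relabel-injective {I} φ {s} {t} p = Setoid.trans (F [ I ])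
    (along-resp [] (φ ∷ sym≃ φ ∷ []) (sym ∘ bwd-fwd φ) s)
    (Setoid.trans (F [ I ]) (relabel-cong (sym≃ φ) p)
      (along-resp (φ ∷ sym≃ φ ∷ []) [] (bwd-fwd φ) t))

  -- The converse tool, for injectivity proofs: an equation that is known after a further
  -- relabelling `ρ` is pulled back along it.
  along-cancel : ∀ {I J K} (p : Path I J) (ρ : J ≃ K) (q : Path I K) {s t} →
    (∀ i → walk q i ≡ fwd ρ (walk p i)) →
    Setoid._≈_ (F [ K ]) (along q s) ((F ⟪ ρ ⟫) t) →
    Setoid._≈_ (F [ J ]) (along p s) t
  along-cancel {K = K} p ρ q {s} {t} q≗ρp e = relabel-injective ρ (begin
    (F ⟪ ρ ⟫) (along p s)
      ≈⟨ relabel-cong ρ (along≈composite p s) ⟩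
    along (composite p ∷ ρ ∷ []) s
      ≈⟨ along-resp (composite p ∷ ρ ∷ []) q
           (λ i → trans (cong (fwd ρ) (fwd-composite p i)) (sym (q≗ρp i))) s ⟩
    along q s
      ≈⟨ e ⟩
    (F ⟪ ρ ⟫) t ∎)
    where open ≈-Reasoning (F [ K ])

-- Surjectivity by counting

injective⇒surjective : ∀ {n} (f : Fin n → Fin n) → (∀ {i j} → f i ≡ f j → i ≡ j) →
                       ∀ j → ∃[ i ] f i ≡ j
injective⇒surjective {suc n} f f-injective j with Fin.any? (λ i → f i Fin.≟ j)
... | yes p = p
-- If `f` missed `j`, punching `j` out would inject `Fin (suc n)` into `Fin n`.
... | no ¬p = contradiction
  (Fin.injective⇒≤ {f = λ i → punchOut (λ j≡fi → ¬p (i , sym j≡fi))}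
    (λ {x} {y} e → f-injective (Fin.punchOut-injective
      (λ p → ¬p (x , sym p)) (λ p → ¬p (y , sym p)) e)))
  ℕ.1+n≰n

-- Injections both ways force equal cardinalities, and then an injection is onto; `g` need not be
-- inverse to `f`.
injections⇒surjective : ∀ {A B : Setoid 0ℓ 0ℓ} → Finite A → Finite B →
  (f : Setoid.Carrier A → Setoid.Carrier B) (g : Setoid.Carrier B → Setoid.Carrier A) →
  (∀ {x y} → Setoid._≈_ B (f x) (f y) → Setoid._≈_ A x y) →
  (∀ {x y} → Setoid._≈_ A (g x) (g y) → Setoid._≈_ B x y) →
  ∀ y → ∃[ x ] Setoid._≈_ B (f x) y
injections⇒surjective {A} {B} (m , α) (n , β) f g f-injective g-injective y =
  let i , e = onto (Fin.cantor-schröder-bernstein f̂-injective ĝ-injective) f̂ f̂-injective (β.to y)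
  in α.from i , inverse-injective β e
  where
  module α = Inverse α
  module β = Inverse β
  f̂ : Fin m → Fin n
  f̂ i = β.to (f (α.from i))
  ĝ : Fin n → Fin m
  ĝ j = α.to (g (β.from j))
  f̂-injective : ∀ {i j} → f̂ i ≡ f̂ j → i ≡ j
  f̂-injective {i} {j} e = trans (sym (α.strictlyInverseˡ i))
    (trans (α.to-cong (f-injective (inverse-injective β e))) (α.strictlyInverseˡ j))
  ĝ-injective : ∀ {i j} → ĝ i ≡ ĝ j → i ≡ j
  ĝ-injective {i} {j} e = trans (sym (β.strictlyInverseˡ i))
    (trans (β.to-cong (g-injective (inverse-injective α e))) (β.strictlyInverseˡ j))
  onto : ∀ {m n} → m ≡ n → (h : Fin m → Fin n) → (∀ {i j} → h i ≡ h j → i ≡ j) →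
         ∀ j → ∃[ i ] h i ≡ j
  onto refl = injective⇒surjective

-- Products of species

module _ {F G : Species} where
  private
    module F = Relabelling F
    module G = Relabelling G

  pair-cong : ∀ {I} {χ : Elem I → Bool} {f f′ : Structure F (part I χ true)}
    {g g′ : Structure G (part I χ false)} →
    Setoid._≈_ (F [ part I χ true ]) f f′ → Setoid._≈_ (G [ part I χ false ]) g g′ →
    Setoid._≈_ ((F *ˢ G) [ I ]) (pair χ f g) (pair χ f′ g′)
  pair-cong p q = pair≈ (λ _ → refl)
    (Setoid.trans (F [ _ ]) (F.along-resp (_ ∷ []) [] (λ _ → part-≡ refl) _) p)
    (Setoid.trans (G [ _ ]) (G.along-resp (_ ∷ []) [] (λ _ → part-≡ refl) _) q)

*ˢ-cong : ∀ {F F′ G G′} → F ≅ F′ → G ≅ G′ → F *ˢ G ≅ F′ *ˢ G′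
*ˢ-cong {F} {F′} {G} {G′} F≅F′ G≅G′ = bijective⇒≅
  (λ { (pair χ f g) → pair χ (f.to _ f) (g.to _ g) })
  (λ { (pair≈ p u v) → pair≈ p
    (F′.trans (F′.sym (_≅_.natural F≅F′ _ _)) (f.to-cong _ u))
    (G′.trans (G′.sym (_≅_.natural G≅G′ _ _)) (g.to-cong _ v)) })
  (λ φ → λ { (pair χ f g) →
    pair-cong (_≅_.natural F≅F′ _ f) (_≅_.natural G≅G′ _ g) })
  (λ { (pair≈ p u v) → pair≈ p
    (inverse-injective (_≅_.iso F≅F′ _) (F′.trans (_≅_.natural F≅F′ _ _) u))
    (inverse-injective (_≅_.iso G≅G′ _) (G′.trans (_≅_.natural G≅G′ _ _) v)) })
  (λ { (pair χ f g) → pair χ (f.from _ f) (g.from _ g)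
    , pair-cong (f.strictlyInverseˡ _ f) (g.strictlyInverseˡ _ g) })
  where
  module F′ {I} = Setoid (F′ [ I ])
  module G′ {I} = Setoid (G′ [ I ])
  module f I = Inverse (_≅_.iso F≅F′ I)
  module g I = Inverse (_≅_.iso G≅G′ I)

not-part : ∀ {I χ} b → part I χ b ≃ part I (not ∘ χ) (not b)
not-part b = mk≃ (mk↔ₛ′
  (λ (i , p) → i , cong not p) (λ (i , p) → i , Bool.not-injective p)
  (λ _ → part-≡ refl) (λ _ → part-≡ refl))

*ˢ-comm : ∀ F G → F *ˢ G ≅ G *ˢ F
*ˢ-comm F G = bijective⇒≅
  (λ { (pair χ f g) → pair (not ∘ χ) ((G ⟪ not-part false ⟫) g) ((F ⟪ not-part true ⟫) f) })
  (λ { (pair≈ p u v) → pair≈ (cong not ∘ p)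
    (G′.trans (G.along-resp (_ ∷ _ ∷ []) (_ ∷ _ ∷ []) (λ _ → part-≡ refl) _)
              (Species.relabel-cong G _ v))
    (F′.trans (F.along-resp (_ ∷ _ ∷ []) (_ ∷ _ ∷ []) (λ _ → part-≡ refl) _)
              (Species.relabel-cong F _ u)) })
  (λ φ → λ { (pair χ f g) → pair-cong
    (G.along-resp (_ ∷ _ ∷ []) (_ ∷ _ ∷ []) (λ _ → part-≡ refl) g)
    (F.along-resp (_ ∷ _ ∷ []) (_ ∷ _ ∷ []) (λ _ → part-≡ refl) f) })
  (λ { (pair≈ p u v) → pair≈ (Bool.not-injective ∘ p)
    (F.along-cancel (_ ∷ []) (not-part true) (_ ∷ _ ∷ []) (λ _ → part-≡ refl) v)
    (G.along-cancel (_ ∷ []) (not-part false) (_ ∷ _ ∷ []) (λ _ → part-≡ refl) u) })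
  (λ { (pair χ g f) →
      pair (not ∘ χ) ((F ⟪ not-part false ⟫) f) ((G ⟪ not-part true ⟫) g)
    , pair≈ (λ i → sym (Bool.not-involutive (χ i)))
        (G.along-resp (_ ∷ _ ∷ _ ∷ []) [] (λ _ → part-≡ refl) g)
        (F.along-resp (_ ∷ _ ∷ _ ∷ []) [] (λ _ → part-≡ refl) f) })
  where
  module F = Relabelling F
  module G = Relabelling G
  module F′ {I} = Setoid (F [ I ])
  module G′ {I} = Setoid (G [ I ])

*ˢ-distribʳ-+ˢ : ∀ H F G → (F +ˢ G) *ˢ H ≅ F *ˢ H +ˢ G *ˢ H
*ˢ-distribʳ-+ˢ H F G = bijective⇒≅
  (λ { (pair χ (inj₁ f) h) → inj₁ (pair χ f h) ; (pair χ (inj₂ g) h) → inj₂ (pair χ g h) })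
  (λ { {_} {pair _ (inj₁ _) _} {pair _ (inj₁ _) _} (pair≈ p (inj₁ u) v) → inj₁ (pair≈ p u v)
     ; {_} {pair _ (inj₂ _) _} {pair _ (inj₂ _) _} (pair≈ p (inj₂ u) v) → inj₂ (pair≈ p u v) })
  (λ φ → λ { (pair χ (inj₁ f) h) → inj₁ (Setoid.refl ((F *ˢ H) [ _ ]))
           ; (pair χ (inj₂ g) h) → inj₂ (Setoid.refl ((G *ˢ H) [ _ ])) })
  (λ { {_} {pair _ (inj₁ _) _} {pair _ (inj₁ _) _} (inj₁ (pair≈ p u v)) → pair≈ p (inj₁ u) v
     ; {_} {pair _ (inj₂ _) _} {pair _ (inj₂ _) _} (inj₂ (pair≈ p u v)) → pair≈ p (inj₂ u) v })
  (λ { (inj₁ (pair χ f h)) → pair χ (inj₁ f) h , inj₁ (Setoid.refl ((F *ˢ H) [ _ ]))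
     ; (inj₂ (pair χ g h)) → pair χ (inj₂ g) h , inj₂ (Setoid.refl ((G *ˢ H) [ _ ])) })

*ˢ-zeroˡ : ∀ F → 0ˢ *ˢ F ≅ 0ˢ
*ˢ-zeroˡ F = bijective⇒≅
  (λ { (pair _ () _) }) (λ { {_} {pair _ () _} }) (λ { _ (pair _ () _) })
  (λ { {_} {pair _ () _} }) (λ ())

size≡0⇒empty : ∀ I → ∣ I ∣ ≡ 0 → ¬ Elem I
size≡0⇒empty I p i with () ← subst Fin p (Inverse.to (proj₂ (FinSet.finite I)) i)

empty⇒size≡0 : ∀ I → ¬ Elem I → ∣ I ∣ ≡ 0
empty⇒size≡0 I ¬i with FinSet.finite I
... | zero  , _ = refl
... | suc _ , e = contradiction (Inverse.from e zero) ¬i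

whole : ∀ {I χ b} → (∀ i → χ i ≡ b) → part I χ b ≃ I
whole all = mk≃ (mk↔ₛ′ proj₁ (λ i → i , all i) (λ _ → refl) (λ _ → part-≡ refl))

*ˢ-identityˡ : ∀ F → 1ˢ *ˢ F ≅ F
*ˢ-identityˡ F = bijective⇒≅
  (λ { {I} (pair χ p f) → (F ⟪ whole (all-false χ p) ⟫) f })
  (λ { {I} {pair χ p f} {pair χ′ p′ f′} (pair≈ q _ v) → F′.trans
    (F.along-resp (_ ∷ []) (_ ∷ _ ∷ []) (λ _ → refl) f)
    (Species.relabel-cong F (whole (all-false χ′ p′)) v) })
  (λ φ → λ { (pair χ p f) → F.along-resp (_ ∷ _ ∷ []) (_ ∷ _ ∷ []) (λ _ → refl) f })
  (λ { {I} {pair χ p f} {pair χ′ p′ f′} e → pair≈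
    (λ i → trans (all-false χ′ p′ i) (sym (all-false χ p i)))
    (ℕ.≡-irrelevant _ _)
    (F.along-cancel (_ ∷ []) (whole (all-false χ′ p′)) (_ ∷ []) (λ _ → refl) e) })
  (λ {I} f →
      pair (λ _ → false) (empty⇒size≡0 (part I (λ _ → false) true) λ { (_ , ()) })
        ((F ⟪ sym≃ (whole (λ _ → refl)) ⟫) f)
    , F.along-resp (_ ∷ _ ∷ []) [] (λ _ → refl) f)
  where
  module F = Relabelling F
  module F′ {I} = Setoid (F [ I ])
  all-false : ∀ {I} χ → ∣ part I χ true ∣ ≡ 0 → ∀ i → χ i ≡ false
  all-false {I} χ p i = Bool.¬-not λ q → size≡0⇒empty (part I χ true) p (i , q)

-- Associativity of the product

module Nest {A : Set} (χ : A → Bool) (χ′ : Σ A (λ i → χ i ≡ true) → Bool) where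

  -- `χ′` takes a label together with a proof that `χ` is true there, so the value of `χ i` is
  -- abstracted along with its equation; the lemmas below generalise over both.
  nestAt : ∀ i b → χ i ≡ b → Bool
  nestAt i true  p = χ′ (i , p)
  nestAt i false p = false

  nest : A → Bool
  nest i = nestAt i (χ i) refl

  nest-inside : ∀ {i} (p : χ i ≡ true) → nest i ≡ χ′ (i , p)
  nest-inside {i} p = go (χ i) refl p
    where
    go : ∀ b (q : χ i ≡ b) (r : b ≡ true) → nestAt i b q ≡ χ′ (i , p)
    go true q _ = cong χ′ (part-≡ refl)

  nest-outside : ∀ {i} → χ i ≡ false → nest i ≡ false
  nest-outside {i} p = go (χ i) refl p
    where
    go : ∀ b (q : χ i ≡ b) → b ≡ false → nestAt i b q ≡ false
    go false _ _ = refl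

  nest⇒inside : ∀ {i} → nest i ≡ true → χ i ≡ true
  nest⇒inside p = Bool.¬-not λ q → Bool.not-¬ (nest-outside q) p

open Nest using (nest; nest-inside; nest-outside; nest⇒inside)

module _ (I : FinSet) (χ : Elem I → Bool) (χ′ : PartElem I χ true → Bool) where

  -- `first`, `second` and `third` identify the three blocks of labels as they arise from the two
  -- bracketings.
  first : part (part I χ true) χ′ true ≃ part I (nest χ χ′) true
  first = mk≃ (mk↔ₛ′
    (λ ((i , p) , q) → i , trans (nest-inside χ χ′ p) q)
    (λ (i , p) → let q = nest⇒inside χ χ′ p in (i , q) , trans (sym (nest-inside χ χ′ q)) p)
    (λ _ → part-≡ refl) (λ _ → part-≡ (part-≡ refl)))

  second : part (part I χ true) χ′ false ≃ part (part I (nest χ χ′) false) (χ ∘ proj₁) true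
  second = mk≃ (mk↔ₛ′
    (λ ((i , p) , q) → (i , trans (nest-inside χ χ′ p) q) , p)
    (λ ((i , p) , q) → (i , q) , trans (sym (nest-inside χ χ′ q)) p)
    (λ _ → part-≡ (part-≡ refl)) (λ _ → part-≡ (part-≡ refl)))

  third : part I χ false ≃ part (part I (nest χ χ′) false) (χ ∘ proj₁) false
  third = mk≃ (mk↔ₛ′
    (λ (i , p) → (i , nest-outside χ χ′ p) , p)
    (λ ((i , _) , p) → i , p)
    (λ _ → part-≡ (part-≡ refl)) (λ _ → part-≡ refl))

module Associate (F G H : Species) where
  private
    module F = Relabelling F
    module G = Relabelling G
    module H = Relabelling H
    module FG-H {I} = Setoid (((F *ˢ G) *ˢ H) [ I ])
    module F-GH {I} = Setoid ((F *ˢ (G *ˢ H)) [ I ])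

  associate : ∀ {I} → Structure ((F *ˢ G) *ˢ H) I → Structure (F *ˢ (G *ˢ H)) I
  associate {I} (pair χ (pair χ′ f g) h) =
    pair (nest χ χ′) ((F ⟪ first I χ χ′ ⟫) f)
      (pair (χ ∘ proj₁) ((G ⟪ second I χ χ′ ⟫) g) ((H ⟪ third I χ χ′ ⟫) h))

  -- Used with `φ = id` for congruence and with `bwd φ` for naturality.
  nest-cong : ∀ {A B : Set} (φ : B → A) χ χ′ (ξ : B → Bool) ξ′ →
    (e : ∀ j → ξ j ≡ χ (φ j)) → (∀ j p q → ξ′ (j , p) ≡ χ′ (φ j , q)) →
    ∀ j → nest ξ ξ′ j ≡ nest χ χ′ (φ j)
  nest-cong φ χ χ′ ξ ξ′ e e′ j with true-or-false (ξ j)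
  ... | inj₁ eq = trans (nest-inside ξ ξ′ eq)
    (trans (e′ j eq q) (sym (nest-inside χ χ′ q)))
    where q = trans (sym (e j)) eq
  ... | inj₂ eq = trans (nest-outside ξ ξ′ eq)
    (sym (nest-outside χ χ′ (trans (sym (e j)) eq)))

  associate-cong : ∀ {I} {s t : Structure ((F *ˢ G) *ˢ H) I} →
    s FG-H.≈ t → associate s F-GH.≈ associate t
  associate-cong {I} {pair χ (pair χ′ f g) h} {pair ξ (pair ξ′ f′ g′) h′}
    (pair≈ p (pair≈ q u v) w) = pair≈
      (nest-cong id χ χ′ ξ ξ′ p (λ j r r′ → trans (q (j , r)) (cong χ′ (part-≡ refl))))
      (Setoid.trans (F [ _ ])
        (F.along-resp (_ ∷ _ ∷ []) (_ ∷ _ ∷ first I ξ ξ′ ∷ []) (λ _ → part-≡ refl) f)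
        (Species.relabel-cong F (first I ξ ξ′) u))
      (pair≈ (λ (i , _) → p i)
        (Setoid.trans (G [ _ ])
          (G.along-resp (_ ∷ _ ∷ _ ∷ []) (_ ∷ _ ∷ second I ξ ξ′ ∷ []) (λ _ → part-≡ (part-≡ refl)) g)
          (Species.relabel-cong G (second I ξ ξ′) v))
        (Setoid.trans (H [ _ ])
          (H.along-resp (_ ∷ _ ∷ _ ∷ []) (_ ∷ third I ξ ξ′ ∷ []) (λ _ → part-≡ (part-≡ refl)) h)
          (Species.relabel-cong H (third I ξ ξ′) w)))

  associate-natural : ∀ {I J} (φ : I ≃ J) s →
    associate ((((F *ˢ G) *ˢ H) ⟪ φ ⟫) s) F-GH.≈ ((F *ˢ (G *ˢ H)) ⟪ φ ⟫) (associate s)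
  associate-natural {I} {J} φ (pair χ (pair χ′ f g) h) = pair≈
    (λ j → sym (nest-cong (bwd φ) χ χ′ (χ ∘ bwd φ)
      (χ′ ∘ bwd (restrict φ (λ i → cong χ (bwd-fwd φ i)) true))
      (λ _ → refl) (λ _ _ _ → cong χ′ (part-≡ refl)) j))
    (F.along-resp (_ ∷ _ ∷ _ ∷ []) (_ ∷ _ ∷ []) (λ _ → part-≡ refl) f)
    (pair≈ (λ _ → refl)
      (G.along-resp (_ ∷ _ ∷ _ ∷ _ ∷ []) (_ ∷ _ ∷ []) (λ _ → part-≡ (part-≡ refl)) g)
      (H.along-resp (_ ∷ _ ∷ _ ∷ _ ∷ []) (_ ∷ _ ∷ []) (λ _ → part-≡ (part-≡ refl)) h))

  associate-injective : ∀ {I} {s t : Structure ((F *ˢ G) *ˢ H) I} →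
    associate s F-GH.≈ associate t → s FG-H.≈ t
  associate-injective {I} {pair χ (pair χ′ f g) h} {pair ξ (pair ξ′ f′ g′) h′}
    (pair≈ p u (pair≈ q v w)) = pair≈ ξ≗χ
      (pair≈ (λ (i , r) → trans (sym (nest-inside ξ ξ′ r)) (trans (p i) (nest-inside χ χ′ _)))
        (F.along-cancel (_ ∷ _ ∷ []) (first I ξ ξ′) (_ ∷ _ ∷ []) (λ _ → part-≡ refl) u)
        (G.along-cancel (_ ∷ _ ∷ []) (second I ξ ξ′) (_ ∷ _ ∷ _ ∷ [])
          (λ _ → part-≡ (part-≡ refl)) v))
      (H.along-cancel (_ ∷ []) (third I ξ ξ′) (_ ∷ _ ∷ _ ∷ []) (λ _ → part-≡ (part-≡ refl)) w)
    where
    ξ≗χ : ∀ i → ξ i ≡ χ i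
    -- The outer partition is recovered blockwise: the first block lies inside it, and on the other
    -- labels the inner pair carries it as its own partition.
    ξ≗χ i with true-or-false (nest ξ ξ′ i)
    ... | inj₂ eq = q (i , eq)
    ... | inj₁ eq = trans (nest⇒inside ξ ξ′ eq) (sym (nest⇒inside χ χ′ (trans (sym (p i)) eq)))

-- Conjugating reassociation by commutativity gives an injection the other way, so
-- reassociation is onto by counting.

*ˢ-assoc : ∀ F G H → (F *ˢ G) *ˢ H ≅ F *ˢ (G *ˢ H)
*ˢ-assoc F G H = bijective⇒≅ {(F *ˢ G) *ˢ H} {F *ˢ (G *ˢ H)}
  (λ {I} → associate {I}) (λ {I} {s} {t} → associate-cong {I} {s} {t}) associate-natural
  (λ {I} {s} {t} → associate-injective {I} {s} {t}) (λ {I} → associate-surjective I)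
  where
  open Associate F G H
  open Associate H G F using () renaming
    (associate to associate′; associate-injective to associate′-injective)
  there : F *ˢ (G *ˢ H) ≅ (H *ˢ G) *ˢ F
  there = ≅-trans {F *ˢ (G *ˢ H)} {(G *ˢ H) *ˢ F} {(H *ˢ G) *ˢ F} (*ˢ-comm F (G *ˢ H))
    (*ˢ-cong {G *ˢ H} {H *ˢ G} {F} {F} (*ˢ-comm G H) (≅-refl {F}))
  here : H *ˢ (G *ˢ F) ≅ (F *ˢ G) *ˢ H
  here = ≅-trans {H *ˢ (G *ˢ F)} {(G *ˢ F) *ˢ H} {(F *ˢ G) *ˢ H} (*ˢ-comm H (G *ˢ F))
    (*ˢ-cong {G *ˢ F} {F *ˢ G} {H} {H} (*ˢ-comm G F) (≅-refl {H}))
  back : ∀ I → Structure (F *ˢ (G *ˢ H)) I → Structure ((F *ˢ G) *ˢ H) I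
  back I s = Inverse.to (_≅_.iso here I) (associate′ (Inverse.to (_≅_.iso there I) s))
  back-injective : ∀ I {s t} →
    Setoid._≈_ (((F *ˢ G) *ˢ H) [ I ]) (back I s) (back I t) →
    Setoid._≈_ ((F *ˢ (G *ˢ H)) [ I ]) s t
  back-injective I p = inverse-injective (_≅_.iso there I)
    (associate′-injective (inverse-injective (_≅_.iso here I) p))
  associate-surjective : ∀ I t → ∃[ s ] Setoid._≈_ ((F *ˢ (G *ˢ H)) [ I ]) (associate {I} s) t
  associate-surjective I =
    injections⇒surjective {((F *ˢ G) *ˢ H) [ I ]} {(F *ˢ (G *ˢ H)) [ I ]}
      (Species.finite ((F *ˢ G) *ˢ H) I) (Species.finite (F *ˢ (G *ˢ H)) I)
      (associate {I}) (back I) (λ {s} {t} → associate-injective {I} {s} {t})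
      (λ {s} {t} → back-injective I {s} {t})

isCommutativeSemiring : IsCommutativeSemiring _≅_ _+ˢ_ _*ˢ_ 0ˢ 1ˢ
isCommutativeSemiring = isCommutativeSemiringˡ record
  { +-isCommutativeMonoid = record
    { isMonoid = record
      { isSemigroup = record
        { isMagma = record { isEquivalence = ≅-isEquivalence ; ∙-cong = +ˢ-cong }
        ; assoc   = +ˢ-assoc
        }
      ; identity = +ˢ-identityˡ , λ F → ≅-trans (+ˢ-comm F 0ˢ) (+ˢ-identityˡ F)
      }
    ; comm = +ˢ-comm
    }
  ; *-isCommutativeMonoid = record
    { isMonoid = record
      { isSemigroup = record
        { isMagma = record { isEquivalence = ≅-isEquivalence ; ∙-cong = *ˢ-cong }
        ; assoc   = *ˢ-assoc
        }
      ; identity = *ˢ-identityˡ , λ F → ≅-trans (*ˢ-comm F 1ˢ) (*ˢ-identityˡ F)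
      }
    ; comm = *ˢ-comm
    }
  ; distribʳ = *ˢ-distribʳ-+ˢ
  ; zeroˡ    = *ˢ-zeroˡ
  }

-- Sequences

module Summation (F : ℕ → Species) (bounded : ∀ k I → Structure (F k) I → k ≤ ∣ I ∣) where
  private
    module F k = Species (F k)
    module F′ {k} {I} = Setoid (F k [ I ])

  infix 4 _≈ᵏ_

  data _≈ᵏ_ {I} : (s t : ∃[ k ] Structure (F k) I) → Set where
    at : ∀ k {s t} → s F′.≈ t → (k , s) ≈ᵏ (k , t)

  Summands : FinSet → Setoid 0ℓ 0ℓ
  Summands I = record
    { Carrier       = ∃[ k ] Structure (F k) I
    ; _≈_           = _≈ᵏ_
    ; isEquivalence = record
      { refl  = at _ F′.refl
      ; sym   = λ { (at k p) → at k (F′.sym p) }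
      ; trans = λ { (at k p) (at .k q) → at k (F′.trans p q) }
      }
    }

  _≈ᵏ?_ : ∀ {I} → Decidable (_≈ᵏ_ {I})
  _≈ᵏ?_ {I} (k , s) (l , t) with k ℕ.≟ l
  ... | no k≢l   = no λ { (at _ _) → k≢l refl }
  ... | yes refl = map′ (at k) (λ { (at _ p) → p }) (finite⇒dec (F.finite k I) s t)

  -- By the bound only the indices from 0 to |I| can carry structures on `I`, hence the key set
  -- `Fin (suc ∣ I ∣)`.
  finite-Summands : ∀ I → Finite (Summands I)
  finite-Summands I = finite-fibred (setoid (Fin (suc ∣ I ∣))) (Summands I) (_ , ↔-id _) _≈ᵏ?_
    (λ (k , s) → fromℕ< (s≤s (bounded k I s))) over
    (λ (k , s) i e → covers (trans (sym (Fin.toℕ-fromℕ< _)) (cong toℕ e)) s)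
    where
    structures : ∀ k → ∃ (IsEnumeration (F k [ I ]))
    structures k = finite⇒list (F.finite k I)
    over : Fin (suc ∣ I ∣) → List (∃[ k ] Structure (F k) I)
    over i = map (toℕ i ,_) (proj₁ (structures (toℕ i)))
    covers : ∀ {k i} → k ≡ toℕ i → ∀ s → Membership._∈_ (Summands I) (k , s) (over i)
    covers {i = i} refl s =
      Membershipₚ.∈-map⁺ (F (toℕ i) [ I ]) (Summands I) (at _) (proj₂ (structures (toℕ i)) s)

  Σˢ : Species
  Σˢ = record
    { _[_]         = Summands
    ; finite       = finite-Summands
    ; relabel      = λ φ → record
      { to   = λ (k , s) → k , (F k ⟪ φ ⟫) s
      ; cong = λ { (at k p) → at k (F.relabel-cong k φ p) }
      }
    ; relabel-resp = λ p (k , s) → at k (F.relabel-resp k p s)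
    ; relabel-id   = λ (k , s) → at k (F.relabel-id k s)
    ; relabel-∘    = λ φ ψ (k , s) → at k (F.relabel-∘ k φ ψ s)
    }

-- The label `i` of the other part leaves room for one extra index.
size-< : ∀ {I} χ → Elem (part I χ true) → ∣ part I χ false ∣ < ∣ I ∣
size-< {I} χ (i , p) = Fin.injective⇒≤ {f = f} f-injective
  where
  module I = Inverse (proj₂ (FinSet.finite I))
  module V = Inverse (proj₂ (FinSet.finite (part I χ false)))
  f : Fin (suc ∣ part I χ false ∣) → Fin ∣ I ∣
  f zero    = I.to i
  f (suc k) = I.to (proj₁ (V.from k))
  outside : ∀ k → i ≢ proj₁ (V.from k)
  outside k e with () ← trans (sym p) (trans (cong χ e) (proj₂ (V.from k)))
  f-injective : ∀ {k l} → f k ≡ f l → k ≡ l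
  f-injective {zero}  {zero}  _ = refl
  f-injective {zero}  {suc l} e = contradiction (inverse-injective (proj₂ (FinSet.finite I)) e) (outside l)
  f-injective {suc k} {zero}  e =
    contradiction (inverse-injective (proj₂ (FinSet.finite I)) (sym e)) (outside k)
  f-injective {suc k} {suc l} e = cong suc (trans (sym (V.strictlyInverseˡ k))
    (trans (cong V.to (part-≡ (inverse-injective (proj₂ (FinSet.finite I)) e))) (V.strictlyInverseˡ l)))

module Sequences (G : Species) (inhabited : ∀ I → Structure G I → Elem I) where

  power : ℕ → Species
  power zero    = 1ˢ
  power (suc k) = G *ˢ power k

  -- Each of the `k` blocks contains a label because `G` has no structure on the empty set. This
  -- keeps the infinite sum a species.
  power-bounded : ∀ k I → Structure (power k) I → k ≤ ∣ I ∣
  power-bounded zero    _ _            = z≤n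
  power-bounded (suc k) _ (pair χ f s) =
    ℕ.≤-<-trans (power-bounded k _ s) (size-< χ (inhabited _ f))

  open Summation power power-bounded using (at)

  seq : Species
  seq = Summation.Σˢ power power-bounded

  private
    module Source {I} = Setoid ((1ˢ +ˢ G *ˢ seq) [ I ])
    module Target {I} = Setoid (seq [ I ])

  prepend : ∀ {I} → Structure (1ˢ +ˢ G *ˢ seq) I → Structure seq I
  prepend (inj₁ p)                  = 0 , p
  prepend (inj₂ (pair χ f (k , s))) = suc k , pair χ f s

  prepend-cong : ∀ {I} s t → Source._≈_ {I} s t → prepend s Target.≈ prepend t
  prepend-cong _ _ (inj₁ p) = at 0 p
  prepend-cong (inj₂ (pair χ f (k , s))) (inj₂ (pair χ′ f′ (.k , s′))) (inj₂ (pair≈ p u (at .k v))) =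
    at (suc k) (pair≈ p u v)

  prepend-natural : ∀ {I J} (φ : I ≃ J) s →
    prepend (((1ˢ +ˢ G *ˢ seq) ⟪ φ ⟫) s) Target.≈ (seq ⟪ φ ⟫) (prepend s)
  prepend-natural φ (inj₁ p)                  = at 0 refl
  prepend-natural φ (inj₂ (pair χ f (k , s))) = at (suc k) (Setoid.refl (power (suc k) [ _ ]))

  prepend-injective : ∀ {I} s t → prepend s Target.≈ prepend t → Source._≈_ {I} s t
  prepend-injective (inj₁ _) (inj₁ _) (at 0 p) = inj₁ p
  prepend-injective (inj₂ (pair χ f (k , s))) (inj₂ (pair χ′ f′ (.k , s′))) (at _ (pair≈ p u v)) =
    inj₂ (pair≈ p u (at k v))

  prepend-surjective : ∀ {I} t → ∃[ s ] prepend {I} s Target.≈ t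
  prepend-surjective (zero  , p)          = inj₁ p , at 0 refl
  prepend-surjective (suc k , pair χ f s) =
    inj₂ (pair χ f (k , s)) , at (suc k) (Setoid.refl (power (suc k) [ _ ]))

  -- The equation l = 1 + g l that `geometric` expects of the series of `G`.
  seq-unfold : seq ≅ 1ˢ +ˢ G *ˢ seq
  seq-unfold = ≅-sym {1ˢ +ˢ G *ˢ seq} {seq} (bijective⇒≅ {1ˢ +ˢ G *ˢ seq} {seq}
    (λ {I} → prepend {I}) (λ {I} {s} {t} → prepend-cong {I} s t) prepend-natural
    (λ {I} {s} {t} → prepend-injective {I} s t) (λ {I} → prepend-surjective {I}))

E₊ : Species
E₊ = record
  { _[_]         = λ I → setoid (0 < ∣ I ∣)
  ; finite       = λ I → enum I
  ; relabel      = λ φ → record { to = subst (0 <_) (∣∣-cong φ) ; cong = cong _ }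
  ; relabel-resp = λ _ _ → ℕ.≤-irrelevant _ _
  ; relabel-id   = λ _ → ℕ.≤-irrelevant _ _
  ; relabel-∘    = λ _ _ _ → ℕ.≤-irrelevant _ _
  }
  where
  enum : ∀ I → Finite (setoid (0 < ∣ I ∣))
  enum I with 0 ℕ.<? ∣ I ∣
  ... | yes p = 1 , mk↔ₛ′ (λ _ → zero) (λ _ → p) (λ { zero → refl }) (ℕ.≤-irrelevant _)
  ... | no ¬p = 0 , mk↔ₛ′ (⊥-elim ∘ ¬p) (λ ()) (λ ()) (⊥-elim ∘ ¬p)

Eˢ≅1ˢ+E₊ : Eˢ ≅ 1ˢ +ˢ E₊
Eˢ≅1ˢ+E₊ = ≅-sym (bijective⇒≅ {1ˢ +ˢ E₊} {Eˢ} (λ _ → tt) (λ _ → refl) (λ _ _ → refl)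
  (λ {I} {s} {t} _ → unique I s t) (λ {I} _ → exists I , refl))
  where
  unique : ∀ I s t → Setoid._≈_ ((1ˢ +ˢ E₊) [ I ]) s t
  unique I (inj₁ p) (inj₁ q) = inj₁ (ℕ.≡-irrelevant p q)
  unique I (inj₂ p) (inj₂ q) = inj₂ (ℕ.≤-irrelevant p q)
  unique I (inj₁ p) (inj₂ q) = contradiction (sym p) (ℕ.<⇒≢ q)
  unique I (inj₂ p) (inj₁ q) = contradiction (sym q) (ℕ.<⇒≢ p)
  exists : ∀ I → Structure (1ˢ +ˢ E₊) I
  exists I with ∣ I ∣
  ... | zero  = inj₁ refl
  ... | suc _ = inj₂ (s≤s z≤n)

positive⇒inhabited : ∀ I → 0 < ∣ I ∣ → Elem I
positive⇒inhabited I p = Inverse.from (proj₂ (FinSet.finite I)) (fromℕ< p)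

-- KS-partitions as matrices

∀? : ∀ I {P : Elem I → Set} → Decidable₁ P → Dec (∀ i → P i)
∀? I = all? (FinSet.finite I) λ { refl → id }

∃? : ∀ I {P : Elem I → Set} → Decidable₁ P → Dec (∃ P)
∃? I = any? (FinSet.finite I) λ { refl → id }

Matrix : FinSet → Set
Matrix I = Elem I → Elem I → Bool

IsMatrixIso : ∀ {I J} → I ≃ J → Matrix I → Matrix J → Set
IsMatrixIso φ M N = ∀ j k → N j k ≡ M (bwd φ j) (bwd φ k)

isMatrixIso-fwd : ∀ {I J} (φ : I ≃ J) {M N} → IsMatrixIso φ M N →
                  ∀ i j → N (fwd φ i) (fwd φ j) ≡ M i j
isMatrixIso-fwd φ {M} e i j = trans (e _ _) (cong₂ M (bwd-fwd φ i) (bwd-fwd φ j))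

record MatrixProperty : Set₁ where
  field
    Holds     : ∀ I → Matrix I → Set
    holds?    : ∀ I M → Dec (Holds I M)
    invariant : ∀ {I J} (φ : I ≃ J) {M N} → IsMatrixIso φ M N → Holds I M → Holds J N

open MatrixProperty using (Holds; holds?; invariant)

MatricesWith : MatrixProperty → Species
MatricesWith P = record
  { _[_]         = Matrices
  ; finite       = λ I → finite-subset (Adj I) (Matrices I)
      (finite-Maps I (finite-Maps I finite-Bool)) proj₁ id id
      (λ M → map′ (λ p → (M , p) , λ _ _ → refl)
        (λ ((N , p) , e) → invariant P id≃ {N} {M} (λ i j → sym (e i j)) p) (holds? P I M))
  ; relabel      = λ φ → record
      { to   = λ (M , p) → (λ j k → M (bwd φ j) (bwd φ k)) , invariant P φ {M} (λ _ _ → refl) p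
      ; cong = λ M≗N j k → M≗N (bwd φ j) (bwd φ k)
      }
  ; relabel-resp = λ {_} {_} {φ} {ψ} φ≗ψ (M , _) j k →
      cong₂ M (bwd-cong φ ψ φ≗ψ j) (bwd-cong φ ψ φ≗ψ k)
  ; relabel-id   = λ _ _ _ → refl
  ; relabel-∘    = λ _ _ _ _ _ → refl
  }
  where
  Adj : FinSet → Setoid 0ℓ 0ℓ
  Adj I = Maps I (Maps I (setoid Bool))
  Matrices : FinSet → Setoid 0ℓ 0ℓ
  Matrices I = On.setoid {B = Σ (Matrix I) (Holds P I)} (Adj I) proj₁
  bwd-cong : ∀ {I J} (φ ψ : I ≃ J) → (∀ i → fwd φ i ≡ fwd ψ i) → ∀ j → bwd φ j ≡ bwd ψ j
  bwd-cong φ ψ φ≗ψ j = trans (sym (bwd-fwd ψ (bwd φ j)))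
    (cong (bwd ψ) (trans (sym (φ≗ψ (bwd φ j))) (fwd-bwd φ j)))

MatricesWith-⊎ : ∀ P Q R →
  (∀ {I M} → Holds P I M → Holds R I M) → (∀ {I M} → Holds Q I M → Holds R I M) →
  (∀ {I M} → Holds R I M → Holds P I M ⊎ Holds Q I M) →
  (∀ {I M N} → (∀ i j → M i j ≡ N i j) → Holds P I M → ¬ Holds Q I N) →
  MatricesWith P +ˢ MatricesWith Q ≅ MatricesWith R
MatricesWith-⊎ P Q R P⇒R Q⇒R R⇒P⊎Q disjoint =
  bijective⇒≅ {MatricesWith P +ˢ MatricesWith Q} {MatricesWith R}
    include
    (λ { {_} {inj₁ _} {inj₁ _} (inj₁ e) → e ; {_} {inj₂ _} {inj₂ _} (inj₂ e) → e })
    (λ φ → λ { (inj₁ _) _ _ → refl ; (inj₂ _) _ _ → refl })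
    (λ { {_} {inj₁ _} {inj₁ _} e → inj₁ e
       ; {_} {inj₂ _} {inj₂ _} e → inj₂ e
       ; {_} {inj₁ (_ , p)} {inj₂ (_ , q)} e → ⊥-elim (disjoint e p q)
       ; {_} {inj₂ (_ , q)} {inj₁ (_ , p)} e → ⊥-elim (disjoint (λ i j → sym (e i j)) p q) })
    (λ (M , r) → onto M (R⇒P⊎Q r))
  where
  include : ∀ {I} → Structure (MatricesWith P +ˢ MatricesWith Q) I → Structure (MatricesWith R) I
  include (inj₁ (M , p)) = M , P⇒R p
  include (inj₂ (M , q)) = M , Q⇒R q
  onto : ∀ {I} M → Holds P I M ⊎ Holds Q I M →
         ∃[ s ] (∀ i j → proj₁ (include {I} s) i j ≡ M i j)
  onto M (inj₁ p) = inj₁ (M , p) , λ _ _ → refl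
  onto M (inj₂ q) = inj₂ (M , q) , λ _ _ → refl

-- A graph with a KS-partition, as a matrix whose diagonal carries the partition:
-- true for K and false for S.

record IsColoured {A : Set} (M : A → A → Bool) : Set where
  constructor coloured
  field
    symmetric : ∀ i j → M i j ≡ M j i
    uniform   : ∀ i j → M i i ≡ M j j → M i j ≡ M i i

open IsColoured

-- v can change sides: it is adjacent to the other vertices in K and to none in S.

IsSwing : ∀ {A : Set} → (A → A → Bool) → A → Set
IsSwing M v = ∀ j → M v j ≡ M j j

isColoured? : ∀ I M → Dec (IsColoured {Elem I} M)
isColoured? I M = map′ (λ (s , u) → coloured s u) (λ (coloured s u) → s , u)
  ((∀? I λ i → ∀? I λ j → M i j Bool.≟ M j i)
   ×-dec (∀? I λ i → ∀? I λ j → (M i i Bool.≟ M j j) →-dec (M i j Bool.≟ M i i)))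

isSwing? : ∀ I M → Decidable₁ (IsSwing {Elem I} M)
isSwing? I M v = ∀? I λ j → M v j Bool.≟ M j j

isColoured-iso : ∀ {I J} (φ : I ≃ J) {M N} → IsMatrixIso φ M N → IsColoured M → IsColoured N
isColoured-iso φ e (coloured s u) = coloured
  (λ i j → trans (e i j) (trans (s _ _) (sym (e j i))))
  (λ i j p → trans (e i j) (trans (u _ _ (trans (sym (e i i)) (trans p (e j j)))) (sym (e i i))))

isSwing-iso : ∀ {I J} (φ : I ≃ J) {M N} → IsMatrixIso φ M N →
              ∀ {v} → IsSwing M v → IsSwing N (fwd φ v)
isSwing-iso φ {M} e {v} s j = trans (e _ j)
  (trans (cong (λ i → M i (bwd φ j)) (bwd-fwd φ v)) (trans (s (bwd φ j)) (sym (e j j))))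

isSwing-iso⁻¹ : ∀ {I J} (φ : I ≃ J) {M N} → IsMatrixIso φ M N →
                ∀ {v} → IsSwing N v → IsSwing M (bwd φ v)
isSwing-iso⁻¹ φ {M} {N} e {v} s i =
  trans (cong (M (bwd φ v)) (sym (bwd-fwd φ i))) (trans (sym (e v (fwd φ i)))
    (trans (s (fwd φ i)) (isMatrixIso-fwd φ {M} {N} e i i)))

Colouring : MatrixProperty
Colouring = record
  { Holds     = λ I → IsColoured
  ; holds?    = isColoured?
  ; invariant = λ φ {M} {N} → isColoured-iso φ {M} {N}
  }

HasSwing : ∀ {A : Set} → Bool → (A → A → Bool) → Set
HasSwing b M = ∃[ v ] M v v ≡ b × IsSwing M v

hasSwing? : ∀ b I M → Dec (HasSwing {Elem I} b M)
hasSwing? b I M = ∃? I λ v → (M v v Bool.≟ b) ×-dec isSwing? I M v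

hasSwing-iso : ∀ {b I J} (φ : I ≃ J) {M N} → IsMatrixIso φ M N → HasSwing b M → HasSwing b N
hasSwing-iso φ {M} {N} e (v , p , s) =
  fwd φ v , trans (isMatrixIso-fwd φ {M} {N} e v v) p , isSwing-iso φ {M} {N} e s

hasSwing-iso⁻¹ : ∀ {b I J} (φ : I ≃ J) {M N} → IsMatrixIso φ M N → HasSwing b N → HasSwing b M
hasSwing-iso⁻¹ φ {M} {N} e (v , p , s) = bwd φ v , trans (sym (e v v)) p , isSwing-iso⁻¹ φ {M} {N} e s

WithSwing WithoutSwing : Bool → MatrixProperty
WithSwing b = record
  { Holds     = λ I M → IsColoured M × HasSwing b M
  ; holds?    = λ I M → isColoured? I M ×-dec hasSwing? b I M
  ; invariant = λ φ {M} {N} e (c , h) → isColoured-iso φ {M} {N} e c , hasSwing-iso φ {M} {N} e h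
  }
WithoutSwing b = record
  { Holds     = λ I M → IsColoured M × ¬ HasSwing b M
  ; holds?    = λ I M → isColoured? I M ×-dec ¬? (hasSwing? b I M)
  ; invariant = λ φ {M} {N} e (c , h) → isColoured-iso φ {M} {N} e c , h ∘ hasSwing-iso⁻¹ φ {M} {N} e
  }

Rigid : MatrixProperty
Rigid = record
  { Holds     = λ I M → IsColoured M × (∀ v → ¬ IsSwing M v)
  ; holds?    = λ I M → isColoured? I M ×-dec ∀? I (λ v → ¬? (isSwing? I M v))
  ; invariant = λ φ {M} {N} e (c , h) →
      isColoured-iso φ {M} {N} e c , λ v s → h _ (isSwing-iso⁻¹ φ {M} {N} e s)
  }

-- KS-partitioned graphs sorted by their swing vertices

Cˢ Bˢ : Species
Cˢ = MatricesWith Colouring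
Bˢ = MatricesWith Rigid

Nˢ Wˢ : Bool → Species
Nˢ b = MatricesWith (WithoutSwing b)
Wˢ b = MatricesWith (WithSwing b)

-- Both colours equal the entry between `v` and `w`, hence swing vertices never occur in K and S at
-- once.
swings-same-colour : ∀ {A : Set} {M : A → A → Bool} → IsColoured M →
  ∀ {v w} → IsSwing M v → IsSwing M w → M v v ≡ M w w
swings-same-colour c {v} {w} s t = trans (sym (t v)) (trans (symmetric c w v) (s w))

hasSwing-resp : ∀ {A : Set} {b} {M N : A → A → Bool} → (∀ i j → M i j ≡ N i j) →
                HasSwing b M → HasSwing b N
hasSwing-resp e (v , p , s) =
  v , trans (sym (e v v)) p , λ j → trans (sym (e v j)) (trans (s j) (e j j))

Nˢ+Wˢ≅Cˢ : ∀ b → Nˢ b +ˢ Wˢ b ≅ Cˢ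
Nˢ+Wˢ≅Cˢ b = MatricesWith-⊎ (WithoutSwing b) (WithSwing b) Colouring proj₁ proj₁
  (λ {I} {M} c → decide I c (hasSwing? b I M))
  (λ e (_ , ¬h) (_ , h) → ¬h (hasSwing-resp (λ i j → sym (e i j)) h))
  where
  decide : ∀ I {M} → IsColoured {Elem I} M → Dec (HasSwing b M) →
    (IsColoured M × ¬ HasSwing b M) ⊎ (IsColoured M × HasSwing b M)
  decide I c (yes h) = inj₂ (c , h)
  decide I c (no ¬h) = inj₁ (c , ¬h)

Bˢ+Wˢ≅Nˢ : Bˢ +ˢ Wˢ true ≅ Nˢ false
Bˢ+Wˢ≅Nˢ = MatricesWith-⊎ Rigid (WithSwing true) (WithoutSwing false)
  (λ (c , h) → c , λ (v , _ , s) → h v s)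
  (λ (c , (v , p , s)) → c , λ (w , q , t) →
    contradiction (trans (sym p) (trans (swings-same-colour c s t) q)) λ ())
  (λ {I} {M} (c , h) → decide I c h (hasSwing? true I M))
  (λ e (_ , ¬h) (_ , h) → let v , _ , s = hasSwing-resp (λ i j → sym (e i j)) h in ¬h v s)
  where
  decide : ∀ I {M} → IsColoured {Elem I} M → ¬ HasSwing false M → Dec (HasSwing true M) →
    (IsColoured M × (∀ v → ¬ IsSwing M v)) ⊎ (IsColoured M × HasSwing true M)
  decide I c h (yes p) = inj₂ (c , p)
  decide I {M} c h (no ¬p) = inj₁ (c , rigid)
    where
    rigid : ∀ v → ¬ IsSwing M v
    rigid v s with true-or-false (M v v)
    ... | inj₁ p = ¬p (v , p , s)
    ... | inj₂ p = h (v , p , s)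

-- Extends the matrix R on the complement of χ by swing vertices of colour b.

module Extension {A : Set} (χ : A → Bool) (b : Bool)
  (R : (x y : Σ A λ i → χ i ≡ false) → Bool) where

  extendAt : ∀ i j c d → χ i ≡ c → χ j ≡ d → Bool
  extendAt i j true  true  p q = b
  extendAt i j true  false p q = R (j , q) (j , q)
  extendAt i j false true  p q = R (i , p) (i , p)
  extendAt i j false false p q = R (i , p) (j , q)

  extend : A → A → Bool
  extend i j = extendAt i j (χ i) (χ j) refl refl

  extend≡ : ∀ {i j c d} (p : χ i ≡ c) (q : χ j ≡ d) → extend i j ≡ extendAt i j c d p q
  extend≡ refl refl = refl

  extend-swing : ∀ {v} → χ v ≡ true → IsSwing extend v
  extend-swing {v} p j with true-or-false (χ j)
  ... | inj₁ q = trans (extend≡ p q) (sym (extend≡ q q))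
  ... | inj₂ q = trans (extend≡ p q) (sym (extend≡ q q))

  extend-coloured : IsColoured R → IsColoured extend
  extend-coloured c = coloured extend-symmetric extend-uniform
    where
    extend-symmetric : ∀ i j → extend i j ≡ extend j i
    extend-symmetric i j with true-or-false (χ i) | true-or-false (χ j)
    ... | inj₁ p | inj₁ q = trans (extend≡ p q) (sym (extend≡ q p))
    ... | inj₁ p | inj₂ q = trans (extend≡ p q) (sym (extend≡ q p))
    ... | inj₂ p | inj₁ q = trans (extend≡ p q) (sym (extend≡ q p))
    ... | inj₂ p | inj₂ q = trans (extend≡ p q) (trans (symmetric c _ _) (sym (extend≡ q p)))
    extend-uniform : ∀ i j → extend i i ≡ extend j j → extend i j ≡ extend i i
    extend-uniform i j e with true-or-false (χ i) | true-or-false (χ j)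
    ... | inj₁ p | _      = trans (extend-swing p j) (sym e)
    ... | inj₂ p | inj₁ q = trans (extend≡ p q) (sym (extend≡ p p))
    ... | inj₂ p | inj₂ q = trans (extend≡ p q)
      (trans (uniform c _ _ (trans (sym (extend≡ p p)) (trans e (extend≡ q q)))) (sym (extend≡ p p)))

  extend-swing⁻¹ : ∀ {v} (p : χ v ≡ false) → IsSwing extend v → IsSwing R (v , p)
  extend-swing⁻¹ p s (j , q) =
    trans (sym (extend≡ p q)) (trans (s j) (extend≡ q q))

open Extension using (extend; extend≡; extend-swing; extend-coloured; extend-swing⁻¹)

-- Yields congruence for `φ = id` and naturality for `bwd φ`, for `attach` as well as `plant`. The
-- colours `b` and `d` are kept apart because `plant` computes them from the two remaining matrices.
extend-cong : ∀ {A B : Set} (φ : B → A) χ b R (ξ : B → Bool) d Q →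
  (∀ j → ξ j ≡ χ (φ j)) → d ≡ b →
  (∀ j k p q p′ q′ → Q (j , p) (k , q) ≡ R (φ j , p′) (φ k , q′)) →
  ∀ j k → extend ξ d Q j k ≡ extend χ b R (φ j) (φ k)
extend-cong φ χ b R ξ d Q e d≡b Q≡R j k with true-or-false (ξ j) | true-or-false (ξ k)
... | inj₁ p | inj₁ q = trans (extend≡ ξ d Q p q) (trans d≡b (sym
      (extend≡ χ b R (trans (sym (e j)) p) (trans (sym (e k)) q))))
... | inj₁ p | inj₂ q = trans (extend≡ ξ d Q p q) (trans (Q≡R _ _ _ _ _ _) (sym
      (extend≡ χ b R (trans (sym (e j)) p) (trans (sym (e k)) q))))
... | inj₂ p | inj₁ q = trans (extend≡ ξ d Q p q) (trans (Q≡R _ _ _ _ _ _) (sym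
      (extend≡ χ b R (trans (sym (e j)) p) (trans (sym (e k)) q))))
... | inj₂ p | inj₂ q = trans (extend≡ ξ d Q p q) (trans (Q≡R _ _ _ _ _ _) (sym
      (extend≡ χ b R (trans (sym (e j)) p) (trans (sym (e k)) q))))

extend-injective : ∀ {A : Set} (χ : A → Bool) b R ξ d Q →
  (∀ i j → extend χ b R i j ≡ extend ξ d Q i j) →
  ∀ i j p q p′ q′ → R (i , p) (j , q) ≡ Q (i , p′) (j , q′)
extend-injective χ b R ξ d Q e i j p q p′ q′ =
  trans (sym (extend≡ χ b R p q)) (trans (e i j) (extend≡ ξ d Q p′ q′))

restriction : ∀ {A : Set} → (A → A → Bool) → (χ : A → Bool) →
              (x y : Σ A λ i → χ i ≡ false) → Bool
restriction M χ (i , _) (j , _) = M i j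

restriction-coloured : ∀ {A : Set} {M : A → A → Bool} χ → IsColoured M → IsColoured (restriction M χ)
restriction-coloured χ (coloured s u) = coloured (λ _ _ → s _ _) (λ _ _ → u _ _)

extend-restriction : ∀ {A : Set} {M : A → A → Bool} χ {b} → IsColoured M →
  (∀ i → χ i ≡ true → M i i ≡ b × IsSwing M i) →
  ∀ i j → extend χ b (restriction M χ) i j ≡ M i j
extend-restriction {M = M} χ {b} c new i j with true-or-false (χ i) | true-or-false (χ j)
... | inj₁ p | inj₁ q = trans (extend≡ χ b (restriction M χ) p q)
      (sym (trans (proj₂ (new i p) j) (proj₁ (new j q))))
... | inj₁ p | inj₂ q = trans (extend≡ χ b (restriction M χ) p q) (sym (proj₂ (new i p) j))
... | inj₂ p | inj₁ q = trans (extend≡ χ b (restriction M χ) p q)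
      (sym (trans (symmetric c i j) (proj₂ (new j q) i)))
... | inj₂ p | inj₂ q = extend≡ χ b (restriction M χ) p q

does⇒ : ∀ {P : Set} (p? : Dec P) → does p? ≡ true → P
does⇒ (yes p) _ = p

module _ (b : Bool) where
  private
    module C I = Setoid (Cˢ [ I ])
    module E*N {I} = Setoid ((Eˢ *ˢ Nˢ b) [ I ])

  attach : ∀ {I} → Structure (Eˢ *ˢ Nˢ b) I → Structure Cˢ I
  attach (pair χ _ (R , c , _)) = extend χ b R , extend-coloured χ b R c

  attach-cong : ∀ {I} s t → s E*N.≈ t → C._≈_ I (attach {I} s) (attach {I} t)
  attach-cong (pair χ _ (R , _)) (pair ξ _ (Q , _)) (pair≈ p _ v) i j = sym
    (extend-cong id χ b R ξ b Q p refl
      (λ j k q r q′ r′ → trans (sym (v (j , q) (k , r))) (cong₂ R (part-≡ refl) (part-≡ refl))) i j)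

  attach-natural : ∀ {I J} (φ : I ≃ J) s →
    C._≈_ J (attach {J} (((Eˢ *ˢ Nˢ b) ⟪ φ ⟫) s)) ((Cˢ ⟪ φ ⟫) (attach {I} s))
  attach-natural φ (pair χ _ (R , _)) =
    extend-cong (bwd φ) χ b R (χ ∘ bwd φ) b _ (λ _ → refl) refl
      (λ _ _ _ _ _ _ → cong₂ R (part-≡ refl) (part-≡ refl))

  -- A swing vertex of the whole outside the added set would be swing in `R`, which has none of
  -- colour `b`. So the added set can be read off from the result, which is what injectivity needs.
  attach-new : ∀ {I} s i → Product.χ s i ≡ true ⇔
    (proj₁ (attach {I} s) i i ≡ b × IsSwing (proj₁ (attach {I} s)) i)
  attach-new (pair χ _ (R , _ , h)) i = mk⇔
    (λ p → extend≡ χ b R p p , extend-swing χ b R p)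
    (λ (p , s) → Bool.¬-not λ q →
      h ((i , q) , trans (sym (extend≡ χ b R q q)) p , extend-swing⁻¹ χ b R q s))

  attach-injective : ∀ {I} s t → C._≈_ I (attach {I} s) (attach {I} t) → s E*N.≈ t
  attach-injective {I} s@(pair χ _ (R , _)) t@(pair ξ _ (Q , _)) e = pair≈
    (λ i → Bool.⇔→≡ {z = true} (mk⇔
      (λ p → let q , r = Equivalence.to (attach-new {I} t i) p in
        Equivalence.from (attach-new {I} s i)
          (trans (e i i) q , λ j → trans (e i j) (trans (r j) (sym (e j j)))))
      (λ p → let q , r = Equivalence.to (attach-new {I} s i) p in
        Equivalence.from (attach-new {I} t i)
          (trans (sym (e i i)) q , λ j → trans (sym (e i j)) (trans (r j) (e j j))))))
    refl
    (λ (i , p) (j , q) → extend-injective χ b R ξ b Q e i j _ _ p q)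

  attach-surjective : ∀ {I} t → ∃[ s ] C._≈_ I (attach {I} s) t
  attach-surjective {I} (M , c) =
      pair χ tt (restriction M χ , restriction-coloured χ c , none)
    , extend-restriction χ c (λ i → old i)
    where
    new? : ∀ i → Dec (M i i ≡ b × IsSwing M i)
    new? i = (M i i Bool.≟ b) ×-dec isSwing? I M i
    χ : Elem I → Bool
    χ i = does (new? i)
    old : ∀ i → χ i ≡ true → M i i ≡ b × IsSwing M i
    old i = does⇒ (new? i)
    none : ¬ HasSwing b (restriction M χ)
    none ((i , p) , q , s) = Bool.not-¬ p (dec-true (new? i) (q , swing))
      where
      -- Deleting the swing vertices of colour `b` creates no new ones: a deleted `j` has entry
      -- `M i i` with `i`, and both have colour `b`.
      swing : IsSwing M i
      swing j with true-or-false (χ j)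
      ... | inj₁ r = let u , t = old j r in trans (symmetric c i j) (trans (t i) (trans q (sym u)))
      ... | inj₂ r = s (j , r)

Eˢ*Nˢ≅Cˢ : ∀ b → Eˢ *ˢ Nˢ b ≅ Cˢ
Eˢ*Nˢ≅Cˢ b = bijective⇒≅ {Eˢ *ˢ Nˢ b} {Cˢ}
  (λ {I} → attach b {I}) (λ {I} {s} {t} → attach-cong b {I} s t) (λ {I} {J} → attach-natural b {I} {J})
  (λ {I} {s} {t} → attach-injective b {I} s t) (λ {I} → attach-surjective b {I})

-- Comparing the KS-partitions of one graph

module _ (I : FinSet) where
  private
    A = Elem I

  _≟_ : (i j : A) → Dec (i ≡ j)
  _≟_ = finite⇒dec (FinSet.finite I)

  -- One operation for three purposes: toggling a vertex, clearing the diagonal to obtain a graph,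
  -- and painting a partition onto a graph.
  recolour : (A → A → Bool) → (A → Bool) → A → A → Bool
  recolour M κ i j with i ≟ j
  ... | yes _ = κ i
  ... | no _  = M i j

  recolour-diagonal : ∀ M κ i → recolour M κ i i ≡ κ i
  recolour-diagonal M κ i with i ≟ i
  ... | yes _  = refl
  ... | no i≢i = contradiction refl i≢i

  recolour-off : ∀ M κ {i j} → i ≢ j → recolour M κ i j ≡ M i j
  recolour-off M κ {i} {j} i≢j with i ≟ j
  ... | yes i≡j = contradiction i≡j i≢j
  ... | no _    = refl

  recolour-symmetric : ∀ {M κ} → (∀ i j → M i j ≡ M j i) →
                       ∀ i j → recolour M κ i j ≡ recolour M κ j i
  recolour-symmetric {M} {κ} s i j with i ≟ j
  ... | yes refl = sym (recolour-diagonal M κ i)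
  ... | no i≢j   = trans (s i j) (sym (recolour-off M κ (i≢j ∘ sym)))

  toggleAt : (A → A → Bool) → A → A → Bool
  toggleAt M v i with i ≟ v
  ... | yes _ = not (M i i)
  ... | no _  = M i i

  toggle : (A → A → Bool) → A → A → A → Bool
  toggle M v = recolour M (toggleAt M v)

  toggle-here : ∀ M v → toggle M v v v ≡ not (M v v)
  toggle-here M v = trans (recolour-diagonal M _ v) at-v
    where
    at-v : toggleAt M v v ≡ not (M v v)
    at-v with v ≟ v
    ... | yes _  = refl
    ... | no v≢v = contradiction refl v≢v

  toggle-there : ∀ M v {i j} → i ≢ v ⊎ j ≢ v → toggle M v i j ≡ M i j
  toggle-there M v {i} {j} away with i ≟ j
  ... | no _     = refl
  ... | yes refl = away-from-v away
    where
    away-from-v : i ≢ v ⊎ i ≢ v → toggleAt M v i ≡ M i i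
    away-from-v away with i ≟ v | away
    ... | no _    | _        = refl
    ... | yes i≡v | inj₁ i≢v = contradiction i≡v i≢v
    ... | yes i≡v | inj₂ i≢v = contradiction i≡v i≢v

  toggle-swing : ∀ {M v} → IsSwing M v → IsSwing (toggle M v) v
  toggle-swing {M} {v} s j with j ≟ v
  ... | yes refl = refl
  ... | no j≢v   = trans (toggle-there M v (inj₂ j≢v)) (trans (s j) (sym (toggle-there M v (inj₁ j≢v))))

  -- Row `v` equals the diagonal, so uniformity at `v` holds with either colour of `v`.
  toggle-coloured : ∀ {M v} → IsColoured M → IsSwing M v → IsColoured (toggle M v)
  toggle-coloured {M} {v} c s = coloured toggle-symmetric toggle-uniform
    where
    toggle-symmetric : ∀ i j → toggle M v i j ≡ toggle M v j i
    toggle-symmetric = recolour-symmetric (symmetric c)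
    toggle-uniform : ∀ i j → toggle M v i i ≡ toggle M v j j → toggle M v i j ≡ toggle M v i i
    toggle-uniform i j e with i ≟ v | j ≟ v
    ... | yes refl | _        = trans (toggle-swing s j) (sym e)
    ... | no _     | yes refl = trans (toggle-symmetric i v) (toggle-swing s i)
    ... | no i≢v   | no j≢v   = trans (toggle-there M v (inj₁ i≢v)) (trans
      (uniform c i j (trans (sym (toggle-there M v (inj₁ i≢v))) (trans e (toggle-there M v (inj₁ j≢v)))))
      (sym (toggle-there M v (inj₁ i≢v))))

  -- In the star of KS-partitions, the leaf on the edge w has w in K exactly when the
  -- partition induced on the other vertices has a swing vertex in S. If w is the only
  -- edge, its end with w in S is taken to be the leaf.

  RestSwing : (A → A → Bool) → A → Set
  RestSwing M w = ∃[ v ] v ≢ w × M v v ≡ false × (∀ j → j ≢ w → M v j ≡ M j j)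

  record IsLeaf (M : A → A → Bool) (w : A) : Set where
    constructor leaf
    field
      swing      : IsSwing M w
      true⇒rest : M w w ≡ true → RestSwing M w
      rest⇒true : RestSwing M w → M w w ≡ true

  open IsLeaf

  restSwing? : ∀ M w → Dec (RestSwing M w)
  restSwing? M w = ∃? I λ v → ¬? (v ≟ w) ×-dec ((M v v Bool.≟ false)
    ×-dec ∀? I (λ j → ¬? (j ≟ w) →-dec (M v j Bool.≟ M j j)))

  isLeaf? : ∀ M w → Dec (IsLeaf M w)
  isLeaf? M w = map′ (λ (s , f , g) → leaf s f g) (λ (leaf s f g) → s , f , g)
    (isSwing? I M w ×-dec (((M w w Bool.≟ true) →-dec restSwing? M w)
      ×-dec (restSwing? M w →-dec (M w w Bool.≟ true))))

  -- Let `v` be another swing vertex; it has the colour of `w`. If both are in S, then `v` is a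
  -- swing vertex in S of the rest, which would put `w` in K. If both are in K, the vertex `u` of S
  -- given by `true⇒rest` is non-adjacent to `v` because `v` is swing, yet adjacent to it because
  -- `u` is swing in the rest.
  leaf-unique : ∀ {M w v} → IsColoured M → IsLeaf M w → IsSwing M v → v ≡ w
  leaf-unique {M} {w} {v} c l s with v ≟ w
  ... | yes v≡w = v≡w
  ... | no v≢w  with true-or-false (M w w)
  ...   | inj₂ p = contradiction
    (rest⇒true l (v , v≢w , trans (swings-same-colour c s (swing l)) p , λ j _ → s j))
    (Bool.not-¬ p)
  ...   | inj₁ p = let u , _ , q , t = true⇒rest l p in contradiction
    (trans (sym q) (trans (sym (s u)) (trans (symmetric c v u)
      (trans (t v v≢w) (trans (swings-same-colour c s (swing l)) p)))))
    λ ()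

  module _ {M N : A → A → Bool} (cM : IsColoured M) (cN : IsColoured N)
           (M≡N : ∀ {i j} → i ≢ j → M i j ≡ N i j) where

    -- In one of the two partitions `v` has the same colour as `k`, and uniformity there determines
    -- the common entry.
    agree⇒swing : ∀ {v k} → M v v ≢ N v v → M k k ≡ N k k → M v k ≡ M k k
    agree⇒swing {v} {k} v≢ k≡ with v ≟ k
    ... | yes refl = refl
    ... | no v≢k with M k k Bool.≟ M v v
    ...   | yes p = trans (uniform cM v k (sym p)) (sym p)
    ...   | no ¬p = trans (M≡N v≢k) (trans (uniform cN v k q) (trans q (sym k≡)))
      where
      q : N v v ≡ N k k
      q = trans (Bool.¬-not (v≢ ∘ sym)) (trans (sym (Bool.¬-not ¬p)) k≡)

    -- If `i` and `j` had one colour in `M`, they would share the other colour in `N`, and the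
    -- common entry would have to equal both.
    disagree⇒opposite : ∀ {i j} → i ≢ j → M i i ≢ N i i → M j j ≢ N j j → M i i ≢ M j j
    disagree⇒opposite {i} {j} i≢j i≢ j≢ p = i≢ (trans (sym (uniform cM i j p))
      (trans (M≡N i≢j) (uniform cN i j q)))
      where
      q : N i i ≡ N j j
      q = trans (Bool.¬-not (i≢ ∘ sym)) (trans (cong not p) (sym (Bool.¬-not (j≢ ∘ sym))))

    -- Exhaustive by `disagree⇒opposite`: at most one vertex moves in each direction.
    data Comparison : Set where
      same : (∀ i → M i i ≡ N i i) → Comparison
      flip : ∀ v → M v v ≢ N v v → (∀ k → k ≢ v → M k k ≡ N k k) → Comparison
      swap : ∀ v w → M v v ≡ true → M w w ≡ false → N v v ≡ false → N w w ≡ true →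
             (∀ k → k ≢ v → k ≢ w → M k k ≡ N k k) → Comparison

    compare : Comparison
    compare with ∃? I (λ i → ¬? (M i i Bool.≟ N i i))
    ... | no ¬p = same λ i → decidable-stable (M i i Bool.≟ N i i) λ q → ¬p (i , q)
    ... | yes (i , i≢) with ∃? I (λ j → ¬? (j ≟ i) ×-dec ¬? (M j j Bool.≟ N j j))
    ...   | no ¬p = flip i i≢ λ k k≢i →
      decidable-stable (M k k Bool.≟ N k k) λ q → ¬p (k , k≢i , q)
    ...   | yes (j , j≢i , j≢) with true-or-false (M i i)
    ...     | inj₁ p = swap i j p q (trans (Bool.¬-not (i≢ ∘ sym)) (cong not p))
                                    (trans (Bool.¬-not (j≢ ∘ sym)) (cong not q)) others
      where
      q : M j j ≡ false
      q = trans (Bool.¬-not (disagree⇒opposite j≢i j≢ i≢)) (cong not p)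
      -- There are only two colours: a third disagreeing vertex would be opposite to both `i` and
      -- `j`, which are opposite to each other.
      others : ∀ k → k ≢ i → k ≢ j → M k k ≡ N k k
      others k k≢i k≢j = decidable-stable (M k k Bool.≟ N k k) λ k≢ →
        disagree⇒opposite k≢j k≢ j≢ (trans (Bool.¬-not (disagree⇒opposite k≢i k≢ i≢))
          (sym (Bool.¬-not (disagree⇒opposite j≢i j≢ i≢))))
    ...     | inj₂ p = swap j i q p (trans (Bool.¬-not (j≢ ∘ sym)) (cong not q))
                                    (trans (Bool.¬-not (i≢ ∘ sym)) (cong not p)) others
      where
      q : M j j ≡ true
      q = trans (Bool.¬-not (disagree⇒opposite j≢i j≢ i≢)) (cong not p)
      others : ∀ k → k ≢ j → k ≢ i → M k k ≡ N k k
      others k k≢j k≢i = decidable-stable (M k k Bool.≟ N k k) λ k≢ →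
        disagree⇒opposite k≢j k≢ j≢ (trans (Bool.¬-not (disagree⇒opposite k≢i k≢ i≢))
          (sym (Bool.¬-not (disagree⇒opposite j≢i j≢ i≢))))

    extensional : (∀ i → M i i ≡ N i i) → ∀ i j → M i j ≡ N i j
    extensional d i j with i ≟ j
    ... | yes refl = d i
    ... | no i≢j   = M≡N i≢j

    flip-swing : ∀ {v} → M v v ≢ N v v → (∀ k → k ≢ v → M k k ≡ N k k) → IsSwing M v
    flip-swing {v} v≢ d k with k ≟ v
    ... | yes refl = refl
    ... | no k≢v   = agree⇒swing v≢ (d k k≢v)

  module _ {M N : A → A → Bool} (cM : IsColoured M) (cN : IsColoured N)
           (M≡N : ∀ {i j} → i ≢ j → M i j ≡ N i j)
           {v w : A} (p : M v v ≡ true) (q : M w w ≡ false) (p′ : N v v ≡ false) (q′ : N w w ≡ true)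
           (d : ∀ k → k ≢ v → k ≢ w → M k k ≡ N k k) where
    private
      v≢ : M v v ≢ N v v
      v≢ e = Bool.not-¬ p′ (trans (sym e) p)
      w≢ : M w w ≢ N w w
      w≢ e = Bool.not-¬ q (trans e q′)
      v≢w : v ≢ w
      v≢w refl = Bool.not-¬ q p
      swings : ∀ (L : A → A → Bool) {x y} → (∀ k → k ≢ x → k ≢ y → L x k ≡ L k k) →
               L x y ≡ L y y → IsSwing L x
      swings L {x} {y} others xy k with k ≟ x | k ≟ y
      ... | yes refl | _        = refl
      ... | no _     | yes refl = xy
      ... | no k≢x   | no k≢y   = others k k≢x k≢y

    -- If `v` and `w` are adjacent, the partition between `M` and `N` has both in K. It is reached
    -- from `M` by moving `w` and from `N` by moving `v`; in the non-adjacent case below both are in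
    -- S instead.
    swap-swing-true : M v w ≡ true → IsSwing M w × IsSwing N v
    swap-swing-true e =
        swings M (λ k k≢w k≢v → agree⇒swing cM cN M≡N w≢ (d k k≢v k≢w))
          (trans (symmetric cM w v) (trans e (sym p)))
      , swings N (λ k k≢v k≢w → agree⇒swing cN cM (sym ∘ M≡N) (v≢ ∘ sym) (sym (d k k≢v k≢w)))
          (trans (sym (M≡N v≢w)) (trans e (sym q′)))

    swap-swing-false : M v w ≡ false → IsSwing M v × IsSwing N w
    swap-swing-false e =
        swings M (λ k k≢v k≢w → agree⇒swing cM cN M≡N v≢ (d k k≢v k≢w)) (trans e (sym q))
      , swings N (λ k k≢w k≢v → agree⇒swing cN cM (sym ∘ M≡N) (w≢ ∘ sym) (sym (d k k≢v k≢w)))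
          (trans (symmetric cN w v) (trans (sym (M≡N v≢w)) (trans e (sym p′))))

  -- Each way of differing listed by `compare` produces a swing vertex of `M`.
  rigid-unique : ∀ {M N : A → A → Bool} → IsColoured M → IsColoured N →
    (∀ {i j} → i ≢ j → M i j ≡ N i j) → (∀ v → ¬ IsSwing M v) → ∀ i j → M i j ≡ N i j
  rigid-unique {M} {N} cM cN M≡N rigid with compare cM cN M≡N
  ... | same d       = extensional cM cN M≡N d
  ... | flip v v≢ d  = ⊥-elim (rigid v (flip-swing cM cN M≡N v≢ d))
  ... | swap v w p q p′ q′ d with true-or-false (M v w)
  ...   | inj₁ e = ⊥-elim (rigid w (proj₁ (swap-swing-true cM cN M≡N p q p′ q′ d e)))
  ...   | inj₂ e = ⊥-elim (rigid v (proj₁ (swap-swing-false cM cN M≡N p q p′ q′ d e)))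

  -- If `M` and `N` differ at `v` only, the condition `RestSwing` at `v` is the same for both while
  -- the colour of `v` is not, so one of them is a leaf. After a swap already `M` is a leaf, at `w`
  -- or at `v` according to adjacency.
  centre-unique : ∀ {M N : A → A → Bool} → IsColoured M → IsColoured N →
    (∀ {i j} → i ≢ j → M i j ≡ N i j) →
    (∀ v → ¬ IsLeaf M v) → (∀ v → ¬ IsLeaf N v) → ∀ i j → M i j ≡ N i j
  centre-unique {M} {N} cM cN M≡N ¬leafM ¬leafN with compare cM cN M≡N
  ... | same d = extensional cM cN M≡N d
  ... | flip v v≢ d = ⊥-elim contra
    where
    sM : IsSwing M v
    sM = flip-swing cM cN M≡N v≢ d
    sN : IsSwing N v
    sN = flip-swing cN cM (sym ∘ M≡N) (v≢ ∘ sym) (λ k k≢ → sym (d k k≢))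
    rest-agree : ∀ {u} → u ≢ v → ∀ j → M u j ≡ N u j
    rest-agree {u} u≢v j with u ≟ j
    ... | yes refl = d u u≢v
    ... | no u≢j   = M≡N u≢j
    M⇒N : RestSwing M v → RestSwing N v
    M⇒N (u , u≢v , p , t) = u , u≢v , trans (sym (d u u≢v)) p
      , λ j j≢v → trans (sym (rest-agree u≢v j)) (trans (t j j≢v) (d j j≢v))
    N⇒M : RestSwing N v → RestSwing M v
    N⇒M (u , u≢v , p , t) = u , u≢v , trans (d u u≢v) p
      , λ j j≢v → trans (rest-agree u≢v j) (trans (t j j≢v) (sym (d j j≢v)))
    contra : ⊥
    contra with restSwing? M v | true-or-false (M v v)
    ... | yes r | inj₁ p = ¬leafM v (leaf sM (λ _ → r) (λ _ → p))
    ... | yes r | inj₂ p = ¬leafN v (leaf sN (λ _ → M⇒N r) (λ _ →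
      trans (Bool.¬-not (v≢ ∘ sym)) (cong not p)))
    ... | no ¬r | inj₂ p = ¬leafM v (leaf sM (λ q → ⊥-elim (Bool.not-¬ p q)) (⊥-elim ∘ ¬r))
    ... | no ¬r | inj₁ p = ¬leafN v (leaf sN
      (λ q → ⊥-elim (v≢ (trans p (sym q)))) (⊥-elim ∘ ¬r ∘ N⇒M))
  ... | swap v w p q p′ q′ d with true-or-false (M v w)
  ...   | inj₁ e = ⊥-elim (¬leafM w (leaf sM (λ r → ⊥-elim (Bool.not-¬ q r)) (⊥-elim ∘ ¬rest)))
    where
    sM = proj₁ (swap-swing-true cM cN M≡N p q p′ q′ d e)
    sN = proj₂ (swap-swing-true cM cN M≡N p q p′ q′ d e)
    -- Such a `u` is in S for `M` and `N`. It is non-adjacent to `v`, which is swing in `N`, but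
    -- being swing in the rest of `M` it would be adjacent to `v` in K.
    ¬rest : ¬ RestSwing M w
    ¬rest (u , u≢w , r , t) = Bool.not-¬
      (trans (sym (trans (M≡N v≢u) (trans (sN u) (sym (d u (v≢u ∘ sym) u≢w)))))
        (trans (symmetric cM v u) (trans (t v v≢w) p)))
      r
      where
      v≢u : v ≢ u
      v≢u refl = Bool.not-¬ r p
      v≢w : v ≢ w
      v≢w refl = Bool.not-¬ q p
  ...   | inj₂ e = ⊥-elim (¬leafM v (leaf sM (λ _ → w , w≢v , q , rest) (λ _ → p)))
    where
    sM = proj₁ (swap-swing-false cM cN M≡N p q p′ q′ d e)
    sN = proj₂ (swap-swing-false cM cN M≡N p q p′ q′ d e)
    w≢v : w ≢ v
    w≢v refl = Bool.not-¬ q p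
    -- `w` is swing in `N`, and away from `v` and `w` the diagonals agree.
    rest : ∀ j → j ≢ v → M w j ≡ M j j
    rest j j≢v with w ≟ j
    ... | yes refl = refl
    ... | no w≢j   = trans (M≡N w≢j) (trans (sN j) (sym (d j j≢v (w≢j ∘ sym))))

  -- `v` stays swing, so a leaf could only be at `v`; there `RestSwing` ignores the colour of `v`,
  -- which toggling has negated.
  toggled-not-leaf : ∀ {M v} → IsColoured M → IsLeaf M v → ∀ w → ¬ IsLeaf (toggle M v) w
  toggled-not-leaf {M} {v} c l w l′
    with leaf-unique (toggle-coloured c (swing l)) l′ (toggle-swing (swing l))
  ... | refl with true-or-false (M v v)
  ...   | inj₁ p = Bool.not-¬ (trans (toggle-here M v) (cong not p))
    (rest⇒true l′ (transfer (true⇒rest l p)))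
    where
    transfer : RestSwing M v → RestSwing (toggle M v) v
    transfer (u , u≢v , q , t) = u , u≢v , trans (toggle-there M v (inj₁ u≢v)) q
      , λ j j≢v → trans (toggle-there M v (inj₁ u≢v))
          (trans (t j j≢v) (sym (toggle-there M v (inj₁ j≢v))))
  ...   | inj₂ p = Bool.not-¬ p
    (rest⇒true l (transfer (true⇒rest l′ (trans (toggle-here M v) (cong not p)))))
    where
    transfer : RestSwing (toggle M v) v → RestSwing M v
    transfer (u , u≢v , q , t) = u , u≢v , trans (sym (toggle-there M v (inj₁ u≢v))) q
      , λ j j≢v → trans (sym (toggle-there M v (inj₁ u≢v)))
          (trans (t j j≢v) (toggle-there M v (inj₁ j≢v)))

open IsLeaf

-- Adding a swing vertex

size≡1⇒contractible : ∀ I → ∣ I ∣ ≡ 1 → Σ (Elem I) λ i → ∀ j → j ≡ i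
size≡1⇒contractible I p = go p (proj₂ (FinSet.finite I))
  where
  only : (k : Fin 1) → k ≡ zero
  only zero = refl
  go : ∀ {n} → n ≡ 1 → Inverse (setoid (Elem I)) (setoid (Fin n)) → Σ (Elem I) λ i → ∀ j → j ≡ i
  go refl e = Inverse.from e zero , λ j →
    trans (sym (Inverse.strictlyInverseʳ e j)) (cong (Inverse.from e) (only (Inverse.to e j)))

contractible⇒size≡1 : ∀ I (i : Elem I) → (∀ j → j ≡ i) → ∣ I ∣ ≡ 1
contractible⇒size≡1 I i only = ↔⇒≡ (mk↔ₛ′ {A = Fin ∣ I ∣} {B = Fin 1} (λ _ → zero) (λ _ → to i)
  (λ { zero → refl }) (λ k → trans (cong to (sym (only (from k)))) (strictlyInverseˡ k)))
  where open Inverse (proj₂ (FinSet.finite I))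

IsIndicator : ∀ {A : Set} → (A → Bool) → A → Set
IsIndicator χ w = χ w ≡ true × (∀ i → χ i ≡ true → i ≡ w)

indicator : ∀ {I} (χ : Elem I → Bool) → ∣ part I χ true ∣ ≡ 1 → Σ (Elem I) (IsIndicator χ)
indicator {I} χ p = let (w , q) , only = size≡1⇒contractible (part I χ true) p in
  w , q , λ i r → cong proj₁ (only (i , r))

indicator⇒size≡1 : ∀ I {χ w} → IsIndicator χ w → ∣ part I χ true ∣ ≡ 1
indicator⇒size≡1 I {χ} {w} (p , only) =
  contractible⇒size≡1 (part I χ true) (w , p) λ (i , q) → part-≡ (only i q)

module _ (I : FinSet) {χ : Elem I → Bool} {w : Elem I} (ind : IsIndicator χ w) where

  outside⇒≢ : ∀ {i} → χ i ≡ false → i ≢ w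
  outside⇒≢ p refl = Bool.not-¬ p (proj₁ ind)

  ≢⇒outside : ∀ {i} → i ≢ w → χ i ≡ false
  ≢⇒outside {i} i≢w = Bool.¬-not (i≢w ∘ proj₂ ind i)

  -- Links the leaf condition, phrased on all of `I`, with the matrix on the complement of `w`, from
  -- which `plant` takes its colour.
  restSwing⇔hasSwing : ∀ M → RestSwing I M w ⇔ HasSwing false (restriction M χ)
  restSwing⇔hasSwing M = mk⇔
    (λ (v , v≢w , p , s) → (v , ≢⇒outside v≢w) , p , λ (j , q) → s j (outside⇒≢ q))
    (λ ((v , q) , p , s) → v , outside⇒≢ q , p , λ j j≢w → s (j , ≢⇒outside j≢w))

-- The colour that makes the added vertex a leaf. It depends on the remaining matrix alone, hence is
-- natural.
plantColour : ∀ I (χ : Elem I → Bool) → Matrix (part I χ false) → Bool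
plantColour I χ R = does (hasSwing? false (part I χ false) R)

module _ (I : FinSet) where

  plant : Structure (Xˢ *ˢ Cˢ) I → Structure Cˢ I
  plant (pair χ _ (R , c)) =
    extend χ (plantColour I χ R) R , extend-coloured χ (plantColour I χ R) R c

  plant-leaf : ∀ s {w} → IsIndicator (Product.χ s) w → IsLeaf I (proj₁ (plant s)) w
  plant-leaf (pair χ _ (R , c)) {w} ind = leaf (extend-swing χ b R (proj₁ ind))
    (λ p → Equivalence.from (restSwing⇔hasSwing I ind M)
      (hasSwing-resp (λ (i , p) (j , q) → sym (extend≡ χ b R p q))
        (does⇒ (hasSwing? false (part I χ false) R) (trans (sym here) p))))
    (λ r → trans here (dec-true (hasSwing? false (part I χ false) R)
      (hasSwing-resp (λ (i , p) (j , q) → extend≡ χ b R p q)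
        (Equivalence.to (restSwing⇔hasSwing I ind M) r))))
    where
    b = plantColour I χ R
    M = extend χ b R
    here : M w w ≡ b
    here = extend≡ χ b R (proj₁ ind) (proj₁ ind)

module _ {I J : FinSet} (φ : I ≃ J) where

  plantColour-iso : ∀ χ ξ (e : ∀ i → ξ (fwd φ i) ≡ χ i) R Q →
    IsMatrixIso (restrict φ e false) R Q → plantColour J ξ Q ≡ plantColour I χ R
  plantColour-iso χ ξ e R Q iso = does-⇔
    (mk⇔ (hasSwing-iso⁻¹ (restrict φ e false) {R} {Q} iso)
         (hasSwing-iso (restrict φ e false) {R} {Q} iso))
    (hasSwing? false (part J ξ false) Q) (hasSwing? false (part I χ false) R)

  restSwing-iso : ∀ {M N} → IsMatrixIso φ M N → ∀ {w} → RestSwing I M w → RestSwing J N (fwd φ w)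
  restSwing-iso {M} {N} e (v , v≢w , p , s) =
      fwd φ v , v≢w ∘ fwd-injective φ
    , trans (isMatrixIso-fwd φ {M} {N} e v v) p
    , λ j j≢ → trans (e (fwd φ v) j) (trans (cong (λ i → M i (bwd φ j)) (bwd-fwd φ v))
        (trans (s (bwd φ j) λ { refl → j≢ (sym (fwd-bwd φ j)) }) (sym (e j j))))

isMatrixIso-sym : ∀ {I J} (φ : I ≃ J) {M N} → IsMatrixIso φ M N → IsMatrixIso (sym≃ φ) N M
isMatrixIso-sym φ {M} {N} e i j = sym (isMatrixIso-fwd φ {M} {N} e i j)

isLeaf-iso : ∀ {I J} (φ : I ≃ J) {M N} → IsMatrixIso φ M N →
             ∀ {w} → IsLeaf I M w → IsLeaf J N (fwd φ w)
isLeaf-iso {I} φ {M} {N} e {w} (leaf s f g) = leaf (isSwing-iso φ {M} {N} e s)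
  (λ p → restSwing-iso φ {M} {N} e (f (trans (sym (isMatrixIso-fwd φ {M} {N} e w w)) p)))
  (λ r → trans (isMatrixIso-fwd φ {M} {N} e w w) (g (subst (RestSwing I M) (bwd-fwd φ w)
    (restSwing-iso (sym≃ φ) {N} {M} (isMatrixIso-sym φ {M} {N} e) r))))

Centre : MatrixProperty
Centre = record
  { Holds     = λ I M → IsColoured M × (∀ w → ¬ IsLeaf I M w)
  ; holds?    = λ I M → isColoured? I M ×-dec ∀? I (λ w → ¬? (isLeaf? I M w))
  ; invariant = λ φ {M} {N} e (c , h) → isColoured-iso φ {M} {N} e c
                  , λ w l → h _ (isLeaf-iso (sym≃ φ) {N} {M} (isMatrixIso-sym φ {M} {N} e) l)
  }

Zˢ : Species
Zˢ = MatricesWith Centre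

plantOrInclude : ∀ I → Structure (Zˢ +ˢ Xˢ *ˢ Cˢ) I → Structure Cˢ I
plantOrInclude I (inj₁ (M , c , _)) = M , c
plantOrInclude I (inj₂ s)           = plant I s

module _ {I : FinSet} where
  private
    module C = Setoid (Cˢ [ I ])
    module X*C = Setoid ((Xˢ *ˢ Cˢ) [ I ])
    module Source = Setoid ((Zˢ +ˢ Xˢ *ˢ Cˢ) [ I ])

  plant-cong : ∀ s t → s X*C.≈ t → C._≈_ (plant I s) (plant I t)
  plant-cong (pair χ _ (R , _)) (pair ξ _ (Q , _)) (pair≈ p _ v) i j = sym
    (extend-cong id χ _ R ξ _ Q p
      (plantColour-iso id≃ χ ξ p R Q (λ j k → sym (v j k)))
      (λ j k q r q′ r′ → trans (sym (v (j , q) (k , r))) (cong₂ R (part-≡ refl) (part-≡ refl))) i j)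

  plant-injective : ∀ s t → C._≈_ (plant I s) (plant I t) → s X*C.≈ t
  plant-injective s@(pair χ p (R , cR)) t@(pair ξ q (Q , cQ)) e =
    go (indicator {I} χ p) (indicator {I} ξ q)
    where
    go : ∃ (IsIndicator χ) → ∃ (IsIndicator ξ) → s X*C.≈ t
    -- A leaf has only one swing vertex, so both decompositions have planted the same vertex.
    go (v , indχ) (w , indξ) with leaf-unique I (proj₂ (plant I t)) (plant-leaf I t indξ)
      (swing (isLeaf-iso id≃ {proj₁ (plant I s)} {proj₁ (plant I t)}
        (λ i j → sym (e i j)) (plant-leaf I s indχ)))
    ... | refl = pair≈
      (λ i → Bool.⇔→≡ {z = true} (mk⇔
        (λ r → trans (cong χ (proj₂ indξ i r)) (proj₁ indχ))
        (λ r → trans (cong ξ (proj₂ indχ i r)) (proj₁ indξ))))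
      (ℕ.≡-irrelevant _ _)
      (λ (i , p) (j , q) → extend-injective χ _ R ξ _ Q e i j _ _ p q)

  not-planted : ∀ M (z : Holds Centre I M) s → ¬ C._≈_ (M , proj₁ z) (plant I s)
  not-planted M (c , ¬leaf) s@(pair χ p _) e =
    let w , ind = indicator {I} χ p in
    ¬leaf w (isLeaf-iso id≃ {proj₁ (plant I s)} {M} e (plant-leaf I s ind))

  plantOrInclude-cong : ∀ s t → s Source.≈ t → C._≈_ (plantOrInclude I s) (plantOrInclude I t)
  plantOrInclude-cong _ _ (inj₁ e) = e
  plantOrInclude-cong _ _ (inj₂ {s} {t} e) = plant-cong s t e

  plantOrInclude-injective : ∀ s t → C._≈_ (plantOrInclude I s) (plantOrInclude I t) → s Source.≈ t
  plantOrInclude-injective (inj₁ _)       (inj₁ _)       e = inj₁ e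
  plantOrInclude-injective (inj₂ s)       (inj₂ t)       e = inj₂ (plant-injective s t e)
  plantOrInclude-injective (inj₁ (M , z)) (inj₂ t)       e = ⊥-elim (not-planted M z t e)
  plantOrInclude-injective (inj₂ s)       (inj₁ (M , z)) e = ⊥-elim (not-planted M z s λ i j → sym (e i j))

  plant-surjective : ∀ M (c : IsColoured M) w → IsLeaf I M w → ∃[ s ] C._≈_ (plant I s) (M , c)
  plant-surjective M c w l =
      pair χ (indicator⇒size≡1 I ind) (restriction M χ , restriction-coloured χ c)
    , extend-restriction χ c (λ i p → new (proj₂ ind i p))
    where
    χ : Elem I → Bool
    χ i = does (_≟_ I i w)
    ind : IsIndicator χ w
    ind = dec-true (_≟_ I w w) refl , λ i → does⇒ (_≟_ I i w)
    R? = hasSwing? false (part I χ false) (restriction M χ)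
    colour : M w w ≡ does R?
    colour = Bool.⇔→≡ {z = true} (mk⇔
      (λ p → dec-true R? (Equivalence.to (restSwing⇔hasSwing I ind M) (true⇒rest l p)))
      (λ p → rest⇒true l (Equivalence.from (restSwing⇔hasSwing I ind M) (does⇒ R? p))))
    new : ∀ {i} → i ≡ w → M i i ≡ does R? × IsSwing M i
    new refl = colour , swing l

  plantOrInclude-surjective : ∀ t → ∃[ s ] C._≈_ (plantOrInclude I s) t
  plantOrInclude-surjective (M , c) with ∃? I (isLeaf? I M)
  ... | no ¬l       = inj₁ (M , c , λ w l → ¬l (w , l)) , λ _ _ → refl
  ... | yes (w , l) = let s , e = plant-surjective M c w l in inj₂ s , e

plantOrInclude-natural : ∀ {I J} (φ : I ≃ J) s →
  Setoid._≈_ (Cˢ [ J ]) (plantOrInclude J (((Zˢ +ˢ Xˢ *ˢ Cˢ) ⟪ φ ⟫) s))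
                        ((Cˢ ⟪ φ ⟫) (plantOrInclude I s))
plantOrInclude-natural φ (inj₁ _) _ _ = refl
plantOrInclude-natural {I} {J} φ (inj₂ (pair χ _ (R , _))) =
  extend-cong (bwd φ) χ _ R (χ ∘ bwd φ) _ _ (λ _ → refl)
    (plantColour-iso φ χ (χ ∘ bwd φ) (λ i → cong χ (bwd-fwd φ i)) R _ (λ _ _ → refl))
    (λ _ _ _ _ _ _ → cong₂ R (part-≡ refl) (part-≡ refl))

Zˢ+Xˢ*Cˢ≅Cˢ : Zˢ +ˢ Xˢ *ˢ Cˢ ≅ Cˢ
Zˢ+Xˢ*Cˢ≅Cˢ = bijective⇒≅ {Zˢ +ˢ Xˢ *ˢ Cˢ} {Cˢ}
  (λ {I} → plantOrInclude I) (λ {I} {s} {t} → plantOrInclude-cong {I} s t)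
  (λ {I} {J} → plantOrInclude-natural {I} {J})
  (λ {I} {s} {t} → plantOrInclude-injective {I} s t) (λ {I} → plantOrInclude-surjective {I})

-- From matrices to split graphs

module _ (I : FinSet) where

  graphOf : {M : Matrix I} → IsColoured M → Graph I
  graphOf {M} c = graph (recolour I M λ _ → false)
    (recolour-symmetric I (symmetric c)) (recolour-diagonal I M _)

  graphOf-ks : {M : Matrix I} (c : IsColoured M) → IsKSPartition (graphOf c) (λ i → M i i)
  graphOf-ks {M} c = ks
    (λ i j p q i≢j → trans (recolour-off I M _ i≢j) (trans (uniform c i j (trans p (sym q))) p))
    stable′
    where
    stable′ : ∀ i j → M i i ≡ false → M j j ≡ false → adj (graphOf c) i j ≡ false
    stable′ i j p q with _≟_ I i j
    ... | yes _ = refl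
    ... | no _  = trans (uniform c i j (trans p (sym q))) p

  paint : Graph I → (Elem I → Bool) → Matrix I
  paint g = recolour I (adj g)

  paint-off : ∀ g κ {i j} → i ≢ j → paint g κ i j ≡ adj g i j
  paint-off g κ = recolour-off I (adj g) κ

  paint-diagonal : ∀ g κ i → paint g κ i i ≡ κ i
  paint-diagonal g κ = recolour-diagonal I (adj g) κ

  paint-coloured : ∀ {g κ} → IsKSPartition g κ → IsColoured (paint g κ)
  paint-coloured {g} {κ} (ks clique stable) = coloured
    (recolour-symmetric I (adj-sym g))
    (λ i j e → uniform′ i j (trans (sym (paint-diagonal g κ i)) (trans e (paint-diagonal g κ j))))
    where
    uniform′ : ∀ i j → κ i ≡ κ j → paint g κ i j ≡ paint g κ i i
    uniform′ i j e with _≟_ I i j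
    ... | yes refl = sym (paint-diagonal g κ i)
    ... | no i≢j with true-or-false (κ i)
    ...   | inj₁ p = trans (clique i j p (trans (sym e) p) i≢j) (sym (trans (paint-diagonal g κ i) p))
    ...   | inj₂ p = trans (stable i j p (trans (sym e) p)) (sym (trans (paint-diagonal g κ i) p))

  graphOf-paint : ∀ {g κ M} (c : IsColoured M) → (∀ {i j} → i ≢ j → M i j ≡ paint g κ i j) →
                  ∀ i j → adj (graphOf c) i j ≡ adj g i j
  graphOf-paint {g} {κ} c M≡ i j with _≟_ I i j
  ... | yes refl = sym (no-loop g i)
  ... | no i≢j   = trans (M≡ i≢j) (paint-off g κ i≢j)

  off-diagonal : ∀ {M N : Matrix I} (c : IsColoured M) (d : IsColoured N) →
    (∀ i j → adj (graphOf c) i j ≡ adj (graphOf d) i j) → ∀ {i j} → i ≢ j → M i j ≡ N i j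
  off-diagonal {M} {N} c d e {i} {j} i≢j = trans (sym (recolour-off I M _ i≢j))
    (trans (e i j) (recolour-off I N _ i≢j))

  graphOf-cong : ∀ {M N : Matrix I} (c : IsColoured M) (d : IsColoured N) →
    (∀ i j → M i j ≡ N i j) → ∀ i j → adj (graphOf c) i j ≡ adj (graphOf d) i j
  graphOf-cong c d e i j with _≟_ I i j
  ... | yes _ = refl
  ... | no _  = e i j

  rigid-balanced : ∀ {M : Matrix I} (c : IsColoured M) → (∀ v → ¬ IsSwing M v) → IsBalanced (graphOf c)
  rigid-balanced {M} c rigid = (λ i → M i i) , graphOf-ks c , λ κ k i →
    trans (sym (paint-diagonal (graphOf c) κ i))
      (sym (rigid-unique I c (paint-coloured k)
        (λ i≢j → trans (sym (recolour-off I M _ i≢j)) (sym (paint-off (graphOf c) κ i≢j)))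
        rigid i i))

  -- Toggling a swing vertex would give a second KS-partition of `g`.
  balanced-rigid : ∀ {g κ} (k : IsKSPartition g κ) →
    (∀ κ′ → IsKSPartition g κ′ → ∀ i → κ′ i ≡ κ i) → ∀ v → ¬ IsSwing (paint g κ) v
  balanced-rigid {g} {κ} k unique v s = Bool.not-¬
    (trans (unique (λ i → toggle I M v i i) toggled-ks v) (sym (paint-diagonal g κ v)))
    (toggle-here I M v)
    where
    M = paint g κ
    c = toggle-coloured I (paint-coloured k) s
    toggled-ks : IsKSPartition g (λ i → toggle I M v i i)
    toggled-ks = isKSPartition-iso id≃ (graphOf c) g
      (λ i j → sym (graphOf-paint {g} {κ} c (recolour-off I M _) i j)) (graphOf-ks c)

graphOf-natural : ∀ {I J} (φ : I ≃ J) {M : Matrix I} (c : IsColoured M) (d : IsColoured _) j k →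
  adj (graphOf J {λ j k → M (bwd φ j) (bwd φ k)} d) j k ≡ adj (graphOf I c) (bwd φ j) (bwd φ k)
graphOf-natural {I} {J} φ c d j k with _≟_ J j k | _≟_ I (bwd φ j) (bwd φ k)
... | yes _    | yes _ = refl
... | yes refl | no p  = contradiction refl p
... | no p     | yes q = contradiction (fwd-injective (sym≃ φ) q) p
... | no _     | no _  = refl

Sˢ Uˢ : Species
Sˢ = pos S
Uˢ = pos U

module _ (I : FinSet) where
  private
    module S = Setoid (Sˢ [ I ])
    module Z = Setoid (Zˢ [ I ])
    module U+B = Setoid ((Uˢ +ˢ Bˢ) [ I ])

  stripCentre : Structure Zˢ I → Structure Sˢ I
  stripCentre (M , c , _) = graphOf I c , (λ i → M i i) , graphOf-ks I c

  stripCentre-cong : ∀ s t → s Z.≈ t → stripCentre s S.≈ stripCentre t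
  stripCentre-cong (_ , c , _) (_ , d , _) e = graphOf-cong I c d e

  stripCentre-injective : ∀ s t → stripCentre s S.≈ stripCentre t → s Z.≈ t
  stripCentre-injective (_ , c , ¬leaf) (_ , d , ¬leaf′) e =
    centre-unique I c d (off-diagonal I c d e) ¬leaf ¬leaf′

  -- Any KS-partition is the centre or one toggle away from it, so the witness `κ` of splitness
  -- serves whichever it is.
  stripCentre-surjective : ∀ t → Σ (Structure Zˢ I) λ s → stripCentre s S.≈ t
  stripCentre-surjective (g , κ , k) with ∃? I (isLeaf? I (paint I g κ))
  ... | no ¬l       = (paint I g κ , paint-coloured I k , λ w l → ¬l (w , l))
                    , graphOf-paint I {g = g} {κ} (paint-coloured I k) (λ _ → refl)
  ... | yes (w , l) = (toggle I (paint I g κ) w , c , toggled-not-leaf I (paint-coloured I k) l)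
                    , graphOf-paint I {g = g} {κ} c (recolour-off I (paint I g κ) _)
    where
    c = toggle-coloured I (paint-coloured I k) (swing l)

  stripRigid : Structure (Uˢ +ˢ Bˢ) I → Structure Sˢ I
  stripRigid (inj₁ (g , s , _)) = g , s
  stripRigid (inj₂ (M , c , _)) = graphOf I c , (λ i → M i i) , graphOf-ks I c

  stripRigid-cong : ∀ s t → s U+B.≈ t → stripRigid s S.≈ stripRigid t
  stripRigid-cong (inj₁ _) (inj₁ _) (inj₁ e) = e
  stripRigid-cong (inj₂ (_ , c , _)) (inj₂ (_ , d , _)) (inj₂ e) = graphOf-cong I c d e

  unbalanced-not-rigid : ∀ {g M} → IsUnbalanced g → (c : IsColoured M) → (∀ v → ¬ IsSwing M v) →
    ¬ (∀ i j → adj g i j ≡ adj (graphOf I c) i j)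
  unbalanced-not-rigid {g} (_ , ¬b) c rigid e = ¬b
    (balanced-iso id≃ (graphOf I c) g e (rigid-balanced I c rigid))

  stripRigid-injective : ∀ s t → stripRigid s S.≈ stripRigid t → s U+B.≈ t
  stripRigid-injective (inj₁ _) (inj₁ _) e = inj₁ e
  stripRigid-injective (inj₂ (_ , c , rigid)) (inj₂ (_ , d , _)) e =
    inj₂ (rigid-unique I c d (off-diagonal I c d e) rigid)
  stripRigid-injective (inj₁ (g , u)) (inj₂ (_ , c , rigid)) e =
    ⊥-elim (unbalanced-not-rigid {g} u c rigid e)
  stripRigid-injective (inj₂ (_ , c , rigid)) (inj₁ (g , u)) e =
    ⊥-elim (unbalanced-not-rigid {g} u c rigid λ i j → sym (e i j))

  stripRigid-surjective : ∀ t → Σ (Structure (Uˢ +ˢ Bˢ) I) λ s → stripRigid s S.≈ t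
  stripRigid-surjective (g , s) = decide (balanced? g)
    where
    decide : Dec (IsBalanced g) → Σ (Structure (Uˢ +ˢ Bˢ) I) λ t → stripRigid t S.≈ (g , s)
    decide (no ¬b)                = inj₁ (g , s , ¬b) , λ _ _ → refl
    decide (yes (κ , k , unique)) =
        inj₂ (paint I g κ , paint-coloured I k , balanced-rigid I k unique)
      , graphOf-paint I {g = g} {κ} (paint-coloured I k) (λ _ → refl)

stripCentre-natural : ∀ {I J} (φ : I ≃ J) s → Setoid._≈_ (Sˢ [ J ])
  (stripCentre J ((Zˢ ⟪ φ ⟫) s)) ((Sˢ ⟪ φ ⟫) (stripCentre I s))
stripCentre-natural φ (M , c , _) =
  graphOf-natural φ {M} c (isColoured-iso φ {M} (λ _ _ → refl) c)

stripRigid-natural : ∀ {I J} (φ : I ≃ J) s → Setoid._≈_ (Sˢ [ J ])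
  (stripRigid J (((Uˢ +ˢ Bˢ) ⟪ φ ⟫) s)) ((Sˢ ⟪ φ ⟫) (stripRigid I s))
stripRigid-natural φ (inj₁ _) _ _ = refl
stripRigid-natural φ (inj₂ (M , c , _)) =
  graphOf-natural φ {M} c (isColoured-iso φ {M} (λ _ _ → refl) c)

Zˢ≅Sˢ : Zˢ ≅ Sˢ
Zˢ≅Sˢ = bijective⇒≅ {Zˢ} {Sˢ} (λ {I} → stripCentre I)
  (λ {I} {s} {t} → stripCentre-cong I s t) (λ {I} {J} → stripCentre-natural {I} {J})
  (λ {I} {s} {t} → stripCentre-injective I s t) (λ {I} → stripCentre-surjective I)

Uˢ+Bˢ≅Sˢ : Uˢ +ˢ Bˢ ≅ Sˢ
Uˢ+Bˢ≅Sˢ = bijective⇒≅ {Uˢ +ˢ Bˢ} {Sˢ} (λ {I} → stripRigid I)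
  (λ {I} {s} {t} → stripRigid-cong I s t) (λ {I} {J} → stripRigid-natural {I} {J})
  (λ {I} {s} {t} → stripRigid-injective I s t) (λ {I} → stripRigid-surjective I)

Sˢ+Xˢ*Cˢ≅Cˢ : Sˢ +ˢ Xˢ *ˢ Cˢ ≅ Cˢ
Sˢ+Xˢ*Cˢ≅Cˢ = ≅-trans {Sˢ +ˢ Xˢ *ˢ Cˢ} {Zˢ +ˢ Xˢ *ˢ Cˢ} {Cˢ}
  (+ˢ-cong {Sˢ} {Zˢ} {Xˢ *ˢ Cˢ} {Xˢ *ˢ Cˢ} (≅-sym {Zˢ} {Sˢ} Zˢ≅Sˢ) (≅-refl {Xˢ *ˢ Cˢ}))
  Zˢ+Xˢ*Cˢ≅Cˢ

-- Virtual species

-_ : Virtual → Virtual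
- (F ⊖ G) = G ⊖ F

open Differences isCommutativeSemiring +ˢ-cancelʳ using (module Presentation; be+ec≈c+c)
open Presentation pos neg _+_ _-_ _*_ -_ virtual
  (λ _ _ → refl) (λ _ _ → refl) (λ _ _ → refl) (λ _ _ → refl) (λ _ _ → refl)
  (λ _ → refl) (λ _ → refl) (λ _ → refl) (λ _ → refl)
  using (ι-invertible; ι-fraction)

Bˢ*Eˢ+Eˢ*Cˢ≅Cˢ+Cˢ : Bˢ *ˢ Eˢ +ˢ Eˢ *ˢ Cˢ ≅ Cˢ +ˢ Cˢ
Bˢ*Eˢ+Eˢ*Cˢ≅Cˢ+Cˢ = be+ec≈c+c {Bˢ} {Cˢ} {Eˢ} {Nˢ false} {Nˢ true} {Wˢ true}
  Bˢ+Wˢ≅Nˢ (Nˢ+Wˢ≅Cˢ true) (Eˢ*Nˢ≅Cˢ false) (Eˢ*Nˢ≅Cˢ true)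

Xˢ-inhabited : ∀ I → Structure Xˢ I → Elem I
Xˢ-inhabited I p = proj₁ (size≡1⇒contractible I p)

E₊²-inhabited : ∀ I → Structure (E₊ *ˢ E₊) I → Elem I
E₊²-inhabited I (pair χ p _) = proj₁ (positive⇒inhabited (part I χ true) p)

unit : IsUnit ((𝟙 - X) * E)
unit = record { invertible =
  -- Sequences of singletons are the linear orders, the inverse of 1 - X; sequences of pairs of
  -- non-empty sets invert 1 - E₊².
  ι-invertible {Xˢ} {Eˢ} {E₊} {Sequences.seq Xˢ Xˢ-inhabited}
    {Sequences.seq (E₊ *ˢ E₊) E₊²-inhabited} {𝟙} {X} {E}
    refl refl refl
    (Sequences.seq-unfold Xˢ Xˢ-inhabited) Eˢ≅1ˢ+E₊ (Sequences.seq-unfold (E₊ *ˢ E₊) E₊²-inhabited) }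

-- F⁻¹ is kept apart from IsUnit._⁻¹ unit: checking their equality inside a product is
-- prohibitively expensive.

/≡* : ∀ G F (unit : IsUnit F) {F⁻¹} → F⁻¹ ≡ IsUnit._⁻¹ unit → _/_ G F ⦃ unit ⦄ ≡ G * F⁻¹
/≡* _ _ _ refl = refl

theorem2p11 : IsUnit ((𝟙 - X) * E) ×
    (⦃ _ : IsUnit ((𝟙 - X) * E) ⦄ → U ≈ ((𝟚 - X) * E - 𝟚) / ((𝟙 - X) * E) * S)
-- The quotient uses whichever inverse the instance carries; it enters through `A*A⁻¹≈𝟙`, so the
-- formula holds for each choice.
theorem2p11 = unit , λ ⦃ unit ⦄ → let A⁻¹ , _ , A*A⁻¹≈𝟙 = IsUnit.invertible unit in
  ι-fraction {Bˢ} {Cˢ} {Eˢ} {Sˢ} {Uˢ} {Xˢ} {𝟙} {𝟚} {X} {E} {S} {U}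
    {A⁻¹} {_/_ ((𝟚 - X) * E - 𝟚) ((𝟙 - X) * E) ⦃ unit ⦄}
    refl refl refl refl refl refl
    Sˢ+Xˢ*Cˢ≅Cˢ Uˢ+Bˢ≅Sˢ Bˢ*Eˢ+Eˢ*Cˢ≅Cˢ+Cˢ A*A⁻¹≈𝟙
    (/≡* ((𝟚 - X) * E - 𝟚) ((𝟙 - X) * E) unit {A⁻¹} refl)
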